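{- Let $M(n)$, $T^\ast(n)$, $P^\ast(n)$ be defined by $$\sum_{n\ge 0} M(n)q^n=\frac{f_2^5f_5^5}{f_1f_{10}},\quad \sum_{n\ge 0} T^\ast(n)q^n=\frac{f_1^5f_{10}^5}{f_2f_5},\quad \sum_{n\ge0}P^\ast(n)q^n=f_1^4f_5^4.$$ Define integer sequences $(A_k)_{k\ge0}$, $(B_k)_{k\ge0}$, $(C_k)_{k\ge0}$ by $A_0=A_1=1$, $B_0=0$, $B_1=1$, $C_0=1$, $C_1=-4$, and for $k\geq 2$, $$A_k=-4A_{k-1}-8A_{k-2}+5\cdot 2^{k-1},\quad B_k=-4B_{k-1}-8B_{k-2}+5\cdot 2^{k-1},\quad C_k=-4C_{k-1}-8C_{k-2}.$$ Then for all $k\geq 1$, \begin{align*} \sum_{n=-1}^\infty M(2^kn+2^{k+1}-1)q^n &= A_k\frac{f_1^4f_5^4}{q}-8A_{k-1}f_2^4f_{10}^4+5\cdot 2^kf_1f_2f_5^3f_{10}^3,\\ \sum_{n=-1}^\infty T^\ast(2^kn+2^{k+1}-2)q^n &= B_k\frac{f_1^4f_5^4}{q}-8B_{k-1}f_2^4f_{10}^4+5\cdot 2^kf_1f_2f_5^3f_{10}^3,\\ \sum_{n=-1}^\infty P^\ast(2^kn+2^{k+1}-1)q^n &= C_k\frac{f_1^4f_5^4}{q}-8C_{k-1}f_2^4f_{10}^4. \end{align*}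
   Context: For a positive integer $m$, $f_m:=\prod_{n=1}^\infty(1-q^{mn})$, regarded as a formal power series in $q$ (identities are of formal Laurent series in $q$). -}

module Defs where

open import Data.Nat as ℕ using (ℕ; zero; suc; _∸_; _≡ᵇ_)
open import Data.Bool using (if_then_else_)
open import Data.Integer using (ℤ; +_; -_; _+_; _-_; _*_; 0ℤ; 1ℤ)

Series : Set
Series = ℕ → ℤ

sumTo : ℕ → (ℕ → ℤ) → ℤ
sumTo zero    g = 0ℤ
sumTo (suc n) g = sumTo n g + g n

infixl 6 _⊕_ _⊖_
infixl 7 _⊛_ _·_
infixr 8 _^ˢ_

_⊕_ : Series → Series → Series
(a ⊕ b) n = a n + b n

_⊖_ : Series → Series → Series
(a ⊖ b) n = a n - b n

_·_ : ℤ → Series → Series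
(c · a) n = c * a n

_⊛_ : Series → Series → Series
(a ⊛ b) n = sumTo (suc n) (λ i → a i * b (n ∸ i))

oneS : Series
oneS zero    = 1ℤ
oneS (suc n) = 0ℤ

mono : ℕ → Series
mono d n = if n ≡ᵇ d then 1ℤ else 0ℤ

qTimes : Series → Series
qTimes a zero    = 0ℤ
qTimes a (suc n) = a n

_^ˢ_ : Series → ℕ → Series
a ^ˢ zero  = oneS
a ^ˢ suc k = a ⊛ (a ^ˢ k)

etaTrunc : ℕ → ℕ → Series
etaTrunc m zero    = oneS
etaTrunc m (suc N) = etaTrunc m N ⊛ (oneS ⊖ mono (m ℕ.* suc N))

-- f_m = ∏_{n≥1} (1 - q^{m n}) as a formal power series: for m ≥ 1 the
-- coefficient of q^n is already determined by the factors with j ≤ n.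
f : ℕ → Series
f m n = etaTrunc m n n

A : ℕ → ℤ
A zero          = 1ℤ
A (suc zero)    = 1ℤ
A (suc (suc k)) = - (+ 4) * A (suc k) - (+ 8) * A k + (+ 5) * (+ (2 ℕ.^ suc k))

B : ℕ → ℤ
B zero          = 0ℤ
B (suc zero)    = 1ℤ
B (suc (suc k)) = - (+ 4) * B (suc k) - (+ 8) * B k + (+ 5) * (+ (2 ℕ.^ suc k))

C : ℕ → ℤ
C zero          = 1ℤ
C (suc zero)    = - (+ 4)
C (suc (suc k)) = - (+ 4) * C (suc k) - (+ 8) * C k

{-# OPTIONS --safe #-}
module Submission where

-- Write F = f₁⁴f₅⁴, G = f₁f₂f₅³f₁₀³, K = F(q²) and t = q f₂f₁₀³ / (f₁³f₅).  Two level 10 relations,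
--   f₅⁴f₂² = f₁⁴f₁₀² (1 + 4t)   and   f₂⁵f₅ = f₁⁵f₁₀ (1 + 5t),
-- turn the three generating functions into rational functions of t:
--   M t = qK(1 + 4t),  T(1 + 5t) = K,  F t = qG,  G(1 + 5t) = K(1 + 4t).
-- If s = t(-q) and r = t(q²), comparing eta products gives t s = -r(1 + 4r) and
-- (1 + 4t)(1 + 4s) = (1 + 4r)², hence t + s = 6r + 20r², so even and odd parts are symmetric
-- functions of t and s that can be computed in terms of r.  The outcome is the case k = 1 together with
--   odd F = -4F - 8qK,  even G = F + 2qG,
-- and applying "odd part" repeatedly yields the recurrences of A, B and C.
-- The two relations are dissections of φ(q)² and ψ(q)² along the ideal (1 + 2i) of ℤ[i], each coset
-- contributing a product of two theta series, which the Jacobi triple product turns into eta products.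

open import Defs
open import Data.Nat using (ℕ; _≤_; _∸_; _^_) renaming (_*_ to _*ℕ_; _+_ to _+ℕ_)
open import Data.Integer using (ℤ; +_; -_) renaming (_*_ to _*ℤ_)
open import Data.Product using (_×_)
open import Relation.Binary.PropositionalEquality

open import Data.Nat as ℕ using (zero; suc; _<_; z≤n; s≤s)
import Data.Nat.Properties as ℕₚ
import Data.Nat.Tactic.RingSolver as ℕ-Solver
open import Data.Integer as ℤ using (-[1+_]; 0ℤ; 1ℤ)
import Data.Integer.Properties as ℤₚ
import Data.Integer.Solver
open import Data.Integer.Tactic.RingSolver using () renaming (solve-∀ to ℤ-solve-∀)
open import Data.List using (List; []; _∷_)
open import Data.Maybe using (Maybe; just; nothing)
open import Data.Product using (_,_; ∃)
open import Data.Sum using (inj₁; inj₂)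
open import Function.Base using (it)
open import Level using (0ℓ)
open import Relation.Nullary using (yes; no)
open import Algebra.Bundles using (AbelianGroup; CommutativeRing; RawRing)
import Algebra.Properties.Group
import Algebra.Properties.Semiring.Exp
import Algebra.Solver.Ring
open import Algebra.Solver.Ring.AlmostCommutativeRing using (_-Raw-AlmostCommutative⟶_; fromCommutativeRing)
import Relation.Binary.Reasoning.Setoid

-- Power series

-- The choice of `t` comes from modular curves: X_0(10) has genus 0 and four cusps, and `t` is the
-- eta quotient with a simple zero at infinity and a simple pole at 0. An eta quotient with constant
-- term 1, a simple pole at 0 and a simple zero at one of the other two cusps must be 1 + ct; this
-- is the origin of 1 + 4t and 1 + 5t. The proof itself is formal. Nothing is ever divided. A
-- quotient is an equation with its denominators multiplied out, and the cancelled factors are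
-- series with constant term 1, powers of q and nonzero integers; a(q) + a(-q) therefore stays
-- doubled. Identities of eta products become ideal memberships over the ring of series, with
-- explicit cofactors that the ring solver checks. Infinite sums and products exist only modulo
-- powers of q. The triple product is the limit of a finite identity whose exponents are natural
-- numbers, so series in one variable suffice, and sums over the integers are finite for each
-- coefficient. The claim is multiplied by q: with m = n + 1 all sums start at m = 0 and no negative
-- exponent occurs.

infix 4 _≈_

-- A record instead of bare pointwise equality, so that `a` and `b` can be inferred from the type of
-- a proof.
record _≈_ (a b : Series) : Set where
  constructor pointwise
  field at : ∀ n → a n ≡ b n
open _≈_ public

sumTo-cong : ∀ n {g h : ℕ → ℤ} → (∀ i → i < n → g i ≡ h i) → sumTo n g ≡ sumTo n h
sumTo-cong zero    eq = refl
sumTo-cong (suc n) eq =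
  cong₂ ℤ._+_ (sumTo-cong n λ i i<n → eq i (ℕₚ.m<n⇒m<1+n i<n)) (eq n ℕₚ.≤-refl)

sumTo-cong′ : ∀ n {g h : ℕ → ℤ} → (∀ i → g i ≡ h i) → sumTo n g ≡ sumTo n h
sumTo-cong′ n eq = sumTo-cong n λ i _ → eq i

sumTo-+ : ∀ n (g h : ℕ → ℤ) → sumTo n (λ i → g i ℤ.+ h i) ≡ sumTo n g ℤ.+ sumTo n h
sumTo-+ zero    g h = refl
sumTo-+ (suc n) g h =
  trans (cong (ℤ._+ (g n ℤ.+ h n)) (sumTo-+ n g h)) (interchange (sumTo n g) (sumTo n h) (g n) (h n))
  where
  interchange : ∀ a b c d → (a ℤ.+ b) ℤ.+ (c ℤ.+ d) ≡ (a ℤ.+ c) ℤ.+ (b ℤ.+ d)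
  interchange = ℤ-solve-∀

sumTo-*ˡ : ∀ n c (g : ℕ → ℤ) → sumTo n (λ i → c ℤ.* g i) ≡ c ℤ.* sumTo n g
sumTo-*ˡ zero    c g = sym (ℤₚ.*-zeroʳ c)
sumTo-*ˡ (suc n) c g =
  trans (cong (ℤ._+ c ℤ.* g n) (sumTo-*ˡ n c g)) (sym (ℤₚ.*-distribˡ-+ c (sumTo n g) (g n)))

sumTo-0 : ∀ n → sumTo n (λ _ → 0ℤ) ≡ 0ℤ
sumTo-0 zero    = refl
sumTo-0 (suc n) = trans (ℤₚ.+-identityʳ _) (sumTo-0 n)

sumTo-suc : ∀ n (g : ℕ → ℤ) → sumTo (suc n) g ≡ g 0 ℤ.+ sumTo n (λ i → g (suc i))
sumTo-suc zero    g = trans (ℤₚ.+-identityˡ (g 0)) (sym (ℤₚ.+-identityʳ (g 0)))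
sumTo-suc (suc n) g =
  trans (cong (ℤ._+ g (suc n)) (sumTo-suc n g)) (ℤₚ.+-assoc (g 0) _ _)

sumTo-swap : ∀ m n (g : ℕ → ℕ → ℤ) →
  sumTo m (λ i → sumTo n (g i)) ≡ sumTo n (λ j → sumTo m (λ i → g i j))
sumTo-swap zero    n g = sym (sumTo-0 n)
sumTo-swap (suc m) n g =
  trans (cong (ℤ._+ sumTo n (g m)) (sumTo-swap m n g)) (sym (sumTo-+ n _ (g m)))

sumTo-split : ∀ m n (g : ℕ → ℤ) →
  sumTo (m ℕ.+ n) g ≡ sumTo m g ℤ.+ sumTo n (λ i → g (m ℕ.+ i))
sumTo-split zero    n g = sym (ℤₚ.+-identityˡ _)
sumTo-split (suc m) n g = begin
  sumTo (suc m ℕ.+ n) g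
    ≡⟨ sumTo-suc (m ℕ.+ n) g ⟩
  g 0 ℤ.+ sumTo (m ℕ.+ n) (λ i → g (suc i))
    ≡⟨ cong (ℤ._+_ (g 0)) (sumTo-split m n _) ⟩
  g 0 ℤ.+ (sumTo m (λ i → g (suc i)) ℤ.+ sumTo n (λ i → g (suc m ℕ.+ i)))
    ≡⟨ sym (ℤₚ.+-assoc (g 0) _ _) ⟩
  g 0 ℤ.+ sumTo m (λ i → g (suc i)) ℤ.+ sumTo n (λ i → g (suc m ℕ.+ i))
    ≡⟨ cong (ℤ._+ sumTo n (λ i → g (suc m ℕ.+ i))) (sym (sumTo-suc m g)) ⟩
  sumTo (suc m) g ℤ.+ sumTo n (λ i → g (suc m ℕ.+ i)) ∎
  where open ≡-Reasoning

tail : Series → Series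
tail a n = a (suc n)

⊛-suc : ∀ a b n → (a ⊛ b) (suc n) ≡ a 0 ℤ.* b (suc n) ℤ.+ (tail a ⊛ b) n
⊛-suc a b n = sumTo-suc (suc n) (λ i → a i ℤ.* b (suc n ∸ i))

⊛-zero : ∀ a b → (a ⊛ b) 0 ≡ a 0 ℤ.* b 0
⊛-zero a b = ℤₚ.+-identityˡ _

⊛-last : ∀ a b n → (a ⊛ b) n ≡ sumTo n (λ i → a i ℤ.* b (n ∸ i)) ℤ.+ a n ℤ.* b 0
⊛-last a b n = cong (λ k → sumTo n (λ i → a i ℤ.* b (n ∸ i)) ℤ.+ a n ℤ.* b k) (ℕₚ.n∸n≡0 n)

⊛-sucʳ : ∀ a b n → (a ⊛ b) (suc n) ≡ (a ⊛ tail b) n ℤ.+ a (suc n) ℤ.* b 0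
⊛-sucʳ a b n = trans (⊛-last a b (suc n)) (cong (ℤ._+ a (suc n) ℤ.* b 0)
  (sumTo-cong (suc n) λ { i (s≤s i≤n) → cong (λ k → a i ℤ.* b k) (ℕₚ.+-∸-assoc 1 i≤n) }))

-- Congruence modulo q^(n+1), the relation through which all limits are taken.
record Agree (n : ℕ) (a b : Series) : Set where
  constructor upTo
  field upto : ∀ i → i ≤ n → a i ≡ b i
open Agree public

agree-refl : ∀ {n a} → Agree n a a
agree-refl = upTo λ _ _ → refl

agree-sym : ∀ {n a b} → Agree n a b → Agree n b a
agree-sym p = upTo λ i i≤n → sym (upto p i i≤n)

agree-trans : ∀ {n a b c} → Agree n a b → Agree n b c → Agree n a c
agree-trans p q = upTo λ i i≤n → trans (upto p i i≤n) (upto q i i≤n)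

agree-≤ : ∀ {m n a b} → m ≤ n → Agree n a b → Agree m a b
agree-≤ m≤n p = upTo λ i i≤m → upto p i (ℕₚ.≤-trans i≤m m≤n)

≈⇒agree : ∀ {n a b} → a ≈ b → Agree n a b
≈⇒agree p = upTo λ i _ → at p i

agree⇒≈ : ∀ {a b} → (∀ n → Agree n a b) → a ≈ b
agree⇒≈ p = pointwise λ n → upto (p n) n ℕₚ.≤-refl

⊛-agree : ∀ {n a a′ b b′} → Agree n a a′ → Agree n b b′ → Agree n (a ⊛ b) (a′ ⊛ b′)
⊛-agree p q = upTo λ i i≤n → sumTo-cong (suc i) λ { j (s≤s j≤i) →
  cong₂ ℤ._*_ (upto p j (ℕₚ.≤-trans j≤i i≤n)) (upto q (i ∸ j) (ℕₚ.≤-trans (ℕₚ.m∸n≤m i j) i≤n)) }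

⊕-agree : ∀ {n a a′ b b′} → Agree n a a′ → Agree n b b′ → Agree n (a ⊕ b) (a′ ⊕ b′)
⊕-agree p q = upTo λ i i≤n → cong₂ ℤ._+_ (upto p i i≤n) (upto q i i≤n)

≈-refl : ∀ {a} → a ≈ a
≈-refl = pointwise λ _ → refl

≈-sym : ∀ {a b} → a ≈ b → b ≈ a
≈-sym p = pointwise λ n → sym (at p n)

≈-trans : ∀ {a b c} → a ≈ b → b ≈ c → a ≈ c
≈-trans p q = pointwise λ n → trans (at p n) (at q n)

⊛-cong : ∀ {a a′ b b′} → a ≈ a′ → b ≈ b′ → a ⊛ b ≈ a′ ⊛ b′
⊛-cong p q = agree⇒≈ λ n → ⊛-agree (≈⇒agree p) (≈⇒agree q)

zeroS : Series
zeroS _ = 0ℤ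

zeroS-⊛ : ∀ a → zeroS ⊛ a ≈ zeroS
zeroS-⊛ a = pointwise λ n → sumTo-0 (suc n)

const-⊛ : ∀ c a → (c · oneS) ⊛ a ≈ c · a
const-⊛ c a = pointwise lem
  where
  lem : ∀ n → ((c · oneS) ⊛ a) n ≡ c ℤ.* a n
  lem zero    = trans (⊛-zero (c · oneS) a) (cong (ℤ._* a 0) (ℤₚ.*-identityʳ c))
  lem (suc n) = begin
    ((c · oneS) ⊛ a) (suc n)
      ≡⟨ ⊛-suc (c · oneS) a n ⟩
    c ℤ.* 1ℤ ℤ.* a (suc n) ℤ.+ (tail (c · oneS) ⊛ a) n
      ≡⟨ cong₂ ℤ._+_ (cong (ℤ._* a (suc n)) (ℤₚ.*-identityʳ c))
           (at (⊛-cong {b = a} (pointwise λ _ → ℤₚ.*-zeroʳ c) ≈-refl) n) ⟩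
    c ℤ.* a (suc n) ℤ.+ (zeroS ⊛ a) n
      ≡⟨ cong (ℤ._+_ (c ℤ.* a (suc n))) (at (zeroS-⊛ a) n) ⟩
    c ℤ.* a (suc n) ℤ.+ 0ℤ
      ≡⟨ ℤₚ.+-identityʳ _ ⟩
    c ℤ.* a (suc n) ∎
    where open ≡-Reasoning

⊛-identityˡ : ∀ a → oneS ⊛ a ≈ a
⊛-identityˡ a = ≈-trans (⊛-cong {b = a} (pointwise λ n → sym (ℤₚ.*-identityˡ (oneS n))) ≈-refl)
  (≈-trans (const-⊛ 1ℤ a) (pointwise λ n → ℤₚ.*-identityˡ (a n)))

⊛-comm : ∀ a b → a ⊛ b ≈ b ⊛ a
⊛-comm a b = pointwise (lem a b)
  where
  lem : ∀ a b n → (a ⊛ b) n ≡ (b ⊛ a) n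
  lem a b zero    = trans (⊛-zero a b) (trans (ℤₚ.*-comm (a 0) (b 0)) (sym (⊛-zero b a)))
  lem a b (suc n) = begin
    (a ⊛ b) (suc n)                            ≡⟨ ⊛-suc a b n ⟩
    a 0 ℤ.* b (suc n) ℤ.+ (tail a ⊛ b) n       ≡⟨ ℤₚ.+-comm _ ((tail a ⊛ b) n) ⟩
    (tail a ⊛ b) n ℤ.+ a 0 ℤ.* b (suc n)       ≡⟨ cong₂ ℤ._+_ (lem (tail a) b n) (ℤₚ.*-comm (a 0) _) ⟩
    (b ⊛ tail a) n ℤ.+ b (suc n) ℤ.* a 0       ≡⟨ sym (⊛-sucʳ b a n) ⟩
    (b ⊛ a) (suc n) ∎
    where open ≡-Reasoning

⊛-distribʳ : ∀ c a b → (a ⊕ b) ⊛ c ≈ a ⊛ c ⊕ b ⊛ c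
⊛-distribʳ c a b = pointwise λ n → trans
  (sumTo-cong′ (suc n) λ i → ℤₚ.*-distribʳ-+ (c (n ∸ i)) (a i) (b i))
  (sumTo-+ (suc n) _ _)

·-⊛ : ∀ c a b → (c · a) ⊛ b ≈ c · (a ⊛ b)
·-⊛ c a b = pointwise λ n → trans
  (sumTo-cong′ (suc n) λ i → ℤₚ.*-assoc c (a i) (b (n ∸ i)))
  (sumTo-*ˡ (suc n) c _)

⊛-assoc : ∀ a b c → (a ⊛ b) ⊛ c ≈ a ⊛ (b ⊛ c)
⊛-assoc a b c = pointwise λ n → lem n a
  where
  lem : ∀ n a → ((a ⊛ b) ⊛ c) n ≡ (a ⊛ (b ⊛ c)) n
  lem zero a = begin
    ((a ⊛ b) ⊛ c) 0           ≡⟨ trans (⊛-zero (a ⊛ b) c) (cong (ℤ._* c 0) (⊛-zero a b)) ⟩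
    (a 0 ℤ.* b 0) ℤ.* c 0     ≡⟨ ℤₚ.*-assoc (a 0) (b 0) (c 0) ⟩
    a 0 ℤ.* (b 0 ℤ.* c 0)     ≡⟨ sym (trans (⊛-zero a (b ⊛ c)) (cong (a 0 ℤ.*_) (⊛-zero b c))) ⟩
    (a ⊛ (b ⊛ c)) 0 ∎
    where open ≡-Reasoning
  lem (suc n) a = begin
    ((a ⊛ b) ⊛ c) (suc n)
      ≡⟨ ⊛-suc (a ⊛ b) c n ⟩
    (a ⊛ b) 0 ℤ.* c (suc n) ℤ.+ (tail (a ⊛ b) ⊛ c) n
      ≡⟨ cong₂ (λ x y → x ℤ.* c (suc n) ℤ.+ y) (⊛-zero a b)
           (at (⊛-cong {b = c} (pointwise (⊛-suc a b)) ≈-refl) n) ⟩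
    a 0 ℤ.* b 0 ℤ.* c (suc n) ℤ.+ ((a 0 · tail b ⊕ tail a ⊛ b) ⊛ c) n
      ≡⟨ cong (ℤ._+_ (a 0 ℤ.* b 0 ℤ.* c (suc n))) (at (⊛-distribʳ c (a 0 · tail b) (tail a ⊛ b)) n) ⟩
    a 0 ℤ.* b 0 ℤ.* c (suc n) ℤ.+ (((a 0 · tail b) ⊛ c) n ℤ.+ ((tail a ⊛ b) ⊛ c) n)
      ≡⟨ cong₂ (λ x y → a 0 ℤ.* b 0 ℤ.* c (suc n) ℤ.+ (x ℤ.+ y))
           (at (·-⊛ (a 0) (tail b) c) n) (lem n (tail a)) ⟩
    a 0 ℤ.* b 0 ℤ.* c (suc n) ℤ.+ (a 0 ℤ.* (tail b ⊛ c) n ℤ.+ (tail a ⊛ (b ⊛ c)) n)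
      ≡⟨ rearrange (a 0) (b 0) (c (suc n)) ((tail b ⊛ c) n) ((tail a ⊛ (b ⊛ c)) n) ⟩
    a 0 ℤ.* (b 0 ℤ.* c (suc n) ℤ.+ (tail b ⊛ c) n) ℤ.+ (tail a ⊛ (b ⊛ c)) n
      ≡⟨ cong (λ x → a 0 ℤ.* x ℤ.+ (tail a ⊛ (b ⊛ c)) n) (sym (⊛-suc b c n)) ⟩
    a 0 ℤ.* (b ⊛ c) (suc n) ℤ.+ (tail a ⊛ (b ⊛ c)) n
      ≡⟨ sym (⊛-suc a (b ⊛ c) n) ⟩
    (a ⊛ (b ⊛ c)) (suc n) ∎
    where
    open ≡-Reasoning
    rearrange : ∀ x y z v w →
      x ℤ.* y ℤ.* z ℤ.+ (x ℤ.* v ℤ.+ w) ≡ x ℤ.* (y ℤ.* z ℤ.+ v) ℤ.+ w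
    rearrange = ℤ-solve-∀

-- Doubling by recursion: `dbl (suc n)` reduces to two successors, which definitions by parity can
-- match on, and on literals it computes, so that `dbl 5` is 10.
dbl : ℕ → ℕ
dbl zero    = zero
dbl (suc n) = suc (suc (dbl n))

dbl-∸ : ∀ n i → dbl n ∸ dbl i ≡ dbl (n ∸ i)
dbl-∸ n       zero    = refl
dbl-∸ zero    (suc i) = refl
dbl-∸ (suc n) (suc i) = dbl-∸ n i

sucdbl-∸ : ∀ n i → i ≤ n → suc (dbl n) ∸ dbl i ≡ suc (dbl (n ∸ i))
sucdbl-∸ n       zero    _         = refl
sucdbl-∸ (suc n) (suc i) (s≤s i≤n) = sucdbl-∸ n i i≤n

sumTo-dbl : ∀ n g → sumTo (dbl n) g ≡ sumTo n (λ i → g (dbl i)) ℤ.+ sumTo n (λ i → g (suc (dbl i)))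
sumTo-dbl zero    g = refl
sumTo-dbl (suc n) g = trans (cong (λ x → x ℤ.+ g (dbl n) ℤ.+ g (suc (dbl n))) (sumTo-dbl n g))
  (rearrange (sumTo n (λ i → g (dbl i))) (sumTo n (λ i → g (suc (dbl i)))) (g (dbl n)) (g (suc (dbl n))))
  where
  rearrange : ∀ a b c d → a ℤ.+ b ℤ.+ c ℤ.+ d ≡ (a ℤ.+ c) ℤ.+ (b ℤ.+ d)
  rearrange = ℤ-solve-∀


-- Even exponents arise from two even ones or from two odd ones; (2i + 1) + (2j + 1) = 2(i + j + 1)
-- explains the factor q on the second product.
⊛-dbl : ∀ a b n → (a ⊛ b) (dbl n) ≡
  ((λ i → a (dbl i)) ⊛ (λ i → b (dbl i)) ⊕ qTimes ((λ i → a (suc (dbl i))) ⊛ (λ i → b (suc (dbl i))))) n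
⊛-dbl a b = λ
  { zero    → sym (ℤₚ.+-identityʳ ((a ⊛ b) 0))
  ; (suc n) → begin
      (a ⊛ b) (dbl (suc n))
        ≡⟨ cong (ℤ._+ term (suc n) (dbl (suc n))) (sumTo-dbl (suc n) (term (suc n))) ⟩
      sumTo (suc n) (λ i → term (suc n) (dbl i)) ℤ.+ sumTo (suc n) (λ i → term (suc n) (suc (dbl i)))
        ℤ.+ term (suc n) (dbl (suc n))
        ≡⟨ rearrange (sumTo (suc n) (λ i → term (suc n) (dbl i))) (sumTo (suc n) (λ i → term (suc n) (suc (dbl i)))) (term (suc n) (dbl (suc n))) ⟩
      sumTo (suc (suc n)) (λ i → term (suc n) (dbl i)) ℤ.+ sumTo (suc n) (λ i → term (suc n) (suc (dbl i)))
        ≡⟨ cong₂ ℤ._+_ (sumTo-cong′ (suc (suc n)) λ i → cong (λ k → a (dbl i) ℤ.* b k) (dbl-∸ (suc n) i))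
             (sumTo-cong (suc n) λ { i (s≤s i≤n) → cong (λ k → a (suc (dbl i)) ℤ.* b k) (sucdbl-∸ n i i≤n) }) ⟩
      ((λ i → a (dbl i)) ⊛ (λ i → b (dbl i)) ⊕ qTimes ((λ i → a (suc (dbl i))) ⊛ (λ i → b (suc (dbl i))))) (suc n) ∎ }
  where
  open ≡-Reasoning
  term : ℕ → ℕ → ℤ
  term n i = a i ℤ.* b (dbl n ∸ i)
  rearrange : ∀ x y z → x ℤ.+ y ℤ.+ z ≡ x ℤ.+ z ℤ.+ y
  rearrange = ℤ-solve-∀

⊛-sucdbl : ∀ a b n → (a ⊛ b) (suc (dbl n)) ≡
  ((λ i → a (dbl i)) ⊛ (λ i → b (suc (dbl i))) ⊕ (λ i → a (suc (dbl i))) ⊛ (λ i → b (dbl i))) n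
⊛-sucdbl a b n = trans (sumTo-dbl (suc n) (λ i → a i ℤ.* b (suc (dbl n) ∸ i)))
  (cong₂ ℤ._+_
    (sumTo-cong (suc n) λ { i (s≤s i≤n) → cong (λ k → a (dbl i) ℤ.* b k) (sucdbl-∸ n i i≤n) })
    (sumTo-cong′ (suc n) λ i → cong (λ k → a (suc (dbl i)) ℤ.* b k) (dbl-∸ n i)))

-- The commutative ring of power series and its solver

infixl 7 _⊗_
infixl 6 _⊞_
infix  8 ⊟_

-- Opaque, so that unification does not unfold series identities into coefficients.
opaque
  _⊗_ _⊞_ : Series → Series → Series
  a ⊗ b = a ⊛ b
  a ⊞ b = a ⊕ b

  ⊟_ even odd : Series → Series
  (⊟ a) n = ℤ.- a n
  even a n = a (dbl n)
  odd  a n = a (suc (dbl n))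

  const : ℤ → Series
  const c = c · oneS

  ⊗-def : ∀ a b → a ⊗ b ≈ a ⊛ b
  ⊗-def a b = ≈-refl

  ⊞-at : ∀ a b n → (a ⊞ b) n ≡ a n ℤ.+ b n
  ⊞-at a b n = refl

  ⊟-at : ∀ a n → (⊟ a) n ≡ ℤ.- a n
  ⊟-at a n = refl

  even-at : ∀ a n → even a n ≡ a (dbl n)
  even-at a n = refl

  odd-at : ∀ a n → odd a n ≡ a (suc (dbl n))
  odd-at a n = refl

  const-⊗-at : ∀ c a n → (const c ⊗ a) n ≡ c ℤ.* a n
  const-⊗-at c a n = at (const-⊛ c a) n

  const-at : ∀ c n → const c n ≡ c ℤ.* oneS n
  const-at c n = refl

  even-⊗ : ∀ a b → even (a ⊗ b) ≈ even a ⊗ even b ⊞ qTimes (odd a ⊗ odd b)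
  even-⊗ a b = pointwise (⊛-dbl a b)

  odd-⊗ : ∀ a b → odd (a ⊗ b) ≈ even a ⊗ odd b ⊞ odd a ⊗ even b
  odd-⊗ a b = pointwise (⊛-sucdbl a b)

  ⊗-zero : ∀ a b → (a ⊗ b) 0 ≡ a 0 ℤ.* b 0
  ⊗-zero = ⊛-zero

  ⊗-suc : ∀ a b n → (a ⊗ b) (suc n) ≡ a 0 ℤ.* b (suc n) ℤ.+ (tail a ⊗ b) n
  ⊗-suc = ⊛-suc

  ⊗-last : ∀ a b n → (a ⊗ b) n ≡ sumTo n (λ i → a i ℤ.* b (n ∸ i)) ℤ.+ a n ℤ.* b 0
  ⊗-last = ⊛-last

  ⊗-agree : ∀ {n a a′ b b′} → Agree n a a′ → Agree n b b′ → Agree n (a ⊗ b) (a′ ⊗ b′)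
  ⊗-agree {n} {a} {a′} {b} {b′} = ⊛-agree {n} {a} {a′} {b} {b′}

  ⊞-agree : ∀ {n a a′ b b′} → Agree n a a′ → Agree n b b′ → Agree n (a ⊞ b) (a′ ⊞ b′)
  ⊞-agree {n} {a} {a′} {b} {b′} = ⊕-agree {n} {a} {a′} {b} {b′}

  zeroS-⊗ : ∀ a → zeroS ⊗ a ≈ zeroS
  zeroS-⊗ = zeroS-⊛

  ⊗-identityˡ : ∀ a → oneS ⊗ a ≈ a
  ⊗-identityˡ = ⊛-identityˡ

  ⊗-comm : ∀ a b → a ⊗ b ≈ b ⊗ a
  ⊗-comm = ⊛-comm

  ⊗-assoc : ∀ a b c → (a ⊗ b) ⊗ c ≈ a ⊗ (b ⊗ c)
  ⊗-assoc = ⊛-assoc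

  ⊗-distribʳ : ∀ c a b → (a ⊞ b) ⊗ c ≈ a ⊗ c ⊞ b ⊗ c
  ⊗-distribʳ = ⊛-distribʳ

  ⊞-assoc : ∀ a b c → (a ⊞ b) ⊞ c ≈ a ⊞ (b ⊞ c)
  ⊞-assoc a b c = pointwise λ n → ℤₚ.+-assoc (a n) (b n) (c n)

  ⊞-comm : ∀ a b → a ⊞ b ≈ b ⊞ a
  ⊞-comm a b = pointwise λ n → ℤₚ.+-comm (a n) (b n)

  ⊞-identityˡ : ∀ a → zeroS ⊞ a ≈ a
  ⊞-identityˡ a = pointwise λ n → ℤₚ.+-identityˡ (a n)

  ⊟-inverseˡ : ∀ a → ⊟ a ⊞ a ≈ zeroS
  ⊟-inverseˡ a = pointwise λ n → ℤₚ.+-inverseˡ (a n)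

  const-⊞ : ∀ c d → const (c ℤ.+ d) ≈ const c ⊞ const d
  const-⊞ c d = pointwise λ n → ℤₚ.*-distribʳ-+ (oneS n) c d

  const-⊗ : ∀ c d → const (c ℤ.* d) ≈ const c ⊗ const d
  const-⊗ c d = ≈-sym (≈-trans (const-⊛ c (const d)) (pointwise λ n → sym (ℤₚ.*-assoc c d (oneS n))))

  const-⊟ : ∀ c → const (ℤ.- c) ≈ ⊟ const c
  const-⊟ c = pointwise λ n → sym (ℤₚ.neg-distribˡ-* c (oneS n))

⊗-cong : ∀ {a a′ b b′} → a ≈ a′ → b ≈ b′ → a ⊗ b ≈ a′ ⊗ b′
⊗-cong p r = agree⇒≈ λ n → ⊗-agree (≈⇒agree p) (≈⇒agree r)

⊞-cong : ∀ {a a′ b b′} → a ≈ a′ → b ≈ b′ → a ⊞ b ≈ a′ ⊞ b′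
⊞-cong p r = agree⇒≈ λ n → ⊞-agree (≈⇒agree p) (≈⇒agree r)

⊟-cong : ∀ {a b} → a ≈ b → ⊟ a ≈ ⊟ b
⊟-cong {a} {b} p = pointwise λ n → trans (⊟-at a n) (trans (cong ℤ.-_ (at p n)) (sym (⊟-at b n)))

const-0 : const 0ℤ ≈ zeroS
const-0 = pointwise λ n → const-at 0ℤ n

const-1 : const 1ℤ ≈ oneS
const-1 = pointwise λ n → trans (const-at 1ℤ n) (ℤₚ.*-identityˡ (oneS n))

seriesRing : CommutativeRing 0ℓ 0ℓ
seriesRing = record
  { Carrier = Series ; _≈_ = _≈_ ; _+_ = _⊞_ ; _*_ = _⊗_ ; -_ = ⊟_ ; 0# = zeroS ; 1# = oneS
  ; isCommutativeRing = record
    { isRing = record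
      { +-isAbelianGroup = record
        { isGroup = record
          { isMonoid = record
            { isSemigroup = record
              { isMagma = record
                { isEquivalence = record { refl = ≈-refl ; sym = ≈-sym ; trans = ≈-trans }
                ; ∙-cong = ⊞-cong }
              ; assoc = ⊞-assoc }
            ; identity = ⊞-identityˡ , λ a → ≈-trans (⊞-comm a zeroS) (⊞-identityˡ a) }
          ; inverse = ⊟-inverseˡ , λ a → ≈-trans (⊞-comm a (⊟ a)) (⊟-inverseˡ a)
          ; ⁻¹-cong = ⊟-cong }
        ; comm = ⊞-comm }
      ; *-cong = ⊗-cong
      ; *-assoc = ⊗-assoc
      ; *-identity = ⊗-identityˡ , λ a → ≈-trans (⊗-comm a oneS) (⊗-identityˡ a)
      ; distrib = (λ a b c → ≈-trans (⊗-comm a (b ⊞ c)) (≈-trans (⊗-distribʳ a b c)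
                    (⊞-cong (⊗-comm b a) (⊗-comm c a))))
                , ⊗-distribʳ }
    ; *-comm = ⊗-comm } }

ℤ-rawRing : RawRing 0ℓ 0ℓ
ℤ-rawRing = CommutativeRing.rawRing ℤₚ.+-*-commutativeRing

-- With the integers as coefficient ring, embedded by `const`, the solver computes with numerical
-- constants instead of treating them as atoms.
const-morphism : ℤ-rawRing -Raw-AlmostCommutative⟶ fromCommutativeRing seriesRing
const-morphism = record
  { ⟦_⟧ = const ; +-homo = const-⊞ ; *-homo = const-⊗ ; -‿homo = const-⊟
  ; 0-homo = const-0 ; 1-homo = const-1 }

const-≟ : (c d : ℤ) → Maybe (const c ≈ const d)
const-≟ c d with c ℤ.≟ d
... | yes refl = just ≈-refl
... | no  _    = nothing

module S = Algebra.Solver.Ring ℤ-rawRing (fromCommutativeRing seriesRing) const-morphism const-≟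

module ≈R = Relation.Binary.Reasoning.Setoid (CommutativeRing.setoid seriesRing)

open S using (solve; con; _:*_; _:+_; _:=_; :-_; _:-_; _:^_)
open Algebra.Properties.Semiring.Exp (CommutativeRing.semiring seriesRing) using () renaming (_^_ to _^^_)

-- Powers of q, cancellation and inverses

private module ℤ+ = Algebra.Properties.Group (AbelianGroup.group ℤₚ.+-0-abelianGroup)
tail-cong : ∀ {a b} → a ≈ b → tail a ≈ tail b
tail-cong p = pointwise λ n → at p (suc n)

qTimes-cong : ∀ {a b} → a ≈ b → qTimes a ≈ qTimes b
qTimes-cong p = pointwise λ { zero → refl ; (suc n) → at p n }

qTimes-agree : ∀ {n a b} → Agree n a b → Agree (suc n) (qTimes a) (qTimes b)
qTimes-agree p = upTo λ { zero _ → refl ; (suc i) (s≤s i≤n) → upto p i i≤n }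

mono-zero : mono 0 ≈ oneS
mono-zero = pointwise λ { zero → refl ; (suc n) → refl }

mono-suc : ∀ d → mono (suc d) ≈ qTimes (mono d)
mono-suc d = pointwise λ { zero → refl ; (suc n) → refl }

qTimes-⊗ : ∀ a b → qTimes a ⊗ b ≈ qTimes (a ⊗ b)
qTimes-⊗ a b = pointwise λ
  { zero    → ⊗-zero (qTimes a) b
  ; (suc n) → trans (⊗-suc (qTimes a) b n) (ℤₚ.+-identityˡ ((a ⊗ b) n)) }

mono-zero-⊗ : ∀ a → mono 0 ⊗ a ≈ a
mono-zero-⊗ a = ≈-trans (⊗-cong mono-zero ≈-refl) (⊗-identityˡ a)

mono-suc-⊗ : ∀ d a → mono (suc d) ⊗ a ≈ qTimes (mono d ⊗ a)
mono-suc-⊗ d a = ≈-trans (⊗-cong (mono-suc d) ≈-refl) (qTimes-⊗ (mono d) a)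

qTimes≈ : ∀ a → qTimes a ≈ mono 1 ⊗ a
qTimes≈ a = ≈-sym (≈-trans (mono-suc-⊗ 0 a) (qTimes-cong (mono-zero-⊗ a)))

mono-⊗ : ∀ d e → mono d ⊗ mono e ≈ mono (d ℕ.+ e)
mono-⊗ zero    e = mono-zero-⊗ (mono e)
mono-⊗ (suc d) e = ≈-trans (mono-suc-⊗ d (mono e))
  (≈-trans (qTimes-cong (mono-⊗ d e)) (≈-sym (mono-suc (d ℕ.+ e))))

-- A factor q^e raises the precision from d to e + d. In the triple product this gain compensates
-- for the coarse approximation of the terms far from the centre.
mono-⊗-agree : ∀ e {d u} → Agree d u oneS → Agree (e ℕ.+ d) (mono e ⊗ u) (mono e)
mono-⊗-agree zero p = agree-trans (≈⇒agree (mono-zero-⊗ _)) (agree-trans p (≈⇒agree (≈-sym mono-zero)))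
mono-⊗-agree (suc e) p = agree-trans (≈⇒agree (mono-suc-⊗ e _))
  (agree-trans (qTimes-agree (mono-⊗-agree e p)) (≈⇒agree (≈-sym (mono-suc e))))

mono-small : ∀ d i → i < d → mono d i ≡ 0ℤ
mono-small (suc d) zero    _         = refl
mono-small (suc d) (suc i) (s≤s i<d) = mono-small d i i<d

mono-agree-0 : ∀ {n d} → n < d → Agree n (mono d) zeroS
mono-agree-0 n<d = upTo λ i i≤n → mono-small _ i (ℕₚ.≤-<-trans i≤n n<d)

-- Coefficientwise division: once all lower coefficients agree, the coefficient of q^m in the
-- product determines that of the factor, because `c` has leading coefficient 1.
agree-cancel : ∀ {n a b} c → c 0 ≡ 1ℤ → Agree n (a ⊗ c) (b ⊗ c) → Agree n a b
agree-cancel {n} {a} {b} c c₀ p = upTo λ i i≤n → lem (suc i) (s≤s i≤n) i ℕₚ.≤-refl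
  where
  lem : ∀ m → m ≤ suc n → ∀ i → i < m → a i ≡ b i
  lem (suc m) (s≤s m≤n) i (s≤s i≤m) with ℕₚ.m≤n⇒m<n∨m≡n i≤m
  ... | inj₁ i<m  = lem m (ℕₚ.m≤n⇒m≤1+n m≤n) i i<m
  ... | inj₂ refl = ℤ+.∙-cancelˡ (sumTo m (λ j → b j ℤ.* c (m ∸ j))) (a m) (b m) (begin
    sumTo m (λ j → b j ℤ.* c (m ∸ j)) ℤ.+ a m
      ≡⟨ cong₂ ℤ._+_ (sumTo-cong m (λ j j<m → cong (ℤ._* c (m ∸ j)) (sym (lem m (ℕₚ.m≤n⇒m≤1+n m≤n) j j<m)))) (times-c₀ a) ⟩
    sumTo m (λ j → a j ℤ.* c (m ∸ j)) ℤ.+ a m ℤ.* c 0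
      ≡⟨ sym (⊗-last a c m) ⟩
    (a ⊗ c) m
      ≡⟨ upto p m m≤n ⟩
    (b ⊗ c) m
      ≡⟨ ⊗-last b c m ⟩
    sumTo m (λ j → b j ℤ.* c (m ∸ j)) ℤ.+ b m ℤ.* c 0
      ≡⟨ cong (ℤ._+_ (sumTo m (λ j → b j ℤ.* c (m ∸ j)))) (sym (times-c₀ b)) ⟩
    sumTo m (λ j → b j ℤ.* c (m ∸ j)) ℤ.+ b m ∎)
    where
    open ≡-Reasoning
    times-c₀ : ∀ x → x m ≡ x m ℤ.* c 0
    times-c₀ x = sym (trans (cong (x m ℤ.*_) c₀) (ℤₚ.*-identityʳ (x m)))

⊗-cancelʳ : ∀ {a b} c → c 0 ≡ 1ℤ → a ⊗ c ≈ b ⊗ c → a ≈ b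
⊗-cancelʳ c c₀ p = agree⇒≈ λ n → agree-cancel c c₀ (≈⇒agree p)

const-cancel : ∀ c .{{_ : ℤ.NonZero c}} {a b} → const c ⊗ a ≈ const c ⊗ b → a ≈ b
const-cancel c {a} {b} p = pointwise λ n → ℤₚ.*-cancelˡ-≡ c (a n) (b n)
  (trans (sym (const-⊗-at c a n)) (trans (at p n) (const-⊗-at c b n)))

-- Partial sums of the geometric series ∑ (1 - a)^k.
geometric : Series → ℕ → Series
geometric a zero    = oneS
geometric a (suc N) = oneS ⊞ (oneS ⊞ ⊟ a) ⊗ geometric a N

inverse : Series → Series
inverse a n = geometric a n n

-- A factor divisible by q gains one degree of precision, which makes the geometric sums converge.
⊗-agree-suc : ∀ {n u a b} → u 0 ≡ 0ℤ → Agree n a b → Agree (suc n) (u ⊗ a) (u ⊗ b)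
⊗-agree-suc {n} {u} {a} {b} u₀ p = upTo λ
  { zero    _         → trans (vanish a) (sym (vanish b))
  ; (suc i) (s≤s i≤n) → trans (peel a i) (trans (upto (⊗-agree (agree-refl {a = tail u}) p) i i≤n) (sym (peel b i))) }
  where
  vanish : ∀ x → (u ⊗ x) 0 ≡ 0ℤ
  vanish x = trans (⊗-zero u x) (trans (cong (ℤ._* x 0) u₀) (ℤₚ.*-zeroˡ (x 0)))
  peel : ∀ x i → (u ⊗ x) (suc i) ≡ (tail u ⊗ x) i
  peel x i = trans (⊗-suc u x i) (trans
    (cong (λ y → y ℤ.* x (suc i) ℤ.+ (tail u ⊗ x) i) u₀) (ℤₚ.+-identityˡ ((tail u ⊗ x) i)))

1-a-zero : ∀ a → a 0 ≡ 1ℤ → (oneS ⊞ ⊟ a) 0 ≡ 0ℤ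
1-a-zero a a₀ = trans (⊞-at oneS (⊟ a) 0) (cong (ℤ._+_ 1ℤ) (trans (⊟-at a 0) (cong ℤ.-_ a₀)))

geometric-step : ∀ a → a 0 ≡ 1ℤ → ∀ N → Agree N (geometric a N) (geometric a (suc N))
geometric-step a a₀ zero    = upTo λ { .0 z≤n → sym (trans (⊞-at oneS ((oneS ⊞ ⊟ a) ⊗ oneS) 0)
  (cong (ℤ._+_ 1ℤ) (trans (⊗-zero (oneS ⊞ ⊟ a) oneS) (cong (ℤ._* 1ℤ) (1-a-zero a a₀))))) }
geometric-step a a₀ (suc N) = ⊞-agree agree-refl
  (⊗-agree-suc (1-a-zero a a₀) (geometric-step a a₀ N))

stabilise : (s : ℕ → Series) → (∀ N → Agree N (s N) (s (suc N))) → ∀ m n → m ≤ n → Agree m (s n) (s m)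
stabilise s step m n m≤n with ℕₚ.m≤n⇒∃[o]m+o≡n m≤n
... | o , refl = go o
  where
  go : ∀ o → Agree m (s (m ℕ.+ o)) (s m)
  go zero    = subst (λ k → Agree m (s k) (s m)) (sym (ℕₚ.+-identityʳ m)) agree-refl
  go (suc o) = subst (λ k → Agree m (s k) (s m)) (sym (ℕₚ.+-suc m o))
    (agree-trans (agree-sym (agree-≤ (ℕₚ.m≤m+n m o) (step (m ℕ.+ o)))) (go o))

-- The series whose i-th coefficient is read from the i-th approximation is the limit of the
-- approximations. `inverse` and `prodInf` are diagonals of this kind, and so is `f`.
diagonal : ∀ (s : ℕ → Series) → (∀ N → Agree N (s N) (s (suc N))) → ∀ m n → m ≤ n → Agree m (s n) (λ i → s i i)
diagonal s step m n m≤n = upTo λ i i≤m → upto (stabilise s step i n (ℕₚ.≤-trans i≤m m≤n)) i ℕₚ.≤-refl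

inverse-⊗ : ∀ a → a 0 ≡ 1ℤ → inverse a ⊗ a ≈ oneS
inverse-⊗ a a₀ = agree⇒≈ λ n → agree-trans
  (⊗-agree (agree-sym (diagonal (geometric a) (geometric-step a a₀) n n ℕₚ.≤-refl)) agree-refl)
  (agree-trans (≈⇒agree (telescope (geometric a n)))
  (agree-trans (⊞-agree (⊞-agree (geometric-step a a₀ n) agree-refl) agree-refl)
  (≈⇒agree (collapse (geometric a (suc n))))))
  where
  open ≈R
  -- The expression inside the negation is the next geometric sum, which cancels against g to the
  -- required precision.
  telescope : ∀ g → g ⊗ a ≈ g ⊞ ⊟ (oneS ⊞ (oneS ⊞ ⊟ a) ⊗ g) ⊞ oneS
  telescope g = begin
    g ⊗ a
      ≈⟨ solve 3 (λ a g o → g :* a := g :+ :- (o :+ (con 1ℤ :+ :- a) :* g) :+ o) ≈-refl a g oneS ⟩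
    g ⊞ ⊟ (oneS ⊞ (const 1ℤ ⊞ ⊟ a) ⊗ g) ⊞ oneS
      ≈⟨ ⊞-cong (⊞-cong (≈-refl {g}) (⊟-cong (⊞-cong (≈-refl {oneS}) (⊗-cong
           (⊞-cong const-1 (≈-refl {⊟ a})) (≈-refl {g}))))) (≈-refl {oneS}) ⟩
    g ⊞ ⊟ (oneS ⊞ (oneS ⊞ ⊟ a) ⊗ g) ⊞ oneS ∎
  collapse : ∀ g → g ⊞ ⊟ g ⊞ oneS ≈ oneS
  collapse g = solve 2 (λ g o → g :+ :- g :+ o := o) ≈-refl g oneS

-- Bisection of series

even-cong : ∀ {a b} → a ≈ b → even a ≈ even b
even-cong {a} {b} p = pointwise λ n → trans (even-at a n) (trans (at p (dbl n)) (sym (even-at b n)))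

odd-cong : ∀ {a b} → a ≈ b → odd a ≈ odd b
odd-cong {a} {b} p = pointwise λ n → trans (odd-at a n) (trans (at p (suc (dbl n))) (sym (odd-at b n)))

dbl-induction : ∀ {P : ℕ → Set} → (∀ n → P (dbl n)) → (∀ n → P (suc (dbl n))) → ∀ n → P n
dbl-induction e o zero          = e 0
dbl-induction e o (suc zero)    = o 0
dbl-induction {P} e o (suc (suc n)) =
  dbl-induction {λ m → P (suc (suc m))} (λ m → e (suc m)) (λ m → o (suc m)) n

even-odd-≈ : ∀ {a b} → even a ≈ even b → odd a ≈ odd b → a ≈ b
even-odd-≈ {a} {b} p r = pointwise (dbl-induction
  (λ n → trans (sym (even-at a n)) (trans (at p n) (even-at b n)))
  (λ n → trans (sym (odd-at a n)) (trans (at r n) (odd-at b n))))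

even-⊞ : ∀ a b → even (a ⊞ b) ≈ even a ⊞ even b
even-⊞ a b = pointwise λ n → trans (even-at (a ⊞ b) n) (trans (⊞-at a b (dbl n))
  (sym (trans (⊞-at (even a) (even b) n) (cong₂ ℤ._+_ (even-at a n) (even-at b n)))))

odd-⊞ : ∀ a b → odd (a ⊞ b) ≈ odd a ⊞ odd b
odd-⊞ a b = pointwise λ n → trans (odd-at (a ⊞ b) n) (trans (⊞-at a b (suc (dbl n)))
  (sym (trans (⊞-at (odd a) (odd b) n) (cong₂ ℤ._+_ (odd-at a n) (odd-at b n)))))

merge : Series → Series → Series
merge e o zero          = e 0
merge e o (suc zero)    = o 0
merge e o (suc (suc n)) = merge (tail e) (tail o) n

even-merge : ∀ e o → even (merge e o) ≈ e
even-merge e o = pointwise λ n → trans (even-at (merge e o) n) (lem n e o)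
  where
  lem : ∀ n e o → merge e o (dbl n) ≡ e n
  lem zero    e o = refl
  lem (suc n) e o = lem n (tail e) (tail o)

odd-merge : ∀ e o → odd (merge e o) ≈ o
odd-merge e o = pointwise λ n → trans (odd-at (merge e o) n) (lem n e o)
  where
  lem : ∀ n e o → merge e o (suc (dbl n)) ≡ o n
  lem zero    e o = refl
  lem (suc n) e o = lem n (tail e) (tail o)

-- The substitutions q ↦ q² and q ↦ -q.
opaque
  V ν : Series → Series
  V a = merge a zeroS
  ν a = merge (even a) (⊟ odd a)

  even-V : ∀ a → even (V a) ≈ a
  even-V a = even-merge a zeroS

  odd-V : ∀ a → odd (V a) ≈ zeroS
  odd-V a = odd-merge a zeroS

  even-ν : ∀ a → even (ν a) ≈ even a
  even-ν a = even-merge (even a) (⊟ odd a)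

  odd-ν : ∀ a → odd (ν a) ≈ ⊟ odd a
  odd-ν a = odd-merge (even a) (⊟ odd a)

V-cong : ∀ {a b} → a ≈ b → V a ≈ V b
V-cong {a} {b} p = even-odd-≈ (≈-trans (even-V a) (≈-trans p (≈-sym (even-V b))))
                      (≈-trans (odd-V a) (≈-sym (odd-V b)))

ν-cong : ∀ {a b} → a ≈ b → ν a ≈ ν b
ν-cong {a} {b} p = even-odd-≈ (≈-trans (even-ν a) (≈-trans (even-cong p) (≈-sym (even-ν b))))
                      (≈-trans (odd-ν a) (≈-trans (⊟-cong (odd-cong p)) (≈-sym (odd-ν b))))

V-⊞ : ∀ a b → V (a ⊞ b) ≈ V a ⊞ V b
V-⊞ a b = even-odd-≈
  (≈-trans (even-V (a ⊞ b)) (≈-trans (⊞-cong (≈-sym (even-V a)) (≈-sym (even-V b))) (≈-sym (even-⊞ (V a) (V b)))))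
  (≈-trans (odd-V (a ⊞ b)) (≈-trans (≈-sym (⊞-identityˡ zeroS))
    (≈-trans (⊞-cong (≈-sym (odd-V a)) (≈-sym (odd-V b))) (≈-sym (odd-⊞ (V a) (V b))))))

ν-⊞ : ∀ a b → ν (a ⊞ b) ≈ ν a ⊞ ν b
ν-⊞ a b = even-odd-≈
  (≈-trans (even-ν (a ⊞ b)) (≈-trans (even-⊞ a b)
    (≈-trans (⊞-cong (≈-sym (even-ν a)) (≈-sym (even-ν b))) (≈-sym (even-⊞ (ν a) (ν b))))))
  (≈-trans (odd-ν (a ⊞ b)) (≈-trans (⊟-cong (odd-⊞ a b))
    (≈-trans (solve 2 (λ x y → :- (x :+ y) := :- x :+ :- y) ≈-refl (odd a) (odd b))
    (≈-trans (⊞-cong (≈-sym (odd-ν a)) (≈-sym (odd-ν b))) (≈-sym (odd-⊞ (ν a) (ν b)))))))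

q : Series
q = mono 1

V-⊗ : ∀ a b → V (a ⊗ b) ≈ V a ⊗ V b
V-⊗ a b = even-odd-≈ evens odds
  where
  open ≈R
  odd-V₀ : ∀ a → odd (V a) ≈ const 0ℤ
  odd-V₀ a = ≈-trans (odd-V a) (≈-sym const-0)
  evens : even (V (a ⊗ b)) ≈ even (V a ⊗ V b)
  evens = begin
    even (V (a ⊗ b))              ≈⟨ even-V (a ⊗ b) ⟩
    a ⊗ b                         ≈⟨ solve 3 (λ q a b → a :* b := a :* b :+ q :* (con 0ℤ :* con 0ℤ)) ≈-refl q a b ⟩
    a ⊗ b ⊞ q ⊗ (const 0ℤ ⊗ const 0ℤ)
      ≈⟨ ⊞-cong (⊗-cong (even-V a) (even-V b)) (⊗-cong (≈-refl {q}) (⊗-cong (odd-V₀ a) (odd-V₀ b))) ⟨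
    even (V a) ⊗ even (V b) ⊞ q ⊗ (odd (V a) ⊗ odd (V b))
      ≈⟨ ⊞-cong (≈-refl {even (V a) ⊗ even (V b)}) (qTimes≈ (odd (V a) ⊗ odd (V b))) ⟨
    even (V a) ⊗ even (V b) ⊞ qTimes (odd (V a) ⊗ odd (V b))
      ≈⟨ even-⊗ (V a) (V b) ⟨
    even (V a ⊗ V b) ∎
  odds : odd (V (a ⊗ b)) ≈ odd (V a ⊗ V b)
  odds = begin
    odd (V (a ⊗ b))               ≈⟨ odd-V (a ⊗ b) ⟩
    zeroS                         ≈⟨ const-0 ⟨
    const 0ℤ                      ≈⟨ solve 2 (λ a b → con 0ℤ := a :* con 0ℤ :+ con 0ℤ :* b) ≈-refl a b ⟩
    a ⊗ const 0ℤ ⊞ const 0ℤ ⊗ b   ≈⟨ ⊞-cong (⊗-cong (even-V a) (odd-V₀ b)) (⊗-cong (odd-V₀ a) (even-V b)) ⟨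
    even (V a) ⊗ odd (V b) ⊞ odd (V a) ⊗ even (V b) ≈⟨ odd-⊗ (V a) (V b) ⟨
    odd (V a ⊗ V b) ∎

ν-⊗ : ∀ a b → ν (a ⊗ b) ≈ ν a ⊗ ν b
ν-⊗ a b = even-odd-≈ evens odds
  where
  open ≈R
  evens : even (ν (a ⊗ b)) ≈ even (ν a ⊗ ν b)
  evens = begin
    even (ν (a ⊗ b))              ≈⟨ even-ν (a ⊗ b) ⟩
    even (a ⊗ b)                  ≈⟨ even-⊗ a b ⟩
    even a ⊗ even b ⊞ qTimes (odd a ⊗ odd b)
      ≈⟨ ⊞-cong (⊗-cong (even-ν a) (even-ν b)) (qTimes-cong (≈-trans (⊗-cong (odd-ν a) (odd-ν b))
          (solve 2 (λ x y → (:- x) :* (:- y) := x :* y) ≈-refl (odd a) (odd b)))) ⟨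
    even (ν a) ⊗ even (ν b) ⊞ qTimes (odd (ν a) ⊗ odd (ν b))
      ≈⟨ even-⊗ (ν a) (ν b) ⟨
    even (ν a ⊗ ν b) ∎
  odds : odd (ν (a ⊗ b)) ≈ odd (ν a ⊗ ν b)
  odds = begin
    odd (ν (a ⊗ b))               ≈⟨ odd-ν (a ⊗ b) ⟩
    ⊟ (odd (a ⊗ b))            ≈⟨ ⊟-cong (odd-⊗ a b) ⟩
    ⊟ (even a ⊗ odd b ⊞ odd a ⊗ even b)
      ≈⟨ solve 4 (λ x y z w → :- (x :* y :+ z :* w) := x :* (:- y) :+ (:- z) :* w) ≈-refl (even a) (odd b) (odd a) (even b) ⟩
    even a ⊗ ⊟ (odd b) ⊞ ⊟ (odd a) ⊗ even b
      ≈⟨ ⊞-cong (⊗-cong (even-ν a) (odd-ν b)) (⊗-cong (odd-ν a) (even-ν b)) ⟨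
    even (ν a) ⊗ odd (ν b) ⊞ odd (ν a) ⊗ even (ν b) ≈⟨ odd-⊗ (ν a) (ν b) ⟨
    odd (ν a ⊗ ν b) ∎

even-const : ∀ c → even (const c) ≈ const c
even-const c = pointwise λ n → trans (even-at (const c) n) (trans (const-at c (dbl n))
  (trans (lem n) (sym (const-at c n))))
  where
  lem : ∀ n → c ℤ.* oneS (dbl n) ≡ c ℤ.* oneS n
  lem zero    = refl
  lem (suc n) = refl

odd-const : ∀ c → odd (const c) ≈ zeroS
odd-const c = pointwise λ n → trans (odd-at (const c) n) (trans (const-at c (suc (dbl n))) (ℤₚ.*-zeroʳ c))

V-const : ∀ c → V (const c) ≈ const c
V-const c = even-odd-≈ (≈-trans (even-V (const c)) (≈-sym (even-const c)))
                       (≈-trans (odd-V (const c)) (≈-sym (odd-const c)))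

V-one : V oneS ≈ oneS
V-one = ≈-trans (V-cong (≈-sym const-1)) (≈-trans (V-const 1ℤ) const-1)

⊟-zeroS : ⊟ zeroS ≈ zeroS
⊟-zeroS = pointwise λ n → ⊟-at zeroS n

ν-V : ∀ a → ν (V a) ≈ V a
ν-V a = even-odd-≈ (even-ν (V a)) (≈-trans (odd-ν (V a))
  (≈-trans (⊟-cong (odd-V a)) (≈-trans ⊟-zeroS (≈-sym (odd-V a)))))

ν-const : ∀ c → ν (const c) ≈ const c
ν-const c = ≈-trans (ν-cong (≈-sym (V-const c))) (≈-trans (ν-V (const c)) (V-const c))

ν-one : ν oneS ≈ oneS
ν-one = ≈-trans (ν-cong (≈-sym V-one)) (≈-trans (ν-V oneS) V-one)

even-mono : ∀ d → even (mono (dbl d)) ≈ mono d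
even-mono d = pointwise λ n → trans (even-at (mono (dbl d)) n) (lem d n)
  where
  lem : ∀ d n → mono (dbl d) (dbl n) ≡ mono d n
  lem zero    zero    = refl
  lem zero    (suc n) = refl
  lem (suc d) zero    = refl
  lem (suc d) (suc n) = lem d n

odd-mono : ∀ d → odd (mono (dbl d)) ≈ zeroS
odd-mono d = pointwise λ n → trans (odd-at (mono (dbl d)) n) (lem d n)
  where
  lem : ∀ d n → mono (dbl d) (suc (dbl n)) ≡ 0ℤ
  lem zero    n       = refl
  lem (suc d) zero    = refl
  lem (suc d) (suc n) = lem d n

V-mono : ∀ d → V (mono d) ≈ mono (dbl d)
V-mono d = even-odd-≈ (≈-trans (even-V (mono d)) (≈-sym (even-mono d)))
                      (≈-trans (odd-V (mono d)) (≈-sym (odd-mono d)))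

ν-mono-even : ∀ d → ν (mono (dbl d)) ≈ mono (dbl d)
ν-mono-even d = ≈-trans (ν-cong (≈-sym (V-mono d))) (≈-trans (ν-V (mono d)) (V-mono d))

even-q : ∀ a → even (q ⊗ a) ≈ q ⊗ odd a
even-q a = ≈-trans (even-cong (≈-sym (qTimes≈ a)))
  (≈-trans (pointwise λ { zero → even-at (qTimes a) 0 ; (suc n) → trans (even-at (qTimes a) (suc n)) (sym (odd-at a n)) })
  (qTimes≈ (odd a)))

odd-q : ∀ a → odd (q ⊗ a) ≈ even a
odd-q a = ≈-trans (odd-cong (≈-sym (qTimes≈ a)))
  (pointwise λ n → trans (odd-at (qTimes a) n) (sym (even-at a n)))

-- Together with `⊟-ν` this is how a bisection is computed: symmetric functions of `t` and `s`
-- evaluate the left side, and the 2 is cancelled later.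
⊞-ν : ∀ a → a ⊞ ν a ≈ const (+ 2) ⊗ V (even a)
⊞-ν a = ≈-trans (even-odd-≈
  (≈-trans (even-⊞ a (ν a)) (≈-trans (⊞-cong (≈-sym (even-V (even a))) (≈-trans (even-ν a) (≈-sym (even-V (even a)))))
    (≈-sym (even-⊞ (V (even a)) (V (even a))))))
  (≈-trans (odd-⊞ a (ν a)) (≈-trans (⊞-cong (≈-refl {odd a}) (odd-ν a))
    (≈-trans (CommutativeRing.-‿inverseʳ seriesRing (odd a)) (≈-trans (≈-sym (⊞-identityˡ zeroS))
    (≈-trans (⊞-cong (≈-sym (odd-V (even a))) (≈-sym (odd-V (even a)))) (≈-sym (odd-⊞ (V (even a)) (V (even a))))))))))
  (solve 1 (λ x → x :+ x := con (+ 2) :* x) ≈-refl (V (even a)))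

q-split : ∀ a → a ≈ V (even a) ⊞ q ⊗ V (odd a)
q-split a = even-odd-≈
  (≈-trans (≈-trans (≈-sym (⊞-identityʳ (even a))) (⊞-cong (≈-sym (even-V (even a)))
    (≈-sym (≈-trans (even-q (V (odd a))) (≈-trans (⊗-cong (≈-refl {q}) (odd-V (odd a)))
      (≈-trans (⊗-comm q zeroS) (zeroS-⊗ q))))))) (≈-sym (even-⊞ (V (even a)) (q ⊗ V (odd a)))))
  (≈-trans (≈-trans (≈-sym (⊞-identityˡ (odd a))) (⊞-cong (≈-sym (odd-V (even a)))
    (≈-sym (≈-trans (odd-q (V (odd a))) (even-V (odd a)))))) (≈-sym (odd-⊞ (V (even a)) (q ⊗ V (odd a)))))
  where open CommutativeRing seriesRing using () renaming (+-identityʳ to ⊞-identityʳ)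

⊟-ν : ∀ a → a ⊞ ⊟ ν a ≈ const (+ 2) ⊗ (q ⊗ V (odd a))
⊟-ν a = begin
  a ⊞ ⊟ ν a
    ≈⟨ solve 2 (λ x y → x :+ :- y := con (+ 2) :* x :- (x :+ y)) ≈-refl a (ν a) ⟩
  const (+ 2) ⊗ a ⊞ ⊟ (a ⊞ ν a)
    ≈⟨ ⊞-cong (⊗-cong (≈-refl {const (+ 2)}) (q-split a)) (⊟-cong (⊞-ν a)) ⟩
  const (+ 2) ⊗ (V (even a) ⊞ q ⊗ V (odd a)) ⊞ ⊟ (const (+ 2) ⊗ V (even a))
    ≈⟨ solve 2 (λ x y → con (+ 2) :* (x :+ y) :- con (+ 2) :* x := con (+ 2) :* y) ≈-refl (V (even a)) (q ⊗ V (odd a)) ⟩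
  const (+ 2) ⊗ (q ⊗ V (odd a)) ∎
  where open ≈R

ν-q : ν q ≈ ⊟ q
ν-q = even-odd-≈
  (≈-trans (even-ν q) (pointwise λ n → trans (even-at q n) (sym (trans (even-at (⊟ q) n) (trans (⊟-at q (dbl n)) (lem n))))))
  (≈-trans (odd-ν q) (pointwise λ n → trans (⊟-at (odd q) n) (trans (cong ℤ.-_ (odd-at q n))
    (sym (trans (odd-at (⊟ q) n) (⊟-at q (suc (dbl n))))))))
  where
  lem : ∀ n → ℤ.- q (dbl n) ≡ q (dbl n)
  lem zero    = refl
  lem (suc n) = refl

ν-mono-odd : ∀ d → ν (mono (suc (dbl d))) ≈ ⊟ (mono (suc (dbl d)))
ν-mono-odd d = begin
  ν (mono (suc (dbl d)))       ≈⟨ ν-cong (mono-⊗ 1 (dbl d)) ⟨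
  ν (q ⊗ mono (dbl d))         ≈⟨ ν-⊗ q (mono (dbl d)) ⟩
  ν q ⊗ ν (mono (dbl d))       ≈⟨ ⊗-cong ν-q (ν-mono-even d) ⟩
  ⊟ q ⊗ mono (dbl d)        ≈⟨ solve 2 (λ x y → (:- x) :* y := :- (x :* y)) ≈-refl q (mono (dbl d)) ⟩
  ⊟ (q ⊗ mono (dbl d))      ≈⟨ ⊟-cong (mono-⊗ 1 (dbl d)) ⟩
  ⊟ (mono (suc (dbl d))) ∎
  where open ≈R

V-injective : ∀ {a b} → V a ≈ V b → a ≈ b
V-injective {a} {b} p = ≈-trans (≈-sym (even-V a)) (≈-trans (even-cong p) (even-V b))

-- Infinite products

-- Factor number i is 1 modulo q^(i+1), so the first n factors already fix all coefficients up to
-- q^n.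
Conv : (ℕ → Series) → Set
Conv g = ∀ i → Agree i (g i) oneS

prodTo : ℕ → (ℕ → Series) → Series
prodTo zero    g = oneS
prodTo (suc N) g = prodTo N g ⊗ g N

prodInf : (ℕ → Series) → Series
prodInf g n = prodTo n g n

⊗-identityʳ : ∀ a → a ⊗ oneS ≈ a
⊗-identityʳ = CommutativeRing.*-identityʳ seriesRing

prodTo-cong : ∀ N {g h} → (∀ i → g i ≈ h i) → prodTo N g ≈ prodTo N h
prodTo-cong zero    p = ≈-refl
prodTo-cong (suc N) p = ⊗-cong (prodTo-cong N p) (p N)

prodTo-⊗ : ∀ N g h → prodTo N (λ i → g i ⊗ h i) ≈ prodTo N g ⊗ prodTo N h
prodTo-⊗ zero    g h = ≈-sym (⊗-identityˡ oneS)
prodTo-⊗ (suc N) g h = ≈-trans (⊗-cong (prodTo-⊗ N g h) ≈-refl)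
  (solve 4 (λ x y z w → (x :* y) :* (z :* w) := (x :* z) :* (y :* w)) ≈-refl (prodTo N g) (prodTo N h) (g N) (h N))

prodTo-+ : ∀ M N g → prodTo (M ℕ.+ N) g ≈ prodTo M g ⊗ prodTo N (λ i → g (M ℕ.+ i))
prodTo-+ M zero    g = subst (λ k → prodTo k g ≈ prodTo M g ⊗ oneS) (sym (ℕₚ.+-identityʳ M)) (≈-sym (⊗-identityʳ (prodTo M g)))
prodTo-+ M (suc N) g = subst (λ k → prodTo k g ≈ prodTo M g ⊗ prodTo (suc N) (λ i → g (M ℕ.+ i))) (sym (ℕₚ.+-suc M N))
  (≈-trans (⊗-cong (prodTo-+ M N g) ≈-refl) (⊗-assoc (prodTo M g) _ _))

prodTo-* : ∀ N d g → prodTo (N ℕ.* d) g ≈ prodTo N (λ i → prodTo d (λ j → g (i ℕ.* d ℕ.+ j)))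
prodTo-* zero    d g = ≈-refl
prodTo-* (suc N) d g = subst (λ k → prodTo k g ≈ prodTo (suc N) (λ i → prodTo d (λ j → g (i ℕ.* d ℕ.+ j))))
  (ℕₚ.+-comm (N ℕ.* d) d)
  (≈-trans (prodTo-+ (N ℕ.* d) d g) (⊗-cong (prodTo-* N d g) ≈-refl))

⊗-agree-one : ∀ {n a b} → Agree n a oneS → Agree n b oneS → Agree n (a ⊗ b) oneS
⊗-agree-one p r = agree-trans (⊗-agree p r) (≈⇒agree (⊗-identityˡ oneS))

prodTo-agree-one : ∀ N {n g} → (∀ i → Agree n (g i) oneS) → Agree n (prodTo N g) oneS
prodTo-agree-one zero    p = agree-refl
prodTo-agree-one (suc N) p = ⊗-agree-one (prodTo-agree-one N p) (p N)

prodInf-agree : ∀ {g} → Conv g → ∀ {m n} → m ≤ n → Agree m (prodTo n g) (prodInf g)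
prodInf-agree {g} c {m} {n} = diagonal (λ N → prodTo N g)
  (λ N → agree-sym (agree-trans (⊗-agree agree-refl (c N)) (≈⇒agree (⊗-identityʳ (prodTo N g))))) m n

prodInf-unique : ∀ {g a} → Conv g → (∀ n → Agree n a (prodTo n g)) → a ≈ prodInf g
prodInf-unique c p = agree⇒≈ λ n → agree-trans (p n) (prodInf-agree c ℕₚ.≤-refl)

prodInf-cong : ∀ {g h} → (∀ i → g i ≈ h i) → prodInf g ≈ prodInf h
prodInf-cong p = pointwise λ n → at (prodTo-cong n p) n

prodInf-⊗ : ∀ {g h} → Conv g → Conv h → prodInf g ⊗ prodInf h ≈ prodInf (λ i → g i ⊗ h i)
prodInf-⊗ {g} {h} cg ch = prodInf-unique (λ i → ⊗-agree-one (cg i) (ch i)) λ n → agree-trans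
  (⊗-agree (agree-sym (prodInf-agree cg ℕₚ.≤-refl)) (agree-sym (prodInf-agree ch ℕₚ.≤-refl)))
  (≈⇒agree (≈-sym (prodTo-⊗ n g h)))

prodInf-one : prodInf (λ _ → oneS) ≈ oneS
prodInf-one = ≈-sym (prodInf-unique {λ _ → oneS} (λ i → agree-refl) λ n → agree-sym (prodTo-agree-one n (λ i → agree-refl)))

prodInf-prodTo : ∀ d (g : ℕ → ℕ → Series) → (∀ j → Conv (λ i → g i j)) →
  prodInf (λ i → prodTo d (g i)) ≈ prodTo d (λ j → prodInf (λ i → g i j))
prodInf-prodTo zero    g c = prodInf-one
prodInf-prodTo (suc d) g c = ≈-trans
  (≈-sym (prodInf-⊗ {λ i → prodTo d (g i)} {λ i → g i d} (λ i → prodTo-agree-one d {i} {g i} (λ j → c j i)) (c d)))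
  (⊗-cong (prodInf-prodTo d g c) ≈-refl)

prodInf-group : ∀ d {g} → Conv g → prodInf g ≈ prodInf (λ i → prodTo (suc d) (λ j → g (i ℕ.* suc d ℕ.+ j)))
prodInf-group d {g} c = prodInf-unique
  (λ i → prodTo-agree-one (suc d) λ j →
    agree-≤ (ℕₚ.≤-trans (ℕₚ.m≤m*n i (suc d)) (ℕₚ.m≤m+n (i ℕ.* suc d) j)) (c (i ℕ.* suc d ℕ.+ j)))
  λ n → agree-trans (agree-sym (prodInf-agree c (ℕₚ.m≤m*n n (suc d)))) (≈⇒agree (prodTo-* n (suc d) g))

factor : ℤ → ℕ → Series
factor c d = oneS ⊞ const c ⊗ mono d

-- The Pochhammer symbol (-c q^α; q^s)_∞.
Q : ℤ → ℕ → ℕ → Series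
Q c α s = prodInf (λ i → factor c (α ℕ.+ s ℕ.* i))

factor-agree : ∀ c {n d} → n < d → Agree n (factor c d) oneS
factor-agree c n<d = agree-trans (⊞-agree agree-refl (⊗-agree agree-refl (mono-agree-0 n<d)))
  (≈⇒agree (≈-trans (⊞-cong (≈-refl {oneS}) (⊗-cong (≈-refl {const c}) (≈-sym const-0)))
    (solve 2 (λ o c → o :+ c :* con 0ℤ := o) ≈-refl oneS (const c))))

i<α+s*i : ∀ α s i .{{_ : ℕ.NonZero α}} .{{_ : ℕ.NonZero s}} → i < α ℕ.+ s ℕ.* i
i<α+s*i (suc α) s i = s≤s (ℕₚ.≤-trans (ℕₚ.m≤n*m i s) (ℕₚ.m≤n+m (s ℕ.* i) α))

Q-conv : ∀ c α s .{{_ : ℕ.NonZero α}} .{{_ : ℕ.NonZero s}} → Conv (λ i → factor c (α ℕ.+ s ℕ.* i))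
Q-conv c α s i = factor-agree c (i<α+s*i α s i)

-- The factors are sorted by their index modulo d + 1.
Q-split : ∀ d c α s .{{_ : ℕ.NonZero α}} .{{_ : ℕ.NonZero s}} →
  Q c α s ≈ prodTo (suc d) (λ j → Q c (α ℕ.+ s ℕ.* j) (s ℕ.* suc d))
Q-split d c α s = ≈-trans (prodInf-group d (Q-conv c α s)) (≈-trans
  (prodInf-cong λ i → prodTo-cong (suc d) λ j → subst (λ k → factor c (α ℕ.+ s ℕ.* (i ℕ.* suc d ℕ.+ j)) ≈ factor c k)
    (exponents α s i (suc d) j) ≈-refl)
  (prodInf-prodTo (suc d) (λ i j → factor c (α ℕ.+ s ℕ.* j ℕ.+ s ℕ.* suc d ℕ.* i)) λ j i →
    factor-agree c (ℕₚ.<-≤-trans (i<α+s*i α (s ℕ.* suc d) i {{it}} {{ℕₚ.m*n≢0 s (suc d)}})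
      (ℕₚ.+-monoˡ-≤ (s ℕ.* suc d ℕ.* i) (ℕₚ.m≤m+n α (s ℕ.* j))))))
  where
  exponents : ∀ α s i d j → α ℕ.+ s ℕ.* (i ℕ.* d ℕ.+ j) ≡ α ℕ.+ s ℕ.* j ℕ.+ s ℕ.* d ℕ.* i
  exponents = ℕ-Solver.solve-∀

Q-± : ∀ α s .{{_ : ℕ.NonZero α}} .{{_ : ℕ.NonZero s}} → Q 1ℤ α s ⊗ Q ℤ.-1ℤ α s ≈ Q ℤ.-1ℤ (α ℕ.+ α) (s ℕ.+ s)
Q-± α s = ≈-trans (prodInf-⊗ (Q-conv 1ℤ α s) (Q-conv ℤ.-1ℤ α s)) (prodInf-cong λ i →
  subst (λ k → factor 1ℤ (α ℕ.+ s ℕ.* i) ⊗ factor ℤ.-1ℤ (α ℕ.+ s ℕ.* i) ≈ factor ℤ.-1ℤ k)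
    (exponents α s i) (difference-of-squares (α ℕ.+ s ℕ.* i)))
  where
  exponents : ∀ α s i → (α ℕ.+ s ℕ.* i) ℕ.+ (α ℕ.+ s ℕ.* i) ≡ (α ℕ.+ α) ℕ.+ (s ℕ.+ s) ℕ.* i
  exponents = ℕ-Solver.solve-∀
  difference-of-squares : ∀ d → factor 1ℤ d ⊗ factor ℤ.-1ℤ d ≈ factor ℤ.-1ℤ (d ℕ.+ d)
  difference-of-squares d = begin
    (oneS ⊞ const 1ℤ ⊗ mono d) ⊗ (oneS ⊞ const ℤ.-1ℤ ⊗ mono d)
      ≈⟨ ⊗-cong (⊞-cong (≈-sym const-1) ≈-refl) (⊞-cong (≈-sym const-1) ≈-refl) ⟩
    (const 1ℤ ⊞ const 1ℤ ⊗ mono d) ⊗ (const 1ℤ ⊞ const ℤ.-1ℤ ⊗ mono d)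
      ≈⟨ solve 1 (λ x → (con 1ℤ :+ con 1ℤ :* x) :* (con 1ℤ :+ con ℤ.-1ℤ :* x) := con 1ℤ :+ con ℤ.-1ℤ :* (x :* x)) ≈-refl (mono d) ⟩
    const 1ℤ ⊞ const ℤ.-1ℤ ⊗ (mono d ⊗ mono d)
      ≈⟨ ⊞-cong const-1 (⊗-cong (≈-refl {const ℤ.-1ℤ}) (mono-⊗ d d)) ⟩
    oneS ⊞ const ℤ.-1ℤ ⊗ mono (d ℕ.+ d) ∎
    where open ≈R

V-agree : ∀ {n a b} → Agree n a b → Agree n (V a) (V b)
V-agree {n} {a} {b} p = upTo (dbl-induction
  (λ i i≤n → trans (sym (even-at (V a) i)) (trans (at (even-V a) i)
    (trans (upto p i (ℕₚ.≤-trans (i≤dbl i) i≤n)) (sym (trans (sym (even-at (V b) i)) (at (even-V b) i))))))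
  (λ i _ → trans (trans (sym (odd-at (V a) i)) (at (odd-V a) i)) (sym (trans (sym (odd-at (V b) i)) (at (odd-V b) i)))))
  where
  i≤dbl : ∀ i → i ≤ dbl i
  i≤dbl zero    = z≤n
  i≤dbl (suc i) = s≤s (ℕₚ.m≤n⇒m≤1+n (i≤dbl i))

ν-agree : ∀ {n a b} → Agree n a b → Agree n (ν a) (ν b)
ν-agree {n} {a} {b} p = upTo (dbl-induction
  (λ i i≤n → trans (ν-even a i) (trans (upto p (dbl i) i≤n) (sym (ν-even b i))))
  (λ i i≤n → trans (ν-odd a i) (trans (cong ℤ.-_ (upto p (suc (dbl i)) i≤n)) (sym (ν-odd b i)))))
  where
  ν-even : ∀ a i → ν a (dbl i) ≡ a (dbl i)
  ν-even a i = trans (sym (even-at (ν a) i)) (trans (at (even-ν a) i) (even-at a i))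
  ν-odd : ∀ a i → ν a (suc (dbl i)) ≡ ℤ.- a (suc (dbl i))
  ν-odd a i = trans (sym (odd-at (ν a) i)) (trans (at (odd-ν a) i) (trans (⊟-at (odd a) i) (cong ℤ.-_ (odd-at a i))))

V-prodInf : ∀ {g} → Conv g → V (prodInf g) ≈ prodInf (λ i → V (g i))
V-prodInf {g} c = prodInf-unique
  (λ i → agree-trans (V-agree (c i)) (≈⇒agree V-one))
  λ n → agree-trans (V-agree (agree-sym (prodInf-agree c ℕₚ.≤-refl))) (≈⇒agree (V-prodTo n))
  where
  V-prodTo : ∀ n → V (prodTo n g) ≈ prodTo n (λ i → V (g i))
  V-prodTo zero    = V-one
  V-prodTo (suc n) = ≈-trans (V-⊗ (prodTo n g) (g n)) (⊗-cong (V-prodTo n) ≈-refl)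

ν-prodInf : ∀ {g} → Conv g → ν (prodInf g) ≈ prodInf (λ i → ν (g i))
ν-prodInf {g} c = prodInf-unique
  (λ i → agree-trans (ν-agree (c i)) (≈⇒agree ν-one))
  λ n → agree-trans (ν-agree (agree-sym (prodInf-agree c ℕₚ.≤-refl))) (≈⇒agree (ν-prodTo n))
  where
  ν-prodTo : ∀ n → ν (prodTo n g) ≈ prodTo n (λ i → ν (g i))
  ν-prodTo zero    = ν-one
  ν-prodTo (suc n) = ≈-trans (ν-⊗ (prodTo n g) (g n)) (⊗-cong (ν-prodTo n) ≈-refl)

V-factor : ∀ c d → V (factor c d) ≈ factor c (dbl d)
V-factor c d = ≈-trans (V-⊞ oneS (const c ⊗ mono d)) (⊞-cong V-one
  (≈-trans (V-⊗ (const c) (mono d)) (⊗-cong (V-const c) (V-mono d))))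

ν-factor-odd : ∀ c d → ν (factor c (suc (dbl d))) ≈ factor (ℤ.- c) (suc (dbl d))
ν-factor-odd c d = ≈-trans (ν-⊞ oneS (const c ⊗ mono (suc (dbl d)))) (⊞-cong ν-one
  (≈-trans (ν-⊗ (const c) (mono (suc (dbl d)))) (≈-trans (⊗-cong (ν-const c) (ν-mono-odd d))
  (≈-trans (solve 2 (λ x y → x :* (:- y) := (:- x) :* y) ≈-refl (const c) (mono (suc (dbl d))))
    (⊗-cong (≈-sym (const-⊟ c)) ≈-refl)))))

dbl-+-* : ∀ α s i → dbl (α ℕ.+ s ℕ.* i) ≡ dbl α ℕ.+ dbl s ℕ.* i
dbl-+-* α s i = trans (dbl≡ (α ℕ.+ s ℕ.* i)) (trans (rearrange α s i)
  (sym (cong₂ (λ x y → x ℕ.+ y ℕ.* i) (dbl≡ α) (dbl≡ s))))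
  where
  dbl≡ : ∀ n → dbl n ≡ n ℕ.+ n
  dbl≡ zero    = refl
  dbl≡ (suc n) = cong suc (trans (cong suc (dbl≡ n)) (sym (ℕₚ.+-suc n n)))
  rearrange : ∀ α s i → (α ℕ.+ s ℕ.* i) ℕ.+ (α ℕ.+ s ℕ.* i) ≡ (α ℕ.+ α) ℕ.+ (s ℕ.+ s) ℕ.* i
  rearrange = ℕ-Solver.solve-∀

V-Q : ∀ c α s .{{_ : ℕ.NonZero α}} .{{_ : ℕ.NonZero s}} → V (Q c α s) ≈ Q c (dbl α) (dbl s)
V-Q c α s = ≈-trans (V-prodInf (Q-conv c α s)) (prodInf-cong λ i →
  subst (λ k → V (factor c (α ℕ.+ s ℕ.* i)) ≈ factor c k) (dbl-+-* α s i) (V-factor c (α ℕ.+ s ℕ.* i)))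

-- The start is odd and the step even, so every exponent is odd and every factor changes sign.
ν-Q : ∀ c α s .{{_ : ℕ.NonZero s}} → ν (Q c (suc (dbl α)) (dbl s)) ≈ Q (ℤ.- c) (suc (dbl α)) (dbl s)
ν-Q c α s@(suc _) = ≈-trans (ν-prodInf (Q-conv c (suc (dbl α)) (dbl s))) (prodInf-cong λ i →
  subst (λ k → ν (factor c (suc k)) ≈ factor (ℤ.- c) (suc k)) (dbl-+-* α s i) (ν-factor-odd c (α ℕ.+ s ℕ.* i)))

opaque
  η : ℕ → Series
  η m = Q ℤ.-1ℤ m m

  η-def : ∀ m → η m ≈ Q ℤ.-1ℤ m m
  η-def m = ≈-refl

etaTrunc≈prodTo : ∀ m N → etaTrunc m N ≈ prodTo N (λ i → factor ℤ.-1ℤ (m ℕ.+ m ℕ.* i))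
etaTrunc≈prodTo m zero    = ≈-refl
etaTrunc≈prodTo m (suc N) = ≈-trans
  (≈-sym (⊗-def (etaTrunc m N) (oneS ⊖ mono (m ℕ.* suc N))))
  (⊗-cong (etaTrunc≈prodTo m N)
    (subst (λ k → oneS ⊖ mono k ≈ factor ℤ.-1ℤ (m ℕ.+ m ℕ.* N)) (sym (ℕₚ.*-suc m N)) (minus (m ℕ.+ m ℕ.* N))))
  where
  minus : ∀ d → oneS ⊖ mono d ≈ factor ℤ.-1ℤ d
  minus d = pointwise λ n → sym (trans (⊞-at oneS (const ℤ.-1ℤ ⊗ mono d) n)
    (cong (ℤ._+_ (oneS n)) (trans (const-⊗-at ℤ.-1ℤ (mono d) n) (ℤₚ.-1*i≡-i (mono d n)))))

f≈η : ∀ m → f m ≈ η m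
f≈η m = ≈-trans (pointwise λ n → at (etaTrunc≈prodTo m n) n) (≈-sym (η-def m))

V-η : ∀ m .{{_ : ℕ.NonZero m}} → V (η m) ≈ η (dbl m)
V-η m = ≈-trans (V-cong (η-def m)) (≈-trans (V-Q ℤ.-1ℤ m m) (≈-sym (η-def (dbl m))))

η-zero : ∀ m → η m 0 ≡ 1ℤ
η-zero m = at (η-def m) 0

-- The Jacobi triple product

tri : ℕ → ℕ
tri zero    = 0
tri (suc n) = suc n ℕ.+ tri n

-- The number k(k+1)/2 for any integer k; at k = -(n+1) it equals n(n+1)/2.
triangular : ℤ → ℕ
triangular (+ n)    = tri n
triangular -[1+ n ] = tri n

double-tri : ∀ n → + 2 ℤ.* + tri n ≡ + n ℤ.* (1ℤ ℤ.+ + n)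
double-tri zero    = refl
double-tri (suc n) = begin
  + 2 ℤ.* (+ suc n ℤ.+ + tri n)                    ≡⟨ ℤₚ.*-distribˡ-+ (+ 2) (+ suc n) (+ tri n) ⟩
  + 2 ℤ.* + suc n ℤ.+ + 2 ℤ.* + tri n              ≡⟨ cong (ℤ._+_ (+ 2 ℤ.* + suc n)) (double-tri n) ⟩
  + 2 ℤ.* (1ℤ ℤ.+ + n) ℤ.+ + n ℤ.* (1ℤ ℤ.+ + n)    ≡⟨ rearrange (+ n) ⟩
  (1ℤ ℤ.+ + n) ℤ.* (1ℤ ℤ.+ (1ℤ ℤ.+ + n)) ∎
  where
  open ≡-Reasoning
  rearrange : ∀ x → + 2 ℤ.* (1ℤ ℤ.+ x) ℤ.+ x ℤ.* (1ℤ ℤ.+ x) ≡ (1ℤ ℤ.+ x) ℤ.* (1ℤ ℤ.+ (1ℤ ℤ.+ x))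
  rearrange = ℤ-solve-∀

double-triangular : ∀ k → + 2 ℤ.* + triangular k ≡ k ℤ.* (1ℤ ℤ.+ k)
double-triangular (+ n)    = double-tri n
double-triangular -[1+ n ] = trans (double-tri n) (reflect (+ n))
  where
  reflect : ∀ x → x ℤ.* (1ℤ ℤ.+ x) ≡ (ℤ.- (1ℤ ℤ.+ x)) ℤ.* (1ℤ ℤ.+ (ℤ.- (1ℤ ℤ.+ x)))
  reflect = ℤ-solve-∀

-- The exponent of a^(k(k+1)/2) b^(k(k-1)/2) in Ramanujan's f(a,b) for a = q^α, b = q^β.
weight : ℕ → ℕ → ℤ → ℕ
weight α β k = α ℕ.* triangular k ℕ.+ β ℕ.* triangular (ℤ.- k)

-- Identities between exponents are proved after doubling, over the integers, where they are
-- polynomial and the ring solver applies.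
double-weight : ∀ α β k →
  + 2 ℤ.* + weight α β k ≡ + α ℤ.* (k ℤ.* (1ℤ ℤ.+ k)) ℤ.+ + β ℤ.* (k ℤ.* (k ℤ.- 1ℤ))
double-weight α β k = begin
  + 2 ℤ.* (+ (α ℕ.* t) ℤ.+ + (β ℕ.* t′))
    ≡⟨ cong₂ (λ x y → + 2 ℤ.* (x ℤ.+ y)) (ℤₚ.pos-* α t) (ℤₚ.pos-* β t′) ⟩
  + 2 ℤ.* (+ α ℤ.* + t ℤ.+ + β ℤ.* + t′)
    ≡⟨ rearrange₁ (+ α) (+ β) (+ t) (+ t′) ⟩
  + α ℤ.* (+ 2 ℤ.* + t) ℤ.+ + β ℤ.* (+ 2 ℤ.* + t′)
    ≡⟨ cong₂ (λ x y → + α ℤ.* x ℤ.+ + β ℤ.* y) (double-triangular k) (double-triangular (ℤ.- k)) ⟩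
  + α ℤ.* (k ℤ.* (1ℤ ℤ.+ k)) ℤ.+ + β ℤ.* ((ℤ.- k) ℤ.* (1ℤ ℤ.+ (ℤ.- k)))
    ≡⟨ rearrange₂ (+ α) (+ β) k ⟩
  + α ℤ.* (k ℤ.* (1ℤ ℤ.+ k)) ℤ.+ + β ℤ.* (k ℤ.* (k ℤ.- 1ℤ)) ∎
  where
  open ≡-Reasoning
  t t′ : ℕ
  t = triangular k
  t′ = triangular (ℤ.- k)
  rearrange₁ : ∀ a b x y → + 2 ℤ.* (a ℤ.* x ℤ.+ b ℤ.* y) ≡ a ℤ.* (+ 2 ℤ.* x) ℤ.+ b ℤ.* (+ 2 ℤ.* y)
  rearrange₁ = ℤ-solve-∀
  rearrange₂ : ∀ a b k → a ℤ.* (k ℤ.* (1ℤ ℤ.+ k)) ℤ.+ b ℤ.* ((ℤ.- k) ℤ.* (1ℤ ℤ.+ (ℤ.- k)))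
    ≡ a ℤ.* (k ℤ.* (1ℤ ℤ.+ k)) ℤ.+ b ℤ.* (k ℤ.* (k ℤ.- 1ℤ))
  rearrange₂ = ℤ-solve-∀

double-injective : ∀ {m n} → + 2 ℤ.* + m ≡ + 2 ℤ.* + n → m ≡ n
double-injective {m} {n} p = ℤₚ.+-injective (ℤₚ.*-cancelˡ-≡ (+ 2) (+ m) (+ n) p)

n≤tri : ∀ n → n ≤ tri n
n≤tri zero    = z≤n
n≤tri (suc n) = ℕₚ.m≤m+n (suc n) (tri n)

-- This makes theta series finite in each degree: only |k| ≤ n can contribute to q^n.
∣k∣≤weight : ∀ α β .{{_ : ℕ.NonZero α}} .{{_ : ℕ.NonZero β}} k → ℤ.∣ k ∣ ≤ weight α β k
∣k∣≤weight α β (+ n)    = ℕₚ.≤-trans (n≤tri n) (ℕₚ.≤-trans (ℕₚ.m≤n*m (tri n) α) (ℕₚ.m≤m+n _ _))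
∣k∣≤weight α β -[1+ n ] = ℕₚ.≤-trans (n≤tri (suc n)) (ℕₚ.≤-trans (ℕₚ.m≤n*m (tri (suc n)) β) (ℕₚ.m≤n+m _ (α ℕ.* tri n)))

-- The summand receives both indices, with x + y = n, so that Gaussian binomials are written without
-- truncated subtraction.
antidiagonal : ℕ → (ℕ → ℕ → Series) → Series
antidiagonal zero    h = h 0 0
antidiagonal (suc n) h = h 0 (suc n) ⊞ antidiagonal n (λ x y → h (suc x) y)

antidiagonal-last : ∀ n h →
  antidiagonal (suc n) h ≈ antidiagonal n (λ x y → h x (suc y)) ⊞ h (suc n) 0
antidiagonal-last zero    h = ≈-refl
antidiagonal-last (suc n) h = ≈-trans (⊞-cong (≈-refl {h 0 (suc (suc n))}) (antidiagonal-last n (λ x y → h (suc x) y)))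
  (≈-sym (⊞-assoc (h 0 (suc (suc n))) _ _))

antidiagonal-cong : ∀ n {h h′} → (∀ x y → x ℕ.+ y ≡ n → h x y ≈ h′ x y) → antidiagonal n h ≈ antidiagonal n h′
antidiagonal-cong zero    p = p 0 0 refl
antidiagonal-cong (suc n) p = ⊞-cong (p 0 (suc n) refl) (antidiagonal-cong n λ x y e → p (suc x) y (cong suc e))

antidiagonal-agree : ∀ n {m h h′} → (∀ x y → x ℕ.+ y ≡ n → Agree m (h x y) (h′ x y)) →
  Agree m (antidiagonal n h) (antidiagonal n h′)
antidiagonal-agree zero    p = p 0 0 refl
antidiagonal-agree (suc n) p = ⊞-agree (p 0 (suc n) refl) (antidiagonal-agree n λ x y e → p (suc x) y (cong suc e))

antidiagonal-⊞ : ∀ n h h′ → antidiagonal n (λ x y → h x y ⊞ h′ x y) ≈ antidiagonal n h ⊞ antidiagonal n h′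
antidiagonal-⊞ zero    h h′ = ≈-refl
antidiagonal-⊞ (suc n) h h′ = ≈-trans (⊞-cong ≈-refl (antidiagonal-⊞ n (λ x y → h (suc x) y) (λ x y → h′ (suc x) y)))
  (solve 4 (λ a b c d → (a :+ b) :+ (c :+ d) := (a :+ c) :+ (b :+ d)) ≈-refl (h 0 (suc n)) (h′ 0 (suc n)) _ _)

antidiagonal-⊗ : ∀ n c h → c ⊗ antidiagonal n h ≈ antidiagonal n (λ x y → c ⊗ h x y)
antidiagonal-⊗ zero    c h = ≈-refl
antidiagonal-⊗ (suc n) c h = ≈-trans (CommutativeRing.distribˡ seriesRing c (h 0 (suc n)) _)
  (⊞-cong ≈-refl (antidiagonal-⊗ n c (λ x y → h (suc x) y)))

antidiagonal-sumTo : ∀ n (g : ℕ → Series) i → antidiagonal n (λ x _ → g x) i ≡ sumTo (suc n) (λ x → g x i)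
antidiagonal-sumTo zero    g i = sym (ℤₚ.+-identityˡ (g 0 i))
antidiagonal-sumTo (suc n) g i = trans (⊞-at (g 0) _ i)
  (trans (cong (ℤ._+_ (g 0 i)) (antidiagonal-sumTo n (λ x → g (suc x)) i)) (sym (sumTo-suc (suc n) (λ x → g x i))))

-- gauss s x y is the Gaussian binomial coefficient [x+y; x] in the variable q^s.
gauss : ℕ → ℕ → ℕ → Series
gauss s zero    y       = oneS
gauss s (suc x) zero    = oneS
gauss s (suc x) (suc y) = gauss s (suc x) y ⊞ mono (s ℕ.* suc y) ⊗ gauss s x (suc y)

gauss-zeroʳ : ∀ s x → gauss s x 0 ≈ oneS
gauss-zeroʳ s zero    = ≈-refl
gauss-zeroʳ s (suc x) = ≈-refl

pochhammer : ℕ → ℕ → Series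
pochhammer s n = prodTo n (λ i → factor ℤ.-1ℤ (s ℕ.+ s ℕ.* i))

pochhammer-zero : ∀ s .{{_ : ℕ.NonZero s}} n → pochhammer s n 0 ≡ 1ℤ
pochhammer-zero s n = upto (prodTo-agree-one n {0} λ i →
  factor-agree ℤ.-1ℤ (ℕₚ.≤-<-trans z≤n (i<α+s*i s s i))) 0 z≤n

⊗-zero-one : ∀ {a b} → a 0 ≡ 1ℤ → b 0 ≡ 1ℤ → (a ⊗ b) 0 ≡ 1ℤ
⊗-zero-one {a} {b} p r = trans (⊗-zero a b) (cong₂ ℤ._*_ p r)

factor≈ : ∀ s n → factor ℤ.-1ℤ (s ℕ.+ s ℕ.* n) ≈ const 1ℤ ⊞ ⊟ mono (s ℕ.* suc n)
factor≈ s n = subst (λ k → factor ℤ.-1ℤ (s ℕ.+ s ℕ.* n) ≈ const 1ℤ ⊞ ⊟ mono k) (sym (ℕₚ.*-suc s n))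
  (⊞-cong (≈-sym const-1) (solve 1 (λ x → con ℤ.-1ℤ :* x := :- x) ≈-refl (mono (s ℕ.+ s ℕ.* n))))

-- The quotient formula for Gaussian binomials with denominators cleared. The inductive step rests
-- on 1 - ab = (1 - a) + a(1 - b) for a = q^(s(y+1)) and b = q^(s(x+1)).
gauss-pochhammer : ∀ s x y → gauss s x y ⊗ pochhammer s x ⊗ pochhammer s y ≈ pochhammer s (x ℕ.+ y)
gauss-pochhammer s zero    y    = ≈-trans (⊗-cong (⊗-identityˡ oneS) ≈-refl) (⊗-identityˡ (pochhammer s y))
gauss-pochhammer s (suc x) zero = ≈-trans (⊗-identityʳ _) (≈-trans (⊗-identityˡ (pochhammer s (suc x)))
  (subst (λ k → pochhammer s (suc x) ≈ pochhammer s k) (sym (ℕₚ.+-identityʳ (suc x))) ≈-refl))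
gauss-pochhammer s (suc x) (suc y) = begin
  (g₁ ⊞ py ⊗ g₂) ⊗ (Ex ⊗ fx) ⊗ (Ey ⊗ fy)
    ≈⟨ solve 7 (λ g₁ g₂ py Ex Ey fx fy → (g₁ :+ py :* g₂) :* (Ex :* fx) :* (Ey :* fy)
         := g₁ :* (Ex :* fx) :* Ey :* fy :+ py :* (g₂ :* Ex :* (Ey :* fy)) :* fx) ≈-refl g₁ g₂ py Ex Ey fx fy ⟩
  g₁ ⊗ (Ex ⊗ fx) ⊗ Ey ⊗ fy ⊞ py ⊗ (g₂ ⊗ Ex ⊗ (Ey ⊗ fy)) ⊗ fx
    ≈⟨ ⊞-cong (⊗-cong (gauss-pochhammer s (suc x) y) (factor≈ s y))
         (⊗-cong (⊗-cong (≈-refl {py}) (≈-trans (gauss-pochhammer s x (suc y))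
           (subst (λ k → pochhammer s k ≈ E) (sym (ℕₚ.+-suc x y)) ≈-refl))) (factor≈ s x)) ⟩
  E ⊗ (const 1ℤ ⊞ ⊟ py) ⊞ py ⊗ E ⊗ (const 1ℤ ⊞ ⊟ px)
    ≈⟨ solve 3 (λ E px py → E :* (con 1ℤ :- py) :+ py :* E :* (con 1ℤ :- px) := E :* (con 1ℤ :- py :* px)) ≈-refl E px py ⟩
  E ⊗ (const 1ℤ ⊞ ⊟ (py ⊗ px))
    ≈⟨ ⊗-cong (≈-refl {E}) (⊞-cong (≈-refl {const 1ℤ}) (⊟-cong (≈-trans (mono-⊗ (s ℕ.* suc y) (s ℕ.* suc x))
         (subst (λ k → mono (s ℕ.* suc y ℕ.+ s ℕ.* suc x) ≈ mono k) (exponents s x y) ≈-refl)))) ⟩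
  E ⊗ (const 1ℤ ⊞ ⊟ mono (s ℕ.* suc (suc (x ℕ.+ y))))
    ≈⟨ ⊗-cong (≈-refl {E}) (factor≈ s (suc (x ℕ.+ y))) ⟨
  pochhammer s (suc (suc (x ℕ.+ y)))
    ≈⟨ subst (λ k → pochhammer s (suc (suc (x ℕ.+ y))) ≈ pochhammer s k) (cong suc (sym (ℕₚ.+-suc x y))) ≈-refl ⟩
  pochhammer s (suc x ℕ.+ suc y) ∎
  where
  open ≈R
  g₁ g₂ py px Ex Ey fx fy E : Series
  g₁ = gauss s (suc x) y
  g₂ = gauss s x (suc y)
  py = mono (s ℕ.* suc y)
  px = mono (s ℕ.* suc x)
  Ex = pochhammer s x
  Ey = pochhammer s y
  fx = factor ℤ.-1ℤ (s ℕ.+ s ℕ.* x)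
  fy = factor ℤ.-1ℤ (s ℕ.+ s ℕ.* y)
  E = pochhammer s (suc x ℕ.+ y)
  exponents : ∀ s x y → s ℕ.* suc y ℕ.+ s ℕ.* suc x ≡ s ℕ.* suc (suc (x ℕ.+ y))
  exponents = ℕ-Solver.solve-∀

-- The defining recursion treats x and y differently, but the quotient formula is symmetric. The
-- symmetry then yields the second Pascal rule, `gauss-suc`.
gauss-comm : ∀ s .{{_ : ℕ.NonZero s}} x y → gauss s x y ≈ gauss s y x
gauss-comm s x y = ⊗-cancelʳ (Ex ⊗ Ey) (⊗-zero-one {Ex} {Ey} (pochhammer-zero s x) (pochhammer-zero s y)) (begin
  gauss s x y ⊗ (Ex ⊗ Ey)     ≈⟨ ⊗-assoc (gauss s x y) Ex Ey ⟨
  gauss s x y ⊗ Ex ⊗ Ey       ≈⟨ gauss-pochhammer s x y ⟩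
  pochhammer s (x ℕ.+ y)      ≈⟨ subst (λ k → pochhammer s (x ℕ.+ y) ≈ pochhammer s k) (ℕₚ.+-comm x y) ≈-refl ⟩
  pochhammer s (y ℕ.+ x)      ≈⟨ gauss-pochhammer s y x ⟨
  gauss s y x ⊗ Ey ⊗ Ex       ≈⟨ solve 3 (λ g a b → g :* b :* a := g :* (a :* b)) ≈-refl (gauss s y x) Ex Ey ⟩
  gauss s y x ⊗ (Ex ⊗ Ey) ∎)
  where
  open ≈R
  Ex Ey : Series
  Ex = pochhammer s x
  Ey = pochhammer s y

gauss-suc : ∀ s .{{_ : ℕ.NonZero s}} x y →
  gauss s (suc x) (suc y) ≈ gauss s x (suc y) ⊞ mono (s ℕ.* suc x) ⊗ gauss s (suc x) y
gauss-suc s x y = ≈-trans (gauss-comm s (suc x) (suc y))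
  (⊞-cong (gauss-comm s (suc y) x) (⊗-cong ≈-refl (gauss-comm s y (suc x))))

mono-s*0 : ∀ s → mono (s ℕ.* 0) ≈ oneS
mono-s*0 s = subst (λ k → mono k ≈ oneS) (sym (ℕₚ.*-zeroʳ s)) mono-zero

module GaussSums (s : ℕ) where

  -- The binomial [x+y-1; x], extended by 0 to y = 0, and below it [x+y-1; x-1], extended by 0 to x
  -- = 0: with these values the Pascal rules also hold on the boundary.
  shiftʳ : ℕ → ℕ → Series
  shiftʳ x zero    = zeroS
  shiftʳ x (suc y) = gauss s x y

  shiftˡ : ℕ → ℕ → Series
  shiftˡ zero    y = zeroS
  shiftˡ (suc x) y = gauss s x y

  pascalʳ : ∀ x y → gauss s (suc x) y ≈ shiftʳ (suc x) y ⊞ mono (s ℕ.* y) ⊗ gauss s x y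
  pascalʳ x zero    = ≈-sym (≈-trans (⊞-identityˡ _) (≈-trans (⊗-cong (mono-s*0 s) (gauss-zeroʳ s x)) (⊗-identityˡ oneS)))
  pascalʳ x (suc y) = ≈-refl

  pascalˡ : .{{_ : ℕ.NonZero s}} → ∀ x y → gauss s x (suc y) ≈ shiftˡ x (suc y) ⊞ mono (s ℕ.* x) ⊗ gauss s x y
  pascalˡ zero    y = ≈-sym (≈-trans (⊞-identityˡ _) (≈-trans (⊗-cong (mono-s*0 s) ≈-refl) (⊗-identityˡ oneS)))
  pascalˡ (suc x) y = gauss-suc s x y

  -- The inductive step of the q-binomial theorem. There are two versions, one for each Pascal rule:
  -- `sumʳ` appends a factor of the α-product and `sumˡ` one of the β-product.
  sumʳ : ∀ n (t : ℕ → Series) → antidiagonal (suc n) (λ x y → gauss s x y ⊗ t x) ≈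
    antidiagonal n (λ x y → gauss s x y ⊗ t x) ⊞ antidiagonal n (λ x y → mono (s ℕ.* y) ⊗ gauss s x y ⊗ t (suc x))
  sumʳ n t = begin
    gauss s 0 (suc n) ⊗ t 0 ⊞ antidiagonal n (λ x y → gauss s (suc x) y ⊗ t (suc x))
      ≈⟨ ⊞-cong ≈-refl (≈-trans
          (antidiagonal-cong n λ x y _ → ≈-trans (⊗-cong (pascalʳ x y) ≈-refl) (⊗-distribʳ (t (suc x)) _ _))
          (antidiagonal-⊞ n (λ x y → shiftʳ (suc x) y ⊗ t (suc x)) (λ x y → mono (s ℕ.* y) ⊗ gauss s x y ⊗ t (suc x)))) ⟩
    shiftʳ 0 (suc n) ⊗ t 0 ⊞ (antidiagonal n (λ x y → shiftʳ (suc x) y ⊗ t (suc x)) ⊞ rest)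
      ≈⟨ ⊞-assoc _ _ _ ⟨
    antidiagonal (suc n) (λ x y → shiftʳ x y ⊗ t x) ⊞ rest
      ≈⟨ ⊞-cong (antidiagonal-last n (λ x y → shiftʳ x y ⊗ t x)) ≈-refl ⟩
    antidiagonal n (λ x y → gauss s x y ⊗ t x) ⊞ zeroS ⊗ t (suc n) ⊞ rest
      ≈⟨ ⊞-cong (≈-trans (⊞-cong ≈-refl (zeroS-⊗ (t (suc n)))) (≈-trans (⊞-comm _ zeroS) (⊞-identityˡ _))) ≈-refl ⟩
    antidiagonal n (λ x y → gauss s x y ⊗ t x) ⊞ rest ∎
    where
    open ≈R
    rest : Series
    rest = antidiagonal n (λ x y → mono (s ℕ.* y) ⊗ gauss s x y ⊗ t (suc x))

  sumˡ : .{{_ : ℕ.NonZero s}} → ∀ n (t : ℕ → Series) → antidiagonal (suc n) (λ x y → gauss s x y ⊗ t x) ≈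
    antidiagonal n (λ x y → gauss s x y ⊗ t (suc x)) ⊞ antidiagonal n (λ x y → mono (s ℕ.* x) ⊗ gauss s x y ⊗ t x)
  sumˡ n t = begin
    antidiagonal (suc n) (λ x y → gauss s x y ⊗ t x)
      ≈⟨ antidiagonal-last n (λ x y → gauss s x y ⊗ t x) ⟩
    antidiagonal n (λ x y → gauss s x (suc y) ⊗ t x) ⊞ gauss s (suc n) 0 ⊗ t (suc n)
      ≈⟨ ⊞-cong (≈-trans
          (antidiagonal-cong n λ x y _ → ≈-trans (⊗-cong (pascalˡ x y) ≈-refl) (⊗-distribʳ (t x) _ _))
          (antidiagonal-⊞ n (λ x y → shiftˡ x (suc y) ⊗ t x) (λ x y → mono (s ℕ.* x) ⊗ gauss s x y ⊗ t x)))
          (⊗-cong (≈-sym (gauss-zeroʳ s n)) ≈-refl) ⟩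
    antidiagonal n (λ x y → shiftˡ x (suc y) ⊗ t x) ⊞ rest ⊞ shiftˡ (suc n) 0 ⊗ t (suc n)
      ≈⟨ solve 3 (λ a b c → a :+ b :+ c := a :+ c :+ b) ≈-refl (antidiagonal n (λ x y → shiftˡ x (suc y) ⊗ t x)) rest (shiftˡ (suc n) 0 ⊗ t (suc n)) ⟩
    antidiagonal n (λ x y → shiftˡ x (suc y) ⊗ t x) ⊞ shiftˡ (suc n) 0 ⊗ t (suc n) ⊞ rest
      ≈⟨ ⊞-cong (antidiagonal-last n (λ x y → shiftˡ x y ⊗ t x)) ≈-refl ⟨
    zeroS ⊗ t 0 ⊞ antidiagonal n (λ x y → gauss s x y ⊗ t (suc x)) ⊞ rest
      ≈⟨ ⊞-cong (≈-trans (⊞-cong (zeroS-⊗ (t 0)) ≈-refl) (⊞-identityˡ _)) ≈-refl ⟩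
    antidiagonal n (λ x y → gauss s x y ⊗ t (suc x)) ⊞ rest ∎
    where
    open ≈R
    rest : Series
    rest = antidiagonal n (λ x y → mono (s ℕ.* x) ⊗ gauss s x y ⊗ t x)

pos-+* : ∀ a s n → + (a ℕ.+ s ℕ.* n) ≡ + a ℤ.+ + s ℤ.* + n
pos-+* a s n = cong (ℤ._+_ (+ a)) (ℤₚ.pos-* s n)

-- With w = `weight α β`, this is w(k-1) = w(k) + β - (α+β)k at k = x - N.
weight-step-β : ∀ α β x N → (α ℕ.+ β) ℕ.* x ℕ.+ weight α β (x ℤ.⊖ suc N)
  ≡ weight α β (x ℤ.⊖ N) ℕ.+ (β ℕ.+ (α ℕ.+ β) ℕ.* N)
weight-step-β α β x N = double-injective (begin
  + 2 ℤ.* + ((α ℕ.+ β) ℕ.* x ℕ.+ weight α β (x ℤ.⊖ suc N))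
    ≡⟨ cong (λ y → + 2 ℤ.* (y ℤ.+ + weight α β (x ℤ.⊖ suc N))) (ℤₚ.pos-* (α ℕ.+ β) x) ⟩
  + 2 ℤ.* ((+ α ℤ.+ + β) ℤ.* + x ℤ.+ + weight α β (x ℤ.⊖ suc N))
    ≡⟨ ℤₚ.*-distribˡ-+ (+ 2) ((+ α ℤ.+ + β) ℤ.* + x) (+ weight α β (x ℤ.⊖ suc N)) ⟩
  + 2 ℤ.* ((+ α ℤ.+ + β) ℤ.* + x) ℤ.+ + 2 ℤ.* + weight α β (x ℤ.⊖ suc N)
    ≡⟨ cong (ℤ._+_ (+ 2 ℤ.* ((+ α ℤ.+ + β) ℤ.* + x))) (trans (double-weight α β (x ℤ.⊖ suc N))
         (cong (λ k → + α ℤ.* (k ℤ.* (1ℤ ℤ.+ k)) ℤ.+ + β ℤ.* (k ℤ.* (k ℤ.- 1ℤ))) (sym (ℤₚ.m-n≡m⊖n x (suc N))))) ⟩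
  + 2 ℤ.* ((+ α ℤ.+ + β) ℤ.* + x) ℤ.+ quadratic (+ α) (+ β) (+ x ℤ.- (1ℤ ℤ.+ + N))
    ≡⟨ identity (+ α) (+ β) (+ x) (+ N) ⟩
  quadratic (+ α) (+ β) (+ x ℤ.- + N) ℤ.+ + 2 ℤ.* (+ β ℤ.+ (+ α ℤ.+ + β) ℤ.* + N)
    ≡⟨ cong₂ ℤ._+_ (sym (trans (double-weight α β (x ℤ.⊖ N)) (cong (quadratic (+ α) (+ β)) (sym (ℤₚ.m-n≡m⊖n x N)))))
         (cong (λ y → + 2 ℤ.* y) (sym (pos-+* β (α ℕ.+ β) N))) ⟩
  + 2 ℤ.* + weight α β (x ℤ.⊖ N) ℤ.+ + 2 ℤ.* + (β ℕ.+ (α ℕ.+ β) ℕ.* N)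
    ≡⟨ sym (ℤₚ.*-distribˡ-+ (+ 2) (+ weight α β (x ℤ.⊖ N)) (+ (β ℕ.+ (α ℕ.+ β) ℕ.* N))) ⟩
  + 2 ℤ.* + (weight α β (x ℤ.⊖ N) ℕ.+ (β ℕ.+ (α ℕ.+ β) ℕ.* N)) ∎)
  where
  open ≡-Reasoning
  quadratic : ℤ → ℤ → ℤ → ℤ
  quadratic a b k = a ℤ.* (k ℤ.* (1ℤ ℤ.+ k)) ℤ.+ b ℤ.* (k ℤ.* (k ℤ.- 1ℤ))
  identity : ∀ a b x n →
    + 2 ℤ.* ((a ℤ.+ b) ℤ.* x) ℤ.+ (a ℤ.* ((x ℤ.- (1ℤ ℤ.+ n)) ℤ.* (1ℤ ℤ.+ (x ℤ.- (1ℤ ℤ.+ n)))) ℤ.+ b ℤ.* ((x ℤ.- (1ℤ ℤ.+ n)) ℤ.* ((x ℤ.- (1ℤ ℤ.+ n)) ℤ.- 1ℤ)))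
    ≡ (a ℤ.* ((x ℤ.- n) ℤ.* (1ℤ ℤ.+ (x ℤ.- n))) ℤ.+ b ℤ.* ((x ℤ.- n) ℤ.* ((x ℤ.- n) ℤ.- 1ℤ))) ℤ.+ + 2 ℤ.* (b ℤ.+ (a ℤ.+ b) ℤ.* n)
  identity = ℤ-solve-∀

-- With w = `weight α β`, this is w(k+1) = w(k) + α + (α+β)k at k = x - N = M - y.
weight-step-α : ∀ α β x y M N → x ℕ.+ y ≡ M ℕ.+ N → (α ℕ.+ β) ℕ.* y ℕ.+ weight α β (suc x ℤ.⊖ N)
  ≡ weight α β (x ℤ.⊖ N) ℕ.+ (α ℕ.+ (α ℕ.+ β) ℕ.* M)
weight-step-α α β x y M N x+y≡M+N = double-injective (begin
  + 2 ℤ.* + ((α ℕ.+ β) ℕ.* y ℕ.+ weight α β (suc x ℤ.⊖ N))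
    ≡⟨ cong (λ z → + 2 ℤ.* (z ℤ.+ + weight α β (suc x ℤ.⊖ N))) (ℤₚ.pos-* (α ℕ.+ β) y) ⟩
  + 2 ℤ.* ((+ α ℤ.+ + β) ℤ.* + y ℤ.+ + weight α β (suc x ℤ.⊖ N))
    ≡⟨ ℤₚ.*-distribˡ-+ (+ 2) ((+ α ℤ.+ + β) ℤ.* + y) (+ weight α β (suc x ℤ.⊖ N)) ⟩
  + 2 ℤ.* ((+ α ℤ.+ + β) ℤ.* + y) ℤ.+ + 2 ℤ.* + weight α β (suc x ℤ.⊖ N)
    ≡⟨ cong₂ (λ z w → + 2 ℤ.* ((+ α ℤ.+ + β) ℤ.* z) ℤ.+ w) y≡ (trans (double-weight α β (suc x ℤ.⊖ N))
         (cong (quadratic (+ α) (+ β)) (sym (ℤₚ.m-n≡m⊖n (suc x) N)))) ⟩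
  + 2 ℤ.* ((+ α ℤ.+ + β) ℤ.* (+ M ℤ.+ + N ℤ.- + x)) ℤ.+ quadratic (+ α) (+ β) (1ℤ ℤ.+ + x ℤ.- + N)
    ≡⟨ identity (+ α) (+ β) (+ x) (+ M) (+ N) ⟩
  quadratic (+ α) (+ β) (+ x ℤ.- + N) ℤ.+ + 2 ℤ.* (+ α ℤ.+ (+ α ℤ.+ + β) ℤ.* + M)
    ≡⟨ cong₂ ℤ._+_ (sym (trans (double-weight α β (x ℤ.⊖ N)) (cong (quadratic (+ α) (+ β)) (sym (ℤₚ.m-n≡m⊖n x N)))))
         (cong (λ y → + 2 ℤ.* y) (sym (pos-+* α (α ℕ.+ β) M))) ⟩
  + 2 ℤ.* + weight α β (x ℤ.⊖ N) ℤ.+ + 2 ℤ.* + (α ℕ.+ (α ℕ.+ β) ℕ.* M)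
    ≡⟨ sym (ℤₚ.*-distribˡ-+ (+ 2) (+ weight α β (x ℤ.⊖ N)) (+ (α ℕ.+ (α ℕ.+ β) ℕ.* M))) ⟩
  + 2 ℤ.* + (weight α β (x ℤ.⊖ N) ℕ.+ (α ℕ.+ (α ℕ.+ β) ℕ.* M)) ∎)
  where
  open ≡-Reasoning
  quadratic : ℤ → ℤ → ℤ → ℤ
  quadratic a b k = a ℤ.* (k ℤ.* (1ℤ ℤ.+ k)) ℤ.+ b ℤ.* (k ℤ.* (k ℤ.- 1ℤ))
  isolate : ∀ x y → y ≡ x ℤ.+ y ℤ.- x
  isolate = ℤ-solve-∀
  y≡ : + y ≡ + M ℤ.+ + N ℤ.- + x
  y≡ = trans (isolate (+ x) (+ y)) (cong (λ z → + z ℤ.- + x) x+y≡M+N)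
  identity : ∀ a b x m n →
    + 2 ℤ.* ((a ℤ.+ b) ℤ.* (m ℤ.+ n ℤ.- x)) ℤ.+ (a ℤ.* ((1ℤ ℤ.+ x ℤ.- n) ℤ.* (1ℤ ℤ.+ (1ℤ ℤ.+ x ℤ.- n))) ℤ.+ b ℤ.* ((1ℤ ℤ.+ x ℤ.- n) ℤ.* ((1ℤ ℤ.+ x ℤ.- n) ℤ.- 1ℤ)))
    ≡ (a ℤ.* ((x ℤ.- n) ℤ.* (1ℤ ℤ.+ (x ℤ.- n))) ℤ.+ b ℤ.* ((x ℤ.- n) ℤ.* ((x ℤ.- n) ℤ.- 1ℤ))) ℤ.+ + 2 ℤ.* (a ℤ.+ (a ℤ.+ b) ℤ.* m)
  identity = ℤ-solve-∀

mono-cong : ∀ {d e} → d ≡ e → mono d ≈ mono e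
mono-cong refl = ≈-refl

absorb : ∀ {a b w w′ d} → a ℕ.+ w′ ≡ w ℕ.+ d → ∀ g → b ≈ mono a →
  b ⊗ g ⊗ mono w′ ≈ const 1ℤ ⊗ mono d ⊗ (g ⊗ mono w)
absorb {a} {b} {w} {w′} {d} p g b≈ = begin
  b ⊗ g ⊗ mono w′              ≈⟨ ⊗-cong (⊗-cong b≈ (≈-refl {g})) (≈-refl {mono w′}) ⟩
  mono a ⊗ g ⊗ mono w′         ≈⟨ solve 3 (λ a g w → a :* g :* w := g :* (a :* w)) ≈-refl (mono a) g (mono w′) ⟩
  g ⊗ (mono a ⊗ mono w′)       ≈⟨ ⊗-cong (≈-refl {g}) (≈-trans (mono-⊗ a w′) (≈-trans (mono-cong p) (≈-sym (mono-⊗ w d)))) ⟩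
  g ⊗ (mono w ⊗ mono d)        ≈⟨ solve 3 (λ g w d → g :* (w :* d) := con 1ℤ :* d :* (g :* w)) ≈-refl g (mono w) (mono d) ⟩
  const 1ℤ ⊗ mono d ⊗ (g ⊗ mono w) ∎
  where open ≈R

module TripleProduct (α β : ℕ) .{{_ : ℕ.NonZero α}} .{{_ : ℕ.NonZero β}} where

  private
    s : ℕ
    s = α ℕ.+ β
    instance
      s≢0 : ℕ.NonZero s
      s≢0 = ℕ.>-nonZero (ℕₚ.<-≤-trans (ℕ.>-nonZero⁻¹ α) (ℕₚ.m≤m+n α β))
    open GaussSums s

  term : ℕ → ℕ → ℕ → Series
  term N x y = gauss s x y ⊗ mono (weight α β (x ℤ.⊖ N))

  collect : ∀ a d → a ⊞ const 1ℤ ⊗ mono d ⊗ a ≈ a ⊗ factor 1ℤ d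
  collect a d = ≈-trans (solve 2 (λ a m → a :+ con 1ℤ :* m :* a := a :* (con 1ℤ :+ con 1ℤ :* m)) ≈-refl a (mono d))
    (⊗-cong (≈-refl {a}) (⊞-cong const-1 (≈-refl {const 1ℤ ⊗ mono d})))

  -- Appending a β-factor moves the centre of the sum from N to N + 1, so the old terms reappear at
  -- `suc x`; this is the shape of `sumˡ`.
  finite-β : ∀ N → prodTo N (λ i → factor 1ℤ (β ℕ.+ s ℕ.* i)) ≈ antidiagonal N (term N)
  finite-β zero    = ≈-sym (≈-trans (⊗-identityˡ _)
    (≈-trans (mono-cong (cong₂ ℕ._+_ (ℕₚ.*-zeroʳ α) (ℕₚ.*-zeroʳ β))) mono-zero))
  finite-β (suc N) = begin
    prodTo N (λ i → factor 1ℤ (β ℕ.+ s ℕ.* i)) ⊗ factor 1ℤ d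
      ≈⟨ ⊗-cong (finite-β N) ≈-refl ⟩
    antidiagonal N (term N) ⊗ factor 1ℤ d
      ≈⟨ collect (antidiagonal N (term N)) d ⟨
    antidiagonal N (term N) ⊞ const 1ℤ ⊗ mono d ⊗ antidiagonal N (term N)
      ≈⟨ ⊞-cong (antidiagonal-cong N λ x y _ → ⊗-cong ≈-refl (mono-cong (cong (weight α β) (sym (ℤₚ.[1+m]⊖[1+n]≡m⊖n x N)))))
           (≈-trans (antidiagonal-⊗ N (const 1ℤ ⊗ mono d) (term N))
             (antidiagonal-cong N λ x y _ → ≈-sym (absorb (weight-step-β α β x N) (gauss s x y) ≈-refl))) ⟩
    antidiagonal N (λ x y → gauss s x y ⊗ t (suc x)) ⊞ antidiagonal N (λ x y → mono (s ℕ.* x) ⊗ gauss s x y ⊗ t x)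
      ≈⟨ sumˡ N t ⟨
    antidiagonal (suc N) (term (suc N)) ∎
    where
    open ≈R
    d : ℕ
    d = β ℕ.+ s ℕ.* N
    t : ℕ → Series
    t x = mono (weight α β (x ℤ.⊖ suc N))

  -- A finite form of the triple product. The β-factors come first, since they fix the centre N; an
  -- α-factor then only lengthens the sum.
  finite : ∀ M N → prodTo M (λ i → factor 1ℤ (α ℕ.+ s ℕ.* i)) ⊗ prodTo N (λ i → factor 1ℤ (β ℕ.+ s ℕ.* i))
    ≈ antidiagonal (M ℕ.+ N) (term N)
  finite zero    N = ≈-trans (⊗-identityˡ _) (finite-β N)
  finite (suc M) N = begin
    pα ⊗ factor 1ℤ d ⊗ pβ
      ≈⟨ solve 3 (λ a b c → a :* b :* c := a :* c :* b) ≈-refl pα (factor 1ℤ d) pβ ⟩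
    pα ⊗ pβ ⊗ factor 1ℤ d
      ≈⟨ ⊗-cong (finite M N) ≈-refl ⟩
    antidiagonal (M ℕ.+ N) (term N) ⊗ factor 1ℤ d
      ≈⟨ collect (antidiagonal (M ℕ.+ N) (term N)) d ⟨
    antidiagonal (M ℕ.+ N) (term N) ⊞ const 1ℤ ⊗ mono d ⊗ antidiagonal (M ℕ.+ N) (term N)
      ≈⟨ ⊞-cong ≈-refl (≈-trans (antidiagonal-⊗ (M ℕ.+ N) (const 1ℤ ⊗ mono d) (term N))
           (antidiagonal-cong (M ℕ.+ N) λ x y e → ≈-sym (absorb (weight-step-α α β x y M N e) (gauss s x y) ≈-refl))) ⟩
    antidiagonal (M ℕ.+ N) (λ x y → gauss s x y ⊗ t x) ⊞ antidiagonal (M ℕ.+ N) (λ x y → mono (s ℕ.* y) ⊗ gauss s x y ⊗ t (suc x))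
      ≈⟨ sumʳ (M ℕ.+ N) t ⟨
    antidiagonal (suc M ℕ.+ N) (term N) ∎
    where
    open ≈R
    d : ℕ
    d = α ℕ.+ s ℕ.* M
    pα pβ : Series
    pα = prodTo M (λ i → factor 1ℤ (α ℕ.+ s ℕ.* i))
    pβ = prodTo N (λ i → factor 1ℤ (β ℕ.+ s ℕ.* i))
    t : ℕ → Series
    t x = mono (weight α β (x ℤ.⊖ N))

  -- The binomial tends to 1/(q^s; q^s)_∞: in the quotient formula all three Pochhammer products
  -- agree with `η s` up to the smaller of x and y, and one copy of `η s` cancels.
  η-gauss-agree : ∀ x y → Agree (x ℕ.⊓ y) (gauss s x y ⊗ η s) oneS
  η-gauss-agree x y = agree-cancel (η s) (η-zero s) (agree-trans
    (⊗-agree (⊗-agree agree-refl (agree-sym (to-η (ℕₚ.m⊓n≤m x y)))) (agree-sym (to-η (ℕₚ.m⊓n≤n x y))))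
    (agree-trans (≈⇒agree (gauss-pochhammer s x y))
    (agree-trans (to-η (ℕₚ.≤-trans (ℕₚ.m⊓n≤m x y) (ℕₚ.m≤m+n x y)))
      (≈⇒agree (≈-sym (⊗-identityˡ (η s)))))))
    where
    to-η : ∀ {m n} → m ≤ n → Agree m (pochhammer s n) (η s)
    to-η m≤n = agree-trans (prodInf-agree (Q-conv ℤ.-1ℤ s s) m≤n) (≈⇒agree (≈-sym (η-def s)))

  -- The binomial is correct only up to min(x, y), but its weight is at least |x - n|, and |x - n| +
  -- min(x, y) = n when x + y = 2n. So each term is correct up to q^n.
  term-agree : ∀ n x y → x ℕ.+ y ≡ n ℕ.+ n → Agree n (η s ⊗ term n x y) (mono (weight α β (x ℤ.⊖ n)))
  term-agree n x y e = agree-≤ (ℕₚ.≤-trans bound (ℕₚ.+-monoˡ-≤ (x ℕ.⊓ y) (∣k∣≤weight α β (x ℤ.⊖ n))))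
    (agree-trans (≈⇒agree (solve 3 (λ h g m → h :* (g :* m) := m :* (g :* h)) ≈-refl (η s) (gauss s x y) (mono w)))
      (mono-⊗-agree w (η-gauss-agree x y)))
    where
    w : ℕ
    w = weight α β (x ℤ.⊖ n)
    bound : n ≤ ℤ.∣ x ℤ.⊖ n ∣ ℕ.+ (x ℕ.⊓ y)
    bound with ℕₚ.≤-total x n
    ... | inj₁ x≤n = ℕₚ.≤-reflexive (sym (trans (cong₂ ℕ._+_ (ℤₚ.∣⊖∣-≤ x≤n) (ℕₚ.m≤n⇒m⊓n≡m x≤y)) (ℕₚ.m∸n+n≡m x≤n)))
      where
      x≤y : x ≤ y
      x≤y = ℕₚ.+-cancelˡ-≤ x x y (ℕₚ.≤-trans (ℕₚ.+-mono-≤ x≤n x≤n) (ℕₚ.≤-reflexive (sym e)))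
    ... | inj₂ n≤x = ℕₚ.≤-reflexive (sym (ℕₚ.+-cancelˡ-≡ n _ _ (begin
      n ℕ.+ (ℤ.∣ x ℤ.⊖ n ∣ ℕ.+ (x ℕ.⊓ y))
        ≡⟨ cong₂ (λ a b → n ℕ.+ (a ℕ.+ b)) (trans (ℤₚ.∣m⊖n∣≡∣n⊖m∣ x n) (ℤₚ.∣⊖∣-≤ n≤x)) (ℕₚ.m≥n⇒m⊓n≡n y≤x) ⟩
      n ℕ.+ (x ∸ n ℕ.+ y)   ≡⟨ sym (ℕₚ.+-assoc n (x ∸ n) y) ⟩
      n ℕ.+ (x ∸ n) ℕ.+ y   ≡⟨ cong (ℕ._+ y) (ℕₚ.m+[n∸m]≡n n≤x) ⟩
      x ℕ.+ y               ≡⟨ e ⟩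
      n ℕ.+ n ∎)))
      where
      open ≡-Reasoning
      y≤x : y ≤ x
      y≤x = ℕₚ.+-cancelʳ-≤ y y x (ℕₚ.≤-trans (ℕₚ.+-mono-≤ y≤n y≤n) (ℕₚ.≤-reflexive (sym e)))
        where
        y≤n : y ≤ n
        y≤n = ℕₚ.+-cancelˡ-≤ n y n (ℕₚ.≤-trans (ℕₚ.+-monoˡ-≤ y n≤x) (ℕₚ.≤-reflexive e))

opaque
  -- Ramanujan's f(q^α, q^β), the sum of q^`weight α β k` over all integers k. For positive α and β
  -- the window |k| ≤ n contains every contribution to q^n.
  Θ : ℕ → ℕ → Series
  Θ α β n = sumTo (suc (n ℕ.+ n)) (λ x → mono (weight α β (x ℤ.⊖ n)) n)

  Θ-at : ∀ α β n → Θ α β n ≡ sumTo (suc (n ℕ.+ n)) (λ x → mono (weight α β (x ℤ.⊖ n)) n)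
  Θ-at α β n = refl

triple-product : ∀ α β .{{_ : ℕ.NonZero α}} .{{_ : ℕ.NonZero β}} →
  Θ α β ≈ η (α ℕ.+ β) ⊗ (Q 1ℤ α (α ℕ.+ β) ⊗ Q 1ℤ β (α ℕ.+ β))
triple-product α β = pointwise λ n → sym (begin
  (η s ⊗ (Q 1ℤ α s ⊗ Q 1ℤ β s)) n
    -- For the coefficient of q^n both products are cut after n factors.
    ≡⟨ upto (agree-trans
         (⊗-agree agree-refl (⊗-agree (agree-sym (prodInf-agree (Q-conv 1ℤ α s) ℕₚ.≤-refl)) (agree-sym (prodInf-agree (Q-conv 1ℤ β s) ℕₚ.≤-refl))))
         (agree-trans (≈⇒agree (≈-trans (⊗-cong ≈-refl (finite n n)) (antidiagonal-⊗ (n ℕ.+ n) (η s) (term n))))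
           (antidiagonal-agree (n ℕ.+ n) (term-agree n)))) n ℕₚ.≤-refl ⟩
  antidiagonal (n ℕ.+ n) (λ x _ → mono (weight α β (x ℤ.⊖ n))) n
    ≡⟨ antidiagonal-sumTo (n ℕ.+ n) (λ x → mono (weight α β (x ℤ.⊖ n))) n ⟩
  sumTo (suc (n ℕ.+ n)) (λ x → mono (weight α β (x ℤ.⊖ n)) n)
    ≡⟨ sym (Θ-at α β n) ⟩
  Θ α β n ∎)
  where
  open ≡-Reasoning
  open TripleProduct α β
  s : ℕ
  s = α ℕ.+ β
  instance
    s≢0 : ℕ.NonZero s
    s≢0 = ℕ.>-nonZero (ℕₚ.<-≤-trans (ℕ.>-nonZero⁻¹ α) (ℕₚ.m≤m+n α β))

-- Sums over ℤ and ℤ²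

module ℤS = Data.Integer.Solver.+-*-Solver

Supp : ℕ → (ℤ → ℤ) → Set
Supp B g = ∀ k → B < ℤ.∣ k ∣ → g k ≡ 0ℤ

box : ℕ → (ℤ → ℤ) → ℤ
box B g = sumTo (suc (B ℕ.+ B)) (λ x → g (x ℤ.⊖ B))

range : ℤ → ℕ → (ℤ → ℤ) → ℤ
range l n g = sumTo n (λ x → g (l ℤ.+ + x))

box-cong : ∀ B {g h} → (∀ k → g k ≡ h k) → box B g ≡ box B h
box-cong B p = sumTo-cong′ (suc (B ℕ.+ B)) λ x → p (x ℤ.⊖ B)

box-range : ∀ B g → box B g ≡ range (ℤ.- + B) (suc (B ℕ.+ B)) g
box-range B g = sumTo-cong′ (suc (B ℕ.+ B)) λ x → cong g (sym (ℤₚ.-m+n≡n⊖m B x))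

sumTo-zero : ∀ n {g : ℕ → ℤ} → (∀ i → i < n → g i ≡ 0ℤ) → sumTo n g ≡ 0ℤ
sumTo-zero n p = trans (sumTo-cong n p) (sumTo-0 n)

-- The interval has d surplus points below -B and e above B; g vanishes on all of them.
range-supp : ∀ {B g} → Supp B g → ∀ d e → range (ℤ.- + (B ℕ.+ d)) (d ℕ.+ suc (B ℕ.+ B) ℕ.+ e) g ≡ box B g
range-supp {B} {g} z d e = begin
  sumTo (d ℕ.+ suc (B ℕ.+ B) ℕ.+ e) g′
    ≡⟨ sumTo-split (d ℕ.+ suc (B ℕ.+ B)) e g′ ⟩
  sumTo (d ℕ.+ suc (B ℕ.+ B)) g′ ℤ.+ sumTo e (λ x → g′ (d ℕ.+ suc (B ℕ.+ B) ℕ.+ x))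
    ≡⟨ cong₂ ℤ._+_ (sumTo-split d (suc (B ℕ.+ B)) g′) (sumTo-zero e λ x _ → above x) ⟩
  sumTo d g′ ℤ.+ sumTo (suc (B ℕ.+ B)) (λ x → g′ (d ℕ.+ x)) ℤ.+ 0ℤ
    ≡⟨ trans (ℤₚ.+-identityʳ _) (cong (ℤ._+ sumTo (suc (B ℕ.+ B)) (λ x → g′ (d ℕ.+ x))) (sumTo-zero d below)) ⟩
  0ℤ ℤ.+ sumTo (suc (B ℕ.+ B)) (λ x → g′ (d ℕ.+ x))
    ≡⟨ ℤₚ.+-identityˡ _ ⟩
  sumTo (suc (B ℕ.+ B)) (λ x → g′ (d ℕ.+ x))
    ≡⟨ sumTo-cong′ (suc (B ℕ.+ B)) (λ x → cong g (trans (cancel (+ B) (+ d) (+ x)) (ℤₚ.-m+n≡n⊖m B x))) ⟩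
  box B g ∎
  where
  open ≡-Reasoning
  g′ : ℕ → ℤ
  g′ x = g (ℤ.- + (B ℕ.+ d) ℤ.+ + x)
  cancel : ∀ b d x → ℤ.- (b ℤ.+ d) ℤ.+ (d ℤ.+ x) ≡ ℤ.- b ℤ.+ x
  cancel = ℤ-solve-∀
  above : ∀ x → g′ (d ℕ.+ suc (B ℕ.+ B) ℕ.+ x) ≡ 0ℤ
  above x = trans (cong g (lem (+ B) (+ d) (+ x))) (z (+ suc (B ℕ.+ x)) (s≤s (ℕₚ.m≤m+n B x)))
    where
    lem : ∀ b d x → ℤ.- (b ℤ.+ d) ℤ.+ (d ℤ.+ (1ℤ ℤ.+ (b ℤ.+ b)) ℤ.+ x) ≡ 1ℤ ℤ.+ (b ℤ.+ x)
    lem = ℤ-solve-∀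
  below : ∀ x → x < d → g′ x ≡ 0ℤ
  below x x<d with ℕₚ.m≤n⇒∃[o]m+o≡n x<d
  ... | r , refl = trans (cong g (lem (+ B) (+ x) (+ r))) (z -[1+ B ℕ.+ r ] (s≤s (ℕₚ.m≤m+n B r)))
    where
    lem : ∀ b x r → ℤ.- (b ℤ.+ (1ℤ ℤ.+ x ℤ.+ r)) ℤ.+ x ≡ ℤ.- (1ℤ ℤ.+ (b ℤ.+ r))
    lem = ℤ-solve-∀

range-covers : ∀ {B g l n} → Supp B g → ∀ d e → l ≡ ℤ.- + (B ℕ.+ d) → n ≡ d ℕ.+ suc (B ℕ.+ B) ℕ.+ e →
  range l n g ≡ box B g
range-covers z d e refl refl = range-supp z d e

box-stable : ∀ {B C g} → Supp B g → B ≤ C → box C g ≡ box B g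
box-stable {B} {C} {g} z B≤C with ℕₚ.m≤n⇒∃[o]m+o≡n B≤C
... | e , refl = trans (box-range (B ℕ.+ e) g) (range-covers z e e refl (lem B e))
  where
  lem : ∀ b e → suc (b ℕ.+ e ℕ.+ (b ℕ.+ e)) ≡ e ℕ.+ suc (b ℕ.+ b) ℕ.+ e
  lem = ℕ-Solver.solve-∀

supp-≤ : ∀ {B C g} → Supp B g → B ≤ C → Supp C g
supp-≤ z B≤C k C<k = z k (ℕₚ.≤-<-trans B≤C C<k)

supp-shift : ∀ {B g} c → Supp B g → Supp (B ℕ.+ ℤ.∣ c ∣) (λ k → g (k ℤ.+ c))
supp-shift {B} c z k B+c<k = z (k ℤ.+ c) (ℕₚ.+-cancelʳ-< ℤ.∣ c ∣ B ℤ.∣ k ℤ.+ c ∣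
  (ℕₚ.<-≤-trans B+c<k (ℕₚ.≤-trans (ℕₚ.≤-reflexive (cong ℤ.∣_∣ (lem k c))) (ℤₚ.∣i-j∣≤∣i∣+∣j∣ (k ℤ.+ c) c))))
  where
  lem : ∀ k c → k ≡ (k ℤ.+ c) ℤ.- c
  lem = ℤ-solve-∀

box-shift′ : ∀ {B g} c → Supp B g → box (B ℕ.+ ℤ.∣ c ∣) (λ k → g (k ℤ.+ c)) ≡ box B g
box-shift′ {B} {g} c z = trans (box-range (B ℕ.+ ℤ.∣ c ∣) (λ k → g (k ℤ.+ c)))
  (trans (sumTo-cong′ (suc (B ℕ.+ ℤ.∣ c ∣ ℕ.+ (B ℕ.+ ℤ.∣ c ∣))) λ x → cong g (rearrange (ℤ.- + (B ℕ.+ ℤ.∣ c ∣)) (+ x) c)) (covers c))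
  where
  rearrange : ∀ l x c → l ℤ.+ x ℤ.+ c ≡ l ℤ.+ c ℤ.+ x
  rearrange = ℤ-solve-∀
  covers : ∀ c → range (ℤ.- + (B ℕ.+ ℤ.∣ c ∣) ℤ.+ c) (suc (B ℕ.+ ℤ.∣ c ∣ ℕ.+ (B ℕ.+ ℤ.∣ c ∣))) g ≡ box B g
  covers (+ m) = range-covers z 0 (m ℕ.+ m)
    (trans (lem (+ B) (+ m)) (cong (λ k → ℤ.- + k) (sym (ℕₚ.+-identityʳ B)))) (len B m)
    where
    lem : ∀ b m → ℤ.- (b ℤ.+ m) ℤ.+ m ≡ ℤ.- b
    lem = ℤ-solve-∀
    len : ∀ b m → suc (b ℕ.+ m ℕ.+ (b ℕ.+ m)) ≡ 0 ℕ.+ suc (b ℕ.+ b) ℕ.+ (m ℕ.+ m)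
    len = ℕ-Solver.solve-∀
  covers c@(-[1+ m ]) = range-covers z (suc m ℕ.+ suc m) 0 (lem (+ B) (+ suc m)) (len B (suc m))
    where
    lem : ∀ b m → ℤ.- (b ℤ.+ m) ℤ.+ (ℤ.- m) ≡ ℤ.- (b ℤ.+ (m ℤ.+ m))
    lem = ℤ-solve-∀
    len : ∀ b m → suc (b ℕ.+ m ℕ.+ (b ℕ.+ m)) ≡ m ℕ.+ m ℕ.+ suc (b ℕ.+ b) ℕ.+ 0
    len = ℕ-Solver.solve-∀

box-shift : ∀ {B C g} c → Supp B g → B ℕ.+ ℤ.∣ c ∣ ≤ C → box C (λ k → g (k ℤ.+ c)) ≡ box B g
box-shift {g = g} c z le = trans (box-stable {g = λ k → g (k ℤ.+ c)} (supp-shift c z) le) (box-shift′ c z)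

-- A quotient is no larger than its dividend: |(d+1)j + c| ≥ |j|. For negative j this uses that the
-- remainder is below d + 1.
supp-class : ∀ {B g} d → Supp B g → ∀ c → c < suc d → Supp B (λ j → g (+ suc d ℤ.* j ℤ.+ + c))
supp-class {B} {g} d z c c<d (+ n) B<n = z _ (ℕₚ.<-≤-trans B<n (ℕₚ.≤-trans (ℕₚ.≤-trans (ℕₚ.m≤n*m n (suc d)) (ℕₚ.m≤m+n (suc d ℕ.* n) c))
  (ℕₚ.≤-reflexive (sym (cong (λ k → ℤ.∣ k ℤ.+ + c ∣) (sym (ℤₚ.pos-* (suc d) n)))))))
supp-class {B} {g} d z c c<d -[1+ n ] B<n with ℕₚ.m≤n⇒∃[o]m+o≡n c<d
... | r , e = z _ (ℕₚ.<-≤-trans B<n (ℕₚ.≤-trans (s≤s (ℕₚ.≤-trans (ℕₚ.m≤n*m n (suc d)) (ℕₚ.m≤m+n (suc d ℕ.* n) r)))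
  (ℕₚ.≤-reflexive (cong ℤ.∣_∣ (sym value)))))
  where
  open ≡-Reasoning
  value : + suc d ℤ.* -[1+ n ] ℤ.+ + c ≡ -[1+ suc d ℕ.* n ℕ.+ r ]
  value = begin
    + suc d ℤ.* (ℤ.- (1ℤ ℤ.+ + n)) ℤ.+ + c
      ≡⟨ lem (+ suc d) (+ n) (+ c) ⟩
    ℤ.- (+ suc d ℤ.* + n ℤ.+ (+ suc d ℤ.- + c))
      ≡⟨ cong₂ (λ x y → ℤ.- (x ℤ.+ (y ℤ.- + c))) (sym (ℤₚ.pos-* (suc d) n)) (cong +_ (sym e)) ⟩
    ℤ.- (+ (suc d ℕ.* n) ℤ.+ ((1ℤ ℤ.+ + c ℤ.+ + r) ℤ.- + c))
      ≡⟨ lem₂ (+ (suc d ℕ.* n)) (+ c) (+ r) ⟩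
    ℤ.- (1ℤ ℤ.+ (+ (suc d ℕ.* n) ℤ.+ + r)) ∎
    where
    lem : ∀ d n c → d ℤ.* (ℤ.- (1ℤ ℤ.+ n)) ℤ.+ c ≡ ℤ.- (d ℤ.* n ℤ.+ (d ℤ.- c))
    lem = ℤ-solve-∀
    lem₂ : ∀ x c r → ℤ.- (x ℤ.+ ((1ℤ ℤ.+ c ℤ.+ r) ℤ.- c)) ≡ ℤ.- (1ℤ ℤ.+ (x ℤ.+ r))
    lem₂ = ℤ-solve-∀

sumTo-* : ∀ N d g → sumTo (N ℕ.* d) g ≡ sumTo N (λ i → sumTo d (λ j → g (i ℕ.* d ℕ.+ j)))
sumTo-* zero    d g = refl
sumTo-* (suc N) d g = trans (cong (λ k → sumTo k g) (ℕₚ.+-comm d (N ℕ.* d)))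
  (trans (sumTo-split (N ℕ.* d) d g) (cong (ℤ._+ sumTo d (λ j → g (N ℕ.* d ℕ.+ j))) (sumTo-* N d g)))

box-classes : ∀ {B g} d → Supp B g → box B g ≡ sumTo (suc d) (λ c → box B (λ j → g (+ suc d ℤ.* j ℤ.+ + c)))
box-classes {B} {g} d z = sym (begin
  sumTo (suc d) (λ c → box B (λ j → g (+ suc d ℤ.* j ℤ.+ + c)))
    ≡⟨ sumTo-swap (suc d) (suc (B ℕ.+ B)) _ ⟩
  sumTo (suc (B ℕ.+ B)) (λ x → sumTo (suc d) (λ c → g (+ suc d ℤ.* (x ℤ.⊖ B) ℤ.+ + c)))
    ≡⟨ sumTo-cong′ (suc (B ℕ.+ B)) (λ x → sumTo-cong′ (suc d) λ c → cong g (position x c)) ⟩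
  sumTo (suc (B ℕ.+ B)) (λ x → sumTo (suc d) (λ c → g (ℤ.- + (B ℕ.+ B ℕ.* d) ℤ.+ + (x ℕ.* suc d ℕ.+ c))))
    ≡⟨ sym (sumTo-* (suc (B ℕ.+ B)) (suc d) _) ⟩
  range (ℤ.- + (B ℕ.+ B ℕ.* d)) (suc (B ℕ.+ B) ℕ.* suc d) g
    -- The classes together fill the interval from -B(d+1) to B(d+1) + d, that is Bd points below -B
    -- and Bd + d points above B.
    ≡⟨ range-covers z (B ℕ.* d) (d ℕ.+ B ℕ.* d) refl (len B d) ⟩
  box B g ∎)
  where
  open ≡-Reasoning
  len : ∀ b d → suc (b ℕ.+ b) ℕ.* suc d ≡ b ℕ.* d ℕ.+ suc (b ℕ.+ b) ℕ.+ (d ℕ.+ b ℕ.* d)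
  len = ℕ-Solver.solve-∀
  position : ∀ x c → + suc d ℤ.* (x ℤ.⊖ B) ℤ.+ + c ≡ ℤ.- + (B ℕ.+ B ℕ.* d) ℤ.+ + (x ℕ.* suc d ℕ.+ c)
  position x c = begin
    + suc d ℤ.* (x ℤ.⊖ B) ℤ.+ + c
      ≡⟨ cong (λ k → + suc d ℤ.* k ℤ.+ + c) (sym (ℤₚ.m-n≡m⊖n x B)) ⟩
    (1ℤ ℤ.+ + d) ℤ.* (+ x ℤ.- + B) ℤ.+ + c
      ≡⟨ lem (+ d) (+ x) (+ B) (+ c) ⟩
    ℤ.- (+ B ℤ.+ + B ℤ.* + d) ℤ.+ (+ x ℤ.* (1ℤ ℤ.+ + d) ℤ.+ + c)
      ≡⟨ cong₂ (λ y z → ℤ.- (+ B ℤ.+ y) ℤ.+ (z ℤ.+ + c)) (sym (ℤₚ.pos-* B d)) (sym (ℤₚ.pos-* x (suc d))) ⟩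
    ℤ.- + (B ℕ.+ B ℕ.* d) ℤ.+ + (x ℕ.* suc d ℕ.+ c) ∎
    where
    lem : ∀ d x b c → (1ℤ ℤ.+ d) ℤ.* (x ℤ.- b) ℤ.+ c ≡ ℤ.- (b ℤ.+ b ℤ.* d) ℤ.+ (x ℤ.* (1ℤ ℤ.+ d) ℤ.+ c)
    lem = ℤ-solve-∀

-- A relation that hides the window of summation, so that changes of variable may enlarge it freely;
-- `sums-unique` makes the total well defined.
record Sums (g : ℤ → ℤ) (s : ℤ) : Set where
  constructor sums
  field
    bound : ℕ
    supp  : Supp bound g
    total : box bound g ≡ s

sums-unique : ∀ {g s t} → Sums g s → Sums g t → s ≡ t
sums-unique {g} (sums B z p) (sums C y r) = trans (sym p) (trans (sym (box-stable z (ℕₚ.m≤m+n B C)))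
  (trans (box-stable y (ℕₚ.m≤n+m C B)) r))

sums-cong : ∀ {g h s} → (∀ k → g k ≡ h k) → Sums g s → Sums h s
sums-cong e (sums B z p) = sums B (λ k B<k → trans (sym (e k)) (z k B<k)) (trans (box-cong B λ k → sym (e k)) p)

sums-shift : ∀ c {g s} → Sums g s → Sums (λ k → g (k ℤ.+ c)) s
sums-shift c (sums B z p) = sums (B ℕ.+ ℤ.∣ c ∣) (supp-shift c z) (trans (box-shift′ c z) p)

sums-classes : ∀ d {g s} → Sums g s → ∃ λ r →
  (∀ c → c < suc d → Sums (λ j → g (+ suc d ℤ.* j ℤ.+ + c)) (r c)) × s ≡ sumTo (suc d) r
sums-classes d {g} (sums B z p) = _ , (λ c c<d → sums B (supp-class d z c c<d) refl) , trans (sym p) (box-classes d z)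

box₂ : ℕ → (ℤ → ℤ → ℤ) → ℤ
box₂ B h = box B (λ i → box B (h i))

record Sums₂ (h : ℤ → ℤ → ℤ) (s : ℤ) : Set where
  constructor sums₂
  field
    bound : ℕ
    supp₁ : ∀ i j → bound < ℤ.∣ i ∣ → h i j ≡ 0ℤ
    supp₂ : ∀ i → Supp bound (h i)
    total : box₂ bound h ≡ s

box-zero : ∀ B {g} → (∀ k → g k ≡ 0ℤ) → box B g ≡ 0ℤ
box-zero B p = sumTo-zero (suc (B ℕ.+ B)) λ x _ → p (x ℤ.⊖ B)

supp-box : ∀ {B C} {h : ℤ → ℤ → ℤ} → (∀ i j → B < ℤ.∣ i ∣ → h i j ≡ 0ℤ) → Supp B (λ i → box C (h i))
supp-box {C = C} z i B<i = box-zero C λ j → z i j B<i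

box₂-stable : ∀ {B C} {h : ℤ → ℤ → ℤ} → (∀ i j → B < ℤ.∣ i ∣ → h i j ≡ 0ℤ) → (∀ i → Supp B (h i)) → B ≤ C → box₂ C h ≡ box₂ B h
box₂-stable {B} {C} {h} z₁ z₂ B≤C = trans (box-cong C λ i → box-stable (z₂ i) B≤C)
  (box-stable {B} {C} {λ i → box B (h i)} (supp-box {B} {B} {h} z₁) B≤C)

sums₂-unique : ∀ {h s t} → Sums₂ h s → Sums₂ h t → s ≡ t
sums₂-unique {h} (sums₂ B z₁ z₂ p) (sums₂ C y₁ y₂ r) = trans (sym p)
  (trans (sym (box₂-stable {B} {B ℕ.+ C} {h} z₁ z₂ (ℕₚ.m≤m+n B C)))
  (trans (box₂-stable {C} {B ℕ.+ C} {h} y₁ y₂ (ℕₚ.m≤n+m C B)) r))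

sums₂-cong : ∀ {g h s} → (∀ i j → g i j ≡ h i j) → Sums₂ g s → Sums₂ h s
sums₂-cong e (sums₂ B z₁ z₂ p) = sums₂ B (λ i j B<i → trans (sym (e i j)) (z₁ i j B<i))
  (λ i j B<j → trans (sym (e i j)) (z₂ i j B<j)) (trans (box-cong B λ i → box-cong B λ j → sym (e i j)) p)

sums₂-swap : ∀ {h s} → Sums₂ h s → Sums₂ (λ i j → h j i) s
sums₂-swap {h} (sums₂ B z₁ z₂ p) = sums₂ B (λ i j → z₂ j i) (λ i j → z₁ j i)
  (trans (sumTo-swap (suc (B ℕ.+ B)) (suc (B ℕ.+ B)) (λ x y → h (y ℤ.⊖ B) (x ℤ.⊖ B))) p)

-- Rows with |i| > B vanish and the others are translated by at most |c|B, so the window B + |c|B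
-- suffices. Shears and the swap of coordinates provide the changes of basis used below.
sums₂-shear : ∀ c {h s} → Sums₂ h s → Sums₂ (λ i j → h i (j ℤ.+ c ℤ.* i)) s
sums₂-shear c {h} (sums₂ B z₁ z₂ p) = sums₂ D (λ i j D<i → z₁ i (j ℤ.+ c ℤ.* i) (ℕₚ.≤-<-trans B≤D D<i)) zeros
  (trans (box-cong D rows) (trans (box-stable {B} {D} {λ i → box B (h i)} (supp-box {B} {B} {h} z₁) B≤D) p))
  where
  D : ℕ
  D = B ℕ.+ ℤ.∣ c ∣ ℕ.* B
  B≤D : B ≤ D
  B≤D = ℕₚ.m≤m+n B (ℤ.∣ c ∣ ℕ.* B)
  B+∣ci∣≤D : ∀ i → ℤ.∣ i ∣ ≤ B → B ℕ.+ ℤ.∣ c ℤ.* i ∣ ≤ D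
  B+∣ci∣≤D i i≤B = ℕₚ.+-monoʳ-≤ B (ℕₚ.≤-trans (ℕₚ.≤-reflexive (ℤₚ.abs-* c i)) (ℕₚ.*-monoʳ-≤ ℤ.∣ c ∣ i≤B))
  zeros : ∀ i → Supp D (λ j → h i (j ℤ.+ c ℤ.* i))
  zeros i with ℕₚ.≤-<-connex ℤ.∣ i ∣ B
  ... | inj₁ i≤B = supp-≤ {g = λ j → h i (j ℤ.+ c ℤ.* i)} (supp-shift {g = h i} (c ℤ.* i) (z₂ i)) (B+∣ci∣≤D i i≤B)
  ... | inj₂ B<i = λ j _ → z₁ i (j ℤ.+ c ℤ.* i) B<i
  rows : ∀ i → box D (λ j → h i (j ℤ.+ c ℤ.* i)) ≡ box B (h i)
  rows i with ℕₚ.≤-<-connex ℤ.∣ i ∣ B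
  ... | inj₁ i≤B = box-shift {g = h i} (c ℤ.* i) (z₂ i) (B+∣ci∣≤D i i≤B)
  ... | inj₂ B<i = trans (box-zero D λ j → z₁ i (j ℤ.+ c ℤ.* i) B<i) (sym (box-zero B λ j → z₁ i j B<i))

sums₂-classes : ∀ d {h s} → Sums₂ h s → ∃ λ r →
  (∀ c → c < suc d → Sums₂ (λ i j → h i (+ suc d ℤ.* j ℤ.+ + c)) (r c)) × s ≡ sumTo (suc d) r
sums₂-classes d {h} (sums₂ B z₁ z₂ p) = _ ,
  (λ c c<d → sums₂ B (λ i j B<i → z₁ i _ B<i) (λ i → supp-class {g = h i} d (z₂ i) c c<d) refl) ,
  trans (sym p) (trans (box-cong B λ i → box-classes {g = h i} d (z₂ i))
    (sumTo-swap (suc (B ℕ.+ B)) (suc d) (λ x c → box B (λ j → h (x ℤ.⊖ B) (+ suc d ℤ.* j ℤ.+ + c)))))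

-- The ideal (1 + 2i) has index 5 in ℤ[i], and (u - 2w) + (w + 2u + c) i = (u + w i)(1 + 2i) + c i.
sums₂-quintic : ∀ {h s} → Sums₂ h s → ∃ λ r →
  (∀ c → c < 5 → Sums₂ (λ w u → h (u ℤ.- + 2 ℤ.* w) (w ℤ.+ + 2 ℤ.* u ℤ.+ + c)) (r c)) × s ≡ sumTo 5 r
sums₂-quintic {h} {s} p = split (sums₂-classes 4 sheared)
  where
  -- The coset of (a, b) is b - 2a modulo 5. This shear makes b - 2a a coordinate, which is divided
  -- by 5 as 5w + c; after a swap, the shear by -2 restores a = u - 2w.
  sheared : Sums₂ (λ i j → h i (j ℤ.+ + 2 ℤ.* i)) s
  sheared = sums₂-shear (+ 2) {h} p
  first : ∀ u w → u ℤ.+ (ℤ.- + 2) ℤ.* w ≡ u ℤ.- + 2 ℤ.* w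
  first = ℤ-solve-∀
  second : ∀ u w c → + 5 ℤ.* w ℤ.+ c ℤ.+ + 2 ℤ.* (u ℤ.+ (ℤ.- + 2) ℤ.* w) ≡ w ℤ.+ + 2 ℤ.* u ℤ.+ c
  second = ℤ-solve-∀
  split : (∃ λ r → (∀ c → c < 5 → Sums₂ (λ i j → h i (+ 5 ℤ.* j ℤ.+ + c ℤ.+ + 2 ℤ.* i)) (r c)) × s ≡ sumTo 5 r) → _
  split (r , classes , total) = r , (λ c c<5 → sums₂-cong {λ w u → h (u ℤ.+ (ℤ.- + 2) ℤ.* w) (+ 5 ℤ.* w ℤ.+ + c ℤ.+ + 2 ℤ.* (u ℤ.+ (ℤ.- + 2) ℤ.* w))}
    (λ w u → cong₂ h (first u w) (second u w (+ c)))
    (sums₂-shear (ℤ.- + 2) {λ w u → h u (+ 5 ℤ.* w ℤ.+ + c ℤ.+ + 2 ℤ.* u)}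
      (sums₂-swap {λ i j → h i (+ 5 ℤ.* j ℤ.+ + c ℤ.+ + 2 ℤ.* i)} (classes c c<5)))) , total

-- `a` is the sum of q^(e k) over all integers k, with a separate window for every coefficient.
HasGF : (ℤ → ℕ) → Series → Set
HasGF e a = ∀ n → Sums (λ k → mono (e k) n) (a n)

hasGF-shift : ∀ c {e a} → HasGF e a → HasGF (λ k → e (k ℤ.+ c)) a
hasGF-shift c p n = sums-shift c (p n)

hasGF-suc : ∀ {e a} → HasGF e a → HasGF (λ k → suc (e k)) (qTimes a)
hasGF-suc p zero    = sums 0 (λ k _ → refl) refl
hasGF-suc p (suc n) = p n

hasGF-Θ : ∀ α β .{{_ : ℕ.NonZero α}} .{{_ : ℕ.NonZero β}} → HasGF (weight α β) (Θ α β)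
hasGF-Θ α β n = sums n (λ k n<k → mono-small _ n (ℕₚ.<-≤-trans n<k (∣k∣≤weight α β k))) (sym (Θ-at α β n))

-- The coefficient of q^n in a product involves all degrees up to n, so a single window must serve
-- all of them.
hasGF-uniform : ∀ {e a} → HasGF e a → ∀ n → ∃ λ B →
  (∀ k → B < ℤ.∣ k ∣ → Agree n (mono (e k)) zeroS) × (∀ l → l ≤ n → box B (λ k → mono (e k) l) ≡ a l)
hasGF-uniform {e} p zero = bound ,
  (λ k B<k → upTo λ { .0 z≤n → supp k B<k }) , (λ { .0 z≤n → total })
  where open Sums (p 0)
hasGF-uniform {e} p (suc n) with hasGF-uniform p n | p (suc n)
... | B , z , t | sums C y r = B ℕ.⊔ C , zeros , totals
  where
  zeros : ∀ k → B ℕ.⊔ C < ℤ.∣ k ∣ → Agree (suc n) (mono (e k)) zeroS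
  zeros k lt = upTo λ i i≤sn → case i i≤sn
    where
    case : ∀ i → i ≤ suc n → mono (e k) i ≡ 0ℤ
    case i i≤sn with ℕₚ.m≤n⇒m<n∨m≡n i≤sn
    ... | inj₁ (s≤s i≤n) = upto (z k (ℕₚ.≤-<-trans (ℕₚ.m≤m⊔n B C) lt)) i i≤n
    ... | inj₂ refl      = y k (ℕₚ.≤-<-trans (ℕₚ.m≤n⊔m B C) lt)
  totals : ∀ l → l ≤ suc n → box (B ℕ.⊔ C) (λ k → mono (e k) l) ≡ _
  totals l l≤sn with ℕₚ.m≤n⇒m<n∨m≡n l≤sn
  ... | inj₁ (s≤s l≤n) = trans (box-stable {g = λ k → mono (e k) l} (λ k B<k → upto (z k B<k) l l≤n) (ℕₚ.m≤m⊔n B C)) (t l l≤n)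
  ... | inj₂ refl      = trans (box-stable {g = λ k → mono (e k) l} y (ℕₚ.m≤n⊔m B C)) r

sumTo-*ʳ : ∀ n c (g : ℕ → ℤ) → sumTo n (λ i → g i ℤ.* c) ≡ sumTo n g ℤ.* c
sumTo-*ʳ n c g = trans (sumTo-cong′ n λ i → ℤₚ.*-comm (g i) c) (trans (sumTo-*ˡ n c g) (ℤₚ.*-comm c (sumTo n g)))

hasGF-⊗ : ∀ {e e′ a b} → HasGF e a → HasGF e′ b → ∀ n → Sums₂ (λ i j → mono (e i ℕ.+ e′ j) n) ((a ⊗ b) n)
hasGF-⊗ {e} {e′} {a} {b} p r n with hasGF-uniform {e} {a} p n | hasGF-uniform {e′} {b} r n
... | B , z , t | C , y , v = sums₂ D
  (λ i j D<i → trans (sym (at (mono-⊗ (e i) (e′ j)) n)) (upto (agree-trans (⊗-agree (z i (ℕₚ.≤-<-trans (ℕₚ.m≤m⊔n B C) D<i)) (agree-refl {a = mono (e′ j)}))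
    (≈⇒agree (zeroS-⊗ (mono (e′ j))))) n ℕₚ.≤-refl))
  (λ i j D<j → trans (sym (at (mono-⊗ (e i) (e′ j)) n)) (upto (agree-trans (⊗-agree (agree-refl {a = mono (e i)}) (y j (ℕₚ.≤-<-trans (ℕₚ.m≤n⊔m B C) D<j)))
    (≈⇒agree (≈-trans (⊗-comm (mono (e i)) zeroS) (zeroS-⊗ (mono (e i)))))) n ℕₚ.≤-refl))
  (begin
    box D (λ i → box D (λ j → mono (e i ℕ.+ e′ j) n))
      ≡⟨ box-cong D (λ i → box-cong D λ j → trans (sym (at (mono-⊗ (e i) (e′ j)) n)) (at (⊗-def (mono (e i)) (mono (e′ j))) n)) ⟩
    box D (λ i → box D (λ j → sumTo (suc n) (λ l → mono (e i) l ℤ.* mono (e′ j) (n ∸ l))))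
      ≡⟨ box-cong D (λ i → sumTo-swap (suc (D ℕ.+ D)) (suc n) (λ y l → mono (e i) l ℤ.* mono (e′ (y ℤ.⊖ D)) (n ∸ l))) ⟩
    box D (λ i → sumTo (suc n) (λ l → box D (λ j → mono (e i) l ℤ.* mono (e′ j) (n ∸ l))))
      ≡⟨ box-cong D (λ i → sumTo-cong (suc n) λ { l (s≤s l≤n) → trans
           (sumTo-*ˡ (suc (D ℕ.+ D)) (mono (e i) l) (λ y → mono (e′ (y ℤ.⊖ D)) (n ∸ l)))
           (cong (mono (e i) l ℤ.*_) (trans (box-stable {C} {D} {λ j → mono (e′ j) (n ∸ l)} (λ k C<k → upto (y k C<k) (n ∸ l) (ℕₚ.m∸n≤m n l)) (ℕₚ.m≤n⊔m B C)) (v (n ∸ l) (ℕₚ.m∸n≤m n l)))) }) ⟩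
    box D (λ i → sumTo (suc n) (λ l → mono (e i) l ℤ.* b (n ∸ l)))
      ≡⟨ sumTo-swap (suc (D ℕ.+ D)) (suc n) (λ x l → mono (e (x ℤ.⊖ D)) l ℤ.* b (n ∸ l)) ⟩
    sumTo (suc n) (λ l → box D (λ i → mono (e i) l ℤ.* b (n ∸ l)))
      ≡⟨ sumTo-cong (suc n) (λ { l (s≤s l≤n) → trans
           (sumTo-*ʳ (suc (D ℕ.+ D)) (b (n ∸ l)) (λ x → mono (e (x ℤ.⊖ D)) l))
           (cong (ℤ._* b (n ∸ l)) (trans (box-stable {B} {D} {λ i → mono (e i) l} (λ k B<k → upto (z k B<k) l l≤n) (ℕₚ.m≤m⊔n B C)) (t l l≤n))) }) ⟩
    (a ⊛ b) n
      ≡⟨ sym (at (⊗-def a b) n) ⟩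
    (a ⊗ b) n ∎)
  where
  open ≡-Reasoning
  D : ℕ
  D = B ℕ.⊔ C

-- Dissections of φ² and ψ²

quadratic : ℕ → ℕ → ℤ → ℤ
quadratic α β k = + α ℤ.* (k ℤ.* (1ℤ ℤ.+ k)) ℤ.+ + β ℤ.* (k ℤ.* (k ℤ.- 1ℤ))

weights-≡ : ∀ d α β x y α₁ β₁ x₁ α₂ β₂ x₂ →
  quadratic α β x ℤ.+ quadratic α β y ≡ + 2 ℤ.* + d ℤ.+ (quadratic α₁ β₁ x₁ ℤ.+ quadratic α₂ β₂ x₂) →
  weight α β x ℕ.+ weight α β y ≡ d ℕ.+ (weight α₁ β₁ x₁ ℕ.+ weight α₂ β₂ x₂)
weights-≡ d α β x y α₁ β₁ x₁ α₂ β₂ x₂ p = double-injective (begin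
  + 2 ℤ.* (+ weight α β x ℤ.+ + weight α β y)
    ≡⟨ double-sum α β x α β y ⟩
  quadratic α β x ℤ.+ quadratic α β y
    ≡⟨ p ⟩
  + 2 ℤ.* + d ℤ.+ (quadratic α₁ β₁ x₁ ℤ.+ quadratic α₂ β₂ x₂)
    ≡⟨ cong (ℤ._+_ (+ 2 ℤ.* + d)) (sym (double-sum α₁ β₁ x₁ α₂ β₂ x₂)) ⟩
  + 2 ℤ.* + d ℤ.+ + 2 ℤ.* (+ weight α₁ β₁ x₁ ℤ.+ + weight α₂ β₂ x₂)
    ≡⟨ sym (ℤₚ.*-distribˡ-+ (+ 2) (+ d) _) ⟩
  + 2 ℤ.* + (d ℕ.+ (weight α₁ β₁ x₁ ℕ.+ weight α₂ β₂ x₂)) ∎)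
  where
  open ≡-Reasoning
  double-sum : ∀ α β x γ δ y →
    + 2 ℤ.* (+ weight α β x ℤ.+ + weight γ δ y) ≡ quadratic α β x ℤ.+ quadratic γ δ y
  double-sum α β x γ δ y = trans (ℤₚ.*-distribˡ-+ (+ 2) (+ weight α β x) (+ weight γ δ y))
    (cong₂ ℤ._+_ (double-weight α β x) (double-weight γ δ y))

weight-≡ : ∀ α β x γ δ y → quadratic α β x ≡ quadratic γ δ y → weight α β x ≡ weight γ δ y
weight-≡ α β x γ δ y p = double-injective (trans (double-weight α β x) (trans p (sym (double-weight γ δ y))))

:quadratic : ∀ {n} → ℕ → ℕ → ℤS.Polynomial n → ℤS.Polynomial n
:quadratic α β k = ℤS.con (+ α) ℤS.:* (k ℤS.:* (ℤS.con 1ℤ ℤS.:+ k)) ℤS.:+ ℤS.con (+ β) ℤS.:* (k ℤS.:* (k ℤS.:- ℤS.con 1ℤ))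

-- `a` is what the coset of c contributes to the square of the sum of q^(e k).
Class : (ℤ → ℕ) → ℕ → Series → Set
Class e c a = ∀ n → Sums₂ (λ w u → mono (e (u ℤ.- + 2 ℤ.* w) ℕ.+ e (w ℤ.+ + 2 ℤ.* u ℤ.+ + c)) n) (a n)

quintic : ∀ {e a a₀ a₁ a₂ a₃ a₄} → HasGF e a →
  Class e 0 a₀ → Class e 1 a₁ → Class e 2 a₂ → Class e 3 a₃ → Class e 4 a₄ →
  a ⊗ a ≈ a₀ ⊞ a₁ ⊞ a₂ ⊞ a₃ ⊞ a₄
quintic {e} {a} {a₀} {a₁} {a₂} {a₃} {a₄} p p₀ p₁ p₂ p₃ p₄ = pointwise λ n → go n (sums₂-quintic (hasGF-⊗ {e} {e} {a} {a} p p n))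
  where
  open ≡-Reasoning
  go : ∀ n → (∃ λ r → (∀ c → c < 5 → Sums₂ (λ w u → mono (e (u ℤ.- + 2 ℤ.* w) ℕ.+ e (w ℤ.+ + 2 ℤ.* u ℤ.+ + c)) n) (r c))
       × (a ⊗ a) n ≡ sumTo 5 r) → (a ⊗ a) n ≡ (a₀ ⊞ a₁ ⊞ a₂ ⊞ a₃ ⊞ a₄) n
  go n (r , classes , total) = begin
    (a ⊗ a) n
      ≡⟨ total ⟩
    0ℤ ℤ.+ r 0 ℤ.+ r 1 ℤ.+ r 2 ℤ.+ r 3 ℤ.+ r 4
      ≡⟨ cong (λ x → x ℤ.+ r 1 ℤ.+ r 2 ℤ.+ r 3 ℤ.+ r 4) (ℤₚ.+-identityˡ (r 0)) ⟩
    r 0 ℤ.+ r 1 ℤ.+ r 2 ℤ.+ r 3 ℤ.+ r 4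
      ≡⟨ cong₂ ℤ._+_ (cong₂ ℤ._+_ (cong₂ ℤ._+_ (cong₂ ℤ._+_
           (sums₂-unique (classes 0 (s≤s z≤n)) (p₀ n))
           (sums₂-unique (classes 1 (s≤s (s≤s z≤n))) (p₁ n)))
           (sums₂-unique (classes 2 (s≤s (s≤s (s≤s z≤n)))) (p₂ n)))
           (sums₂-unique (classes 3 (s≤s (s≤s (s≤s (s≤s z≤n))))) (p₃ n)))
           (sums₂-unique (classes 4 (s≤s (s≤s (s≤s (s≤s (s≤s z≤n)))))) (p₄ n)) ⟩
    a₀ n ℤ.+ a₁ n ℤ.+ a₂ n ℤ.+ a₃ n ℤ.+ a₄ n
      ≡⟨ sym (trans (⊞-at (a₀ ⊞ a₁ ⊞ a₂ ⊞ a₃) a₄ n) (cong (ℤ._+ a₄ n) (trans (⊞-at (a₀ ⊞ a₁ ⊞ a₂) a₃ n)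
           (cong (ℤ._+ a₃ n) (trans (⊞-at (a₀ ⊞ a₁) a₂ n) (cong (ℤ._+ a₂ n) (⊞-at a₀ a₁ n))))))) ⟩
    (a₀ ⊞ a₁ ⊞ a₂ ⊞ a₃ ⊞ a₄) n ∎

-- Multiplication by 1 + 2i is a similarity, so the exponent has no mixed term in u and w and the
-- sum over the coset factors into two theta series. The translations `c₁` and `c₂` adjust the
-- linear terms to the shape of `weight`.
class₀ : ∀ c α β α₁ β₁ c₁ α₂ β₂ c₂ {a₁ a₂} →
  HasGF (weight α₁ β₁) a₁ → HasGF (weight α₂ β₂) a₂ →
  (∀ w u → quadratic α β (u ℤ.- + 2 ℤ.* w) ℤ.+ quadratic α β (w ℤ.+ + 2 ℤ.* u ℤ.+ + c)
    ≡ 0ℤ ℤ.+ (quadratic α₁ β₁ (w ℤ.+ c₁) ℤ.+ quadratic α₂ β₂ (u ℤ.+ c₂))) →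
  Class (weight α β) c (a₁ ⊗ a₂)
class₀ c α β α₁ β₁ c₁ α₂ β₂ c₂ {a₁} {a₂} p₁ p₂ eq n = sums₂-cong
  (λ w u → cong (λ d → mono d n) (sym (weights-≡ 0 α β (u ℤ.- + 2 ℤ.* w) (w ℤ.+ + 2 ℤ.* u ℤ.+ + c)
    α₁ β₁ (w ℤ.+ c₁) α₂ β₂ (u ℤ.+ c₂) (eq w u))))
  (hasGF-⊗ {λ w → weight α₁ β₁ (w ℤ.+ c₁)} {λ u → weight α₂ β₂ (u ℤ.+ c₂)}
    (hasGF-shift c₁ {weight α₁ β₁} {a₁} p₁) (hasGF-shift c₂ {weight α₂ β₂} {a₂} p₂) n)

-- For cosets whose exponent leaves the constant 1 after both translations, hence one factor q; the
-- 2 in the hypothesis is that 1 doubled.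
class₁ : ∀ c α β α₁ β₁ c₁ α₂ β₂ c₂ {a₁ a₂} →
  HasGF (weight α₁ β₁) a₁ → HasGF (weight α₂ β₂) a₂ →
  (∀ w u → quadratic α β (u ℤ.- + 2 ℤ.* w) ℤ.+ quadratic α β (w ℤ.+ + 2 ℤ.* u ℤ.+ + c)
    ≡ + 2 ℤ.+ (quadratic α₁ β₁ (w ℤ.+ c₁) ℤ.+ quadratic α₂ β₂ (u ℤ.+ c₂))) →
  Class (weight α β) c (qTimes a₁ ⊗ a₂)
class₁ c α β α₁ β₁ c₁ α₂ β₂ c₂ {a₁} {a₂} p₁ p₂ eq n = sums₂-cong
  (λ w u → cong (λ d → mono d n) (sym (weights-≡ 1 α β (u ℤ.- + 2 ℤ.* w) (w ℤ.+ + 2 ℤ.* u ℤ.+ + c)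
    α₁ β₁ (w ℤ.+ c₁) α₂ β₂ (u ℤ.+ c₂) (eq w u))))
  (hasGF-⊗ {λ w → suc (weight α₁ β₁ (w ℤ.+ c₁))} {λ u → weight α₂ β₂ (u ℤ.+ c₂)}
    (hasGF-suc {λ w → weight α₁ β₁ (w ℤ.+ c₁)} {a₁} (hasGF-shift c₁ {weight α₁ β₁} {a₁} p₁)) (hasGF-shift c₂ {weight α₂ β₂} {a₂} p₂) n)

:class : ℕ → ℕ → ℕ → ℕ → ℕ → ℕ → ℤ → ℕ → ℕ → ℤ → ℤS.Polynomial 2 → ℤS.Polynomial 2 →
  ℤS.Polynomial 2 × ℤS.Polynomial 2
:class d c α β α₁ β₁ c₁ α₂ β₂ c₂ w u =
  (:quadratic α β (u ℤS.:- ℤS.con (+ 2) ℤS.:* w) ℤS.:+ :quadratic α β (w ℤS.:+ ℤS.con (+ 2) ℤS.:* u ℤS.:+ ℤS.con (+ c)))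
  ℤS.:= (ℤS.con (+ 2 ℤ.* + d) ℤS.:+ (:quadratic α₁ β₁ (w ℤS.:+ ℤS.con c₁) ℤS.:+ :quadratic α₂ β₂ (u ℤS.:+ ℤS.con c₂)))

Θ-swap : ∀ α β .{{_ : ℕ.NonZero α}} .{{_ : ℕ.NonZero β}} → Θ α β ≈ Θ β α
Θ-swap α β = ≈-trans (triple-product α β) (≈-trans
  (subst (λ s → η (α ℕ.+ β) ⊗ (Q 1ℤ α (α ℕ.+ β) ⊗ Q 1ℤ β (α ℕ.+ β)) ≈ η s ⊗ (Q 1ℤ β s ⊗ Q 1ℤ α s)) (ℕₚ.+-comm α β)
    (⊗-cong ≈-refl (⊗-comm _ _)))
  (≈-sym (triple-product β α)))

-- Multiplication by i preserves x² + y² and permutes the four nonzero cosets of (1 + 2i), so these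
-- contribute equal products; hence the 4. The factor q reflects their least norm 1.
φ-quintic : Θ 1 1 ⊗ Θ 1 1 ≈ Θ 5 5 ⊗ Θ 5 5 ⊞ const (+ 4) ⊗ (q ⊗ (Θ 7 3 ⊗ Θ 9 1))
φ-quintic = ≈-trans
  (quintic {weight 1 1} (hasGF-Θ 1 1)
    (class₀ 0 1 1 5 5 0ℤ 5 5 0ℤ (hasGF-Θ 5 5) (hasGF-Θ 5 5) (ℤS.solve 2 (:class 0 0 1 1 5 5 0ℤ 5 5 0ℤ) refl))
    (class₁ 1 1 1 7 3 0ℤ 9 1 0ℤ (hasGF-Θ 7 3) (hasGF-Θ 9 1) (ℤS.solve 2 (:class 1 1 1 1 7 3 0ℤ 9 1 0ℤ) refl))
    (class₁ 2 1 1 9 1 0ℤ 3 7 1ℤ (hasGF-Θ 9 1) (hasGF-Θ 3 7) (ℤS.solve 2 (:class 1 2 1 1 9 1 0ℤ 3 7 1ℤ) refl))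
    (class₁ 3 1 1 1 9 1ℤ 7 3 1ℤ (hasGF-Θ 1 9) (hasGF-Θ 7 3) (ℤS.solve 2 (:class 1 3 1 1 1 9 1ℤ 7 3 1ℤ) refl))
    (class₁ 4 1 1 3 7 1ℤ 1 9 (+ 2) (hasGF-Θ 3 7) (hasGF-Θ 1 9) (ℤS.solve 2 (:class 1 4 1 1 3 7 1ℤ 1 9 (+ 2)) refl)))
  (≈-trans (⊞-cong (⊞-cong (⊞-cong (⊞-cong ≈-refl
      (⊗-cong (qTimes≈ (Θ 7 3)) ≈-refl))
      (⊗-cong (qTimes≈ (Θ 9 1)) (Θ-swap 3 7)))
      (⊗-cong (≈-trans (qTimes≈ (Θ 1 9)) (⊗-cong ≈-refl (Θ-swap 1 9))) ≈-refl))
      (⊗-cong (≈-trans (qTimes≈ (Θ 3 7)) (⊗-cong ≈-refl (Θ-swap 3 7))) (Θ-swap 1 9)))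
    (solve 4 (λ a b c q → a :* a :+ q :* b :* c :+ q :* c :* b :+ q :* c :* b :+ q :* b :* c
      := a :* a :+ con (+ 4) :* (q :* (b :* c))) ≈-refl (Θ 5 5) (Θ 7 3) (Θ 9 1) q))

opaque
  -- This is 2ψ(q^m): k and -1-k give the same triangular number. The window is n + 1 because k =
  -- -(n+1) has only the weight m n(n+1)/2; already k = -1 has weight 0.
  Ψ : ℕ → Series
  Ψ m n = box (suc n) (λ k → mono (weight m 0 k) n)

  Ψ-at : ∀ m n → Ψ m n ≡ box (suc n) (λ k → mono (weight m 0 k) n)
  Ψ-at m n = refl

hasGF-Ψ : ∀ m .{{_ : ℕ.NonZero m}} → HasGF (weight m 0) (Ψ m)
hasGF-Ψ m n = sums (suc n) (λ k n<k → mono-small _ n (ℕₚ.≤-pred (ℕₚ.≤-trans n<k (bound k)))) (sym (Ψ-at m n))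
  where
  bound : ∀ k → ℤ.∣ k ∣ ≤ suc (weight m 0 k)
  bound (+ n)    = ℕₚ.m≤n⇒m≤1+n (ℕₚ.≤-trans (n≤tri n) (ℕₚ.≤-trans (ℕₚ.m≤n*m (tri n) m) (ℕₚ.m≤m+n _ 0)))
  bound -[1+ n ] = s≤s (ℕₚ.≤-trans (n≤tri n) (ℕₚ.≤-trans (ℕₚ.m≤n*m (tri n) m) (ℕₚ.m≤m+n _ 0)))

-- The triple product above requires positive exponents, whereas `weight m 0` has β = 0. Splitting k
-- by parity leads to positive exponents, 3m and m in the two applications; odd k give the mirror
-- image of the even ones.
Ψ-parity : ∀ m α β .{{_ : ℕ.NonZero m}} .{{_ : ℕ.NonZero α}} .{{_ : ℕ.NonZero β}} →
  (∀ j → quadratic m 0 (+ 2 ℤ.* j ℤ.+ 0ℤ) ≡ quadratic α β j) →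
  (∀ j → quadratic m 0 (+ 2 ℤ.* j ℤ.+ 1ℤ) ≡ quadratic β α (j ℤ.+ 1ℤ)) →
  Ψ m ≈ const (+ 2) ⊗ Θ α β
Ψ-parity m α β even-eq odd-eq = ≈-trans (pointwise λ n → go n (sums-classes 1 (hasGF-Ψ m n)))
  (≈-trans (⊞-cong (≈-refl {Θ α β}) (Θ-swap β α)) (solve 1 (λ a → a :+ a := con (+ 2) :* a) ≈-refl (Θ α β)))
  where
  go : ∀ n → (∃ λ r → (∀ c → c < 2 → Sums (λ j → mono (weight m 0 (+ 2 ℤ.* j ℤ.+ + c)) n) (r c)) × Ψ m n ≡ sumTo 2 r) →
    Ψ m n ≡ (Θ α β ⊞ Θ β α) n
  go n (r , classes , total) = trans total (trans (cong₂ ℤ._+_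
    (trans (ℤₚ.+-identityˡ (r 0)) (sums-unique (classes 0 (s≤s z≤n)) (sums-cong
      (λ j → cong (λ d → mono d n) (sym (weight-≡ m 0 (+ 2 ℤ.* j ℤ.+ 0ℤ) α β j (even-eq j)))) (hasGF-Θ α β n))))
    (sums-unique (classes 1 (s≤s (s≤s z≤n))) (sums-cong
      (λ j → cong (λ d → mono d n) (sym (weight-≡ m 0 (+ 2 ℤ.* j ℤ.+ 1ℤ) β α (j ℤ.+ 1ℤ) (odd-eq j))))
      (sums-shift 1ℤ (hasGF-Θ β α n)))))
    (sym (⊞-at (Θ α β) (Θ β α) n)))

Ψ-1 : Ψ 1 ≈ const (+ 2) ⊗ Θ 3 1
Ψ-1 = Ψ-parity 1 3 1
  (ℤS.solve 1 (λ j → :quadratic 1 0 (ℤS.con (+ 2) ℤS.:* j ℤS.:+ ℤS.con 0ℤ) ℤS.:= :quadratic 3 1 j) refl)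
  (ℤS.solve 1 (λ j → :quadratic 1 0 (ℤS.con (+ 2) ℤS.:* j ℤS.:+ ℤS.con 1ℤ) ℤS.:= :quadratic 1 3 (j ℤS.:+ ℤS.con 1ℤ)) refl)

Ψ-5 : Ψ 5 ≈ const (+ 2) ⊗ Θ 15 5
Ψ-5 = Ψ-parity 5 15 5
  (ℤS.solve 1 (λ j → :quadratic 5 0 (ℤS.con (+ 2) ℤS.:* j ℤS.:+ ℤS.con 0ℤ) ℤS.:= :quadratic 15 5 j) refl)
  (ℤS.solve 1 (λ j → :quadratic 5 0 (ℤS.con (+ 2) ℤS.:* j ℤS.:+ ℤS.con 1ℤ) ℤS.:= :quadratic 5 15 (j ℤS.:+ ℤS.con 1ℤ)) refl)

-- The sum of two triangular numbers is invariant under the quarter turn about (-1/2, -1/2). It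
-- fixes the coset c = 3, which yields the square of `Ψ 5`, and permutes the other four, which yield
-- equal products. As `Ψ` is 2ψ, everything carries a factor 4.
ψ-quintic : Θ 3 1 ⊗ Θ 3 1 ≈ Θ 4 1 ⊗ Θ 3 2 ⊞ q ⊗ (Θ 15 5 ⊗ Θ 15 5)
ψ-quintic = const-cancel (+ 4) (begin
  const (+ 4) ⊗ (Θ 3 1 ⊗ Θ 3 1)
    ≈⟨ solve 1 (λ a → con (+ 4) :* (a :* a) := (con (+ 2) :* a) :* (con (+ 2) :* a)) ≈-refl (Θ 3 1) ⟩
  (const (+ 2) ⊗ Θ 3 1) ⊗ (const (+ 2) ⊗ Θ 3 1)
    ≈⟨ ⊗-cong Ψ-1 Ψ-1 ⟨
  Ψ 1 ⊗ Ψ 1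
    ≈⟨ quintic {weight 1 0} (hasGF-Ψ 1)
      (class₀ 0 1 0 2 3 0ℤ 4 1 0ℤ (hasGF-Θ 2 3) (hasGF-Θ 4 1) (ℤS.solve 2 (:class 0 0 1 0 2 3 0ℤ 4 1 0ℤ) refl))
      (class₀ 1 1 0 3 2 0ℤ 1 4 1ℤ (hasGF-Θ 3 2) (hasGF-Θ 1 4) (ℤS.solve 2 (:class 0 1 1 0 3 2 0ℤ 1 4 1ℤ) refl))
      (class₀ 2 1 0 4 1 0ℤ 3 2 1ℤ (hasGF-Θ 4 1) (hasGF-Θ 3 2) (ℤS.solve 2 (:class 0 2 1 0 4 1 0ℤ 3 2 1ℤ) refl))
      (class₁ 3 1 0 5 0 0ℤ 5 0 1ℤ (hasGF-Ψ 5) (hasGF-Ψ 5) (ℤS.solve 2 (:class 1 3 1 0 5 0 0ℤ 5 0 1ℤ) refl))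
      (class₀ 4 1 0 1 4 1ℤ 2 3 (+ 2) (hasGF-Θ 1 4) (hasGF-Θ 2 3) (ℤS.solve 2 (:class 0 4 1 0 1 4 1ℤ 2 3 (+ 2)) refl)) ⟩
  Θ 2 3 ⊗ Θ 4 1 ⊞ Θ 3 2 ⊗ Θ 1 4 ⊞ Θ 4 1 ⊗ Θ 3 2 ⊞ qTimes (Ψ 5) ⊗ Ψ 5 ⊞ Θ 1 4 ⊗ Θ 2 3
    ≈⟨ ⊞-cong (⊞-cong (⊞-cong (⊞-cong
        (⊗-cong (Θ-swap 2 3) ≈-refl) (⊗-cong ≈-refl (Θ-swap 1 4))) ≈-refl)
        (⊗-cong (≈-trans (qTimes≈ (Ψ 5)) (⊗-cong ≈-refl Ψ-5)) Ψ-5)) (⊗-cong (Θ-swap 1 4) (Θ-swap 2 3)) ⟩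
  Θ 3 2 ⊗ Θ 4 1 ⊞ Θ 3 2 ⊗ Θ 4 1 ⊞ Θ 4 1 ⊗ Θ 3 2 ⊞ q ⊗ (const (+ 2) ⊗ Θ 15 5) ⊗ (const (+ 2) ⊗ Θ 15 5) ⊞ Θ 4 1 ⊗ Θ 3 2
    ≈⟨ solve 4 (λ a b c q → a :* b :+ a :* b :+ b :* a :+ q :* (con (+ 2) :* c) :* (con (+ 2) :* c) :+ b :* a
        := con (+ 4) :* (b :* a :+ q :* (c :* c))) ≈-refl (Θ 3 2) (Θ 4 1) (Θ 15 5) q ⟩
  const (+ 4) ⊗ (Θ 4 1 ⊗ Θ 3 2 ⊞ q ⊗ (Θ 15 5 ⊗ Θ 15 5)) ∎)
  where open ≈R

-- Theta series as eta products

-- Linear combinations: a - b = c (x - y), stated without subtraction.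
combine : ∀ {a b c x y} → x ≈ y → a ⊞ c ⊗ y ≈ b ⊞ c ⊗ x → a ≈ b
combine {a} {b} {c} {x} {y} p r = begin
  a                               ≈⟨ solve 2 (λ a z → a := a :+ z :- z) ≈-refl a (c ⊗ y) ⟩
  a ⊞ c ⊗ y ⊞ ⊟ (c ⊗ y)           ≈⟨ ⊞-cong r (⊟-cong (⊗-cong (≈-refl {c}) (≈-sym p))) ⟩
  b ⊞ c ⊗ x ⊞ ⊟ (c ⊗ x)           ≈⟨ solve 2 (λ b z → b :+ z :- z := b) ≈-refl b (c ⊗ x) ⟩
  b ∎
  where open ≈R

-- The quotient f_m / f_2m, that is (q^m; q^2m)_∞.
odd-part : ℕ → Series
odd-part m = Q ℤ.-1ℤ m (m ℕ.+ m)

η-odd-part : ∀ m .{{_ : ℕ.NonZero m}} → η m ≈ odd-part m ⊗ η (m ℕ.+ m)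
η-odd-part m = ≈-trans (η-def m) (≈-trans (Q-split 1 ℤ.-1ℤ m m)
  (⊗-cong (≈-trans (⊗-identityˡ _) (Q-≡ (e₁ m) (e₂ m))) (≈-trans (Q-≡ (e₃ m) (e₂ m)) (≈-sym (η-def (m ℕ.+ m))))))
  where
  Q-≡ : ∀ {α α′ s s′} → α ≡ α′ → s ≡ s′ → Q ℤ.-1ℤ α s ≈ Q ℤ.-1ℤ α′ s′
  Q-≡ refl refl = ≈-refl
  e₁ : ∀ m → m ℕ.+ m ℕ.* 0 ≡ m
  e₁ = ℕ-Solver.solve-∀
  e₂ : ∀ m → m ℕ.* 2 ≡ m ℕ.+ m
  e₂ = ℕ-Solver.solve-∀
  e₃ : ∀ m → m ℕ.+ m ℕ.* 1 ≡ m ℕ.+ m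
  e₃ = ℕ-Solver.solve-∀

ν-η : ∀ m .{{_ : ℕ.NonZero m}} → ν (η (dbl m)) ≈ η (dbl m)
ν-η m = ≈-trans (ν-cong (≈-sym (V-η m))) (≈-trans (ν-V (η m)) (V-η m))

-- Only the factors with odd exponent change sign under q ↦ -q, and (-q; q²)(q; q²) = (q²; q⁴) =
-- f_2/f_4. Hence f_1(-q) = f_2³/(f_1 f_4).
ν-η-1 : ν (η 1) ⊗ η 1 ⊗ η 4 ≈ η 2 ^^ 3
ν-η-1 = begin
  ν (η 1) ⊗ η 1 ⊗ η 4
    ≈⟨ ⊗-cong (⊗-cong (≈-trans (ν-cong (η-odd-part 1)) (≈-trans (ν-⊗ (odd-part 1) (η 2)) (⊗-cong (ν-Q ℤ.-1ℤ 0 1) (ν-η 1)))) (η-odd-part 1)) ≈-refl ⟩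
  Q 1ℤ 1 2 ⊗ η 2 ⊗ (odd-part 1 ⊗ η 2) ⊗ η 4
    ≈⟨ solve 4 (λ a b c d → a :* b :* (c :* b) :* d := b :* b :* ((a :* c) :* d)) ≈-refl (Q 1ℤ 1 2) (η 2) (odd-part 1) (η 4) ⟩
  η 2 ⊗ η 2 ⊗ ((Q 1ℤ 1 2 ⊗ odd-part 1) ⊗ η 4)
    ≈⟨ ⊗-cong ≈-refl (≈-trans (⊗-cong (Q-± 1 2) ≈-refl) (≈-sym (η-odd-part 2))) ⟩
  η 2 ⊗ η 2 ⊗ η 2
    ≈⟨ solve 1 (λ a → a :* a :* a := a :^ 3) ≈-refl (η 2) ⟩
  η 2 ^^ 3 ∎
  where open ≈R

ν-η-5 : ν (η 5) ⊗ η 5 ⊗ η 20 ≈ η 10 ^^ 3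
ν-η-5 = begin
  ν (η 5) ⊗ η 5 ⊗ η 20
    ≈⟨ ⊗-cong (⊗-cong (≈-trans (ν-cong (η-odd-part 5)) (≈-trans (ν-⊗ (odd-part 5) (η 10)) (⊗-cong (ν-Q ℤ.-1ℤ 2 5) (ν-η 5)))) (η-odd-part 5)) ≈-refl ⟩
  Q 1ℤ 5 10 ⊗ η 10 ⊗ (odd-part 5 ⊗ η 10) ⊗ η 20
    ≈⟨ solve 4 (λ a b c d → a :* b :* (c :* b) :* d := b :* b :* ((a :* c) :* d)) ≈-refl (Q 1ℤ 5 10) (η 10) (odd-part 5) (η 20) ⟩
  η 10 ⊗ η 10 ⊗ ((Q 1ℤ 5 10 ⊗ odd-part 5) ⊗ η 20)
    ≈⟨ ⊗-cong ≈-refl (≈-trans (⊗-cong (Q-± 5 10) ≈-refl) (≈-sym (η-odd-part 10))) ⟩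
  η 10 ⊗ η 10 ⊗ η 10
    ≈⟨ solve 1 (λ a → a :* a :* a := a :^ 3) ≈-refl (η 10) ⟩
  η 10 ^^ 3 ∎
  where open ≈R

-- This is φ(-q) = f_1²/f_2. The dissection of φ² is used at -q because its terms are then built
-- from f_1, f_2, f_5 and f_10; at q, f_4 and f_20 would enter.
ν-Θ-1 : ν (Θ 1 1) ⊗ η 2 ≈ η 1 ^^ 2
ν-Θ-1 = begin
  ν (Θ 1 1) ⊗ η 2
    ≈⟨ ⊗-cong (≈-trans (ν-cong (triple-product 1 1)) (≈-trans (ν-⊗ (η 2) _) (⊗-cong (ν-η 1) (≈-trans (ν-⊗ _ _) (⊗-cong (ν-Q 1ℤ 0 1) (ν-Q 1ℤ 0 1)))))) ≈-refl ⟩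
  η 2 ⊗ (odd-part 1 ⊗ odd-part 1) ⊗ η 2
    ≈⟨ solve 2 (λ a o → a :* (o :* o) :* a := (o :* a) :^ 2) ≈-refl (η 2) (odd-part 1) ⟩
  (odd-part 1 ⊗ η 2) ^^ 2
    ≈⟨ ⊗-cong (η-odd-part 1) (⊗-cong (η-odd-part 1) ≈-refl) ⟨
  η 1 ^^ 2 ∎
  where open ≈R

ν-Θ-5 : ν (Θ 5 5) ⊗ η 10 ≈ η 5 ^^ 2
ν-Θ-5 = begin
  ν (Θ 5 5) ⊗ η 10
    ≈⟨ ⊗-cong (≈-trans (ν-cong (triple-product 5 5)) (≈-trans (ν-⊗ (η 10) _) (⊗-cong (ν-η 5) (≈-trans (ν-⊗ _ _) (⊗-cong (ν-Q 1ℤ 2 5) (ν-Q 1ℤ 2 5)))))) ≈-refl ⟩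
  η 10 ⊗ (odd-part 5 ⊗ odd-part 5) ⊗ η 10
    ≈⟨ solve 2 (λ a o → a :* (o :* o) :* a := (o :* a) :^ 2) ≈-refl (η 10) (odd-part 5) ⟩
  (odd-part 5 ⊗ η 10) ^^ 2
    ≈⟨ ⊗-cong (η-odd-part 5) (⊗-cong (η-odd-part 5) ≈-refl) ⟨
  η 5 ^^ 2 ∎
  where open ≈R

Q-split-5 : odd-part 1 ≈ oneS ⊗ Q ℤ.-1ℤ 1 10 ⊗ Q ℤ.-1ℤ 3 10 ⊗ Q ℤ.-1ℤ 5 10 ⊗ Q ℤ.-1ℤ 7 10 ⊗ Q ℤ.-1ℤ 9 10
Q-split-5 = Q-split 4 ℤ.-1ℤ 1 2

-- The theta series supply the exponents 1, 3, 7, 9 modulo 10, and `η 5` supplies the missing class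
-- 5; together they form (q; q²)_∞ = f_1/f_2.
ν-Θ-Θ : ν (Θ 7 3 ⊗ Θ 9 1) ⊗ η 5 ⊗ η 2 ≈ η 10 ^^ 3 ⊗ η 1
ν-Θ-Θ = begin
  ν (Θ 7 3 ⊗ Θ 9 1) ⊗ η 5 ⊗ η 2
    ≈⟨ ⊗-cong (⊗-cong (≈-trans (ν-⊗ (Θ 7 3) (Θ 9 1)) (⊗-cong
        (≈-trans (ν-cong (triple-product 7 3)) (≈-trans (ν-⊗ (η 10) _) (⊗-cong (ν-η 5) (≈-trans (ν-⊗ _ _) (⊗-cong (ν-Q 1ℤ 3 5) (ν-Q 1ℤ 1 5))))))
        (≈-trans (ν-cong (triple-product 9 1)) (≈-trans (ν-⊗ (η 10) _) (⊗-cong (ν-η 5) (≈-trans (ν-⊗ _ _) (⊗-cong (ν-Q 1ℤ 4 5) (ν-Q 1ℤ 0 5))))))))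
      (η-odd-part 5)) ≈-refl ⟩
  (η 10 ⊗ (o₇ ⊗ o₃)) ⊗ (η 10 ⊗ (o₉ ⊗ o₁)) ⊗ (o₅ ⊗ η 10) ⊗ η 2
    ≈⟨ solve 7 (λ t d a b c e f → (d :* (e :* b)) :* (d :* (f :* a)) :* (c :* d) :* t := (d :^ 3) :* ((a :* b :* c :* e :* f) :* t))
        ≈-refl (η 2) (η 10) o₁ o₃ o₅ o₇ o₉ ⟩
  η 10 ^^ 3 ⊗ ((o₁ ⊗ o₃ ⊗ o₅ ⊗ o₇ ⊗ o₉) ⊗ η 2)
    ≈⟨ ⊗-cong ≈-refl (⊗-cong (≈-sym (≈-trans Q-split-5 (⊗-cong (⊗-cong (⊗-cong (⊗-cong (⊗-identityˡ o₁) ≈-refl) ≈-refl) ≈-refl) ≈-refl))) ≈-refl) ⟩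
  η 10 ^^ 3 ⊗ (odd-part 1 ⊗ η 2)
    ≈⟨ ⊗-cong ≈-refl (≈-sym (η-odd-part 1)) ⟩
  η 10 ^^ 3 ⊗ η 1 ∎
  where
  open ≈R
  o₁ o₃ o₅ o₇ o₉ : Series
  o₁ = Q ℤ.-1ℤ 1 10
  o₃ = Q ℤ.-1ℤ 3 10
  o₅ = Q ℤ.-1ℤ 5 10
  o₇ = Q ℤ.-1ℤ 7 10
  o₉ = Q ℤ.-1ℤ 9 10

-- This is ψ(q) = f_2²/f_1. The exponents 1 and 3 modulo 4 combine to (-q; q²)_∞.
Θ-3-1 : Θ 3 1 ⊗ η 1 ≈ η 2 ^^ 2
Θ-3-1 = begin
  Θ 3 1 ⊗ η 1
    ≈⟨ ⊗-cong (triple-product 3 1) (η-odd-part 1) ⟩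
  η 4 ⊗ (Q 1ℤ 3 4 ⊗ Q 1ℤ 1 4) ⊗ (odd-part 1 ⊗ η 2)
    ≈⟨ solve 5 (λ a b c d e → a :* (b :* c) :* (d :* e) := (c :* b) :* d :* a :* e) ≈-refl (η 4) (Q 1ℤ 3 4) (Q 1ℤ 1 4) (odd-part 1) (η 2) ⟩
  (Q 1ℤ 1 4 ⊗ Q 1ℤ 3 4) ⊗ odd-part 1 ⊗ η 4 ⊗ η 2
    ≈⟨ ⊗-cong (⊗-cong (⊗-cong (≈-sym (≈-trans (Q-split 1 1ℤ 1 2) (⊗-cong (⊗-identityˡ (Q 1ℤ 1 4)) ≈-refl))) ≈-refl) ≈-refl) ≈-refl ⟩
  Q 1ℤ 1 2 ⊗ odd-part 1 ⊗ η 4 ⊗ η 2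
    ≈⟨ ⊗-cong (≈-trans (⊗-cong (Q-± 1 2) ≈-refl) (≈-sym (η-odd-part 2))) ≈-refl ⟩
  η 2 ⊗ η 2
    ≈⟨ solve 1 (λ a → a :* a := a :^ 2) ≈-refl (η 2) ⟩
  η 2 ^^ 2 ∎
  where open ≈R

Θ-15-5 : Θ 15 5 ⊗ η 5 ≈ η 10 ^^ 2
Θ-15-5 = begin
  Θ 15 5 ⊗ η 5
    ≈⟨ ⊗-cong (triple-product 15 5) (η-odd-part 5) ⟩
  η 20 ⊗ (Q 1ℤ 15 20 ⊗ Q 1ℤ 5 20) ⊗ (odd-part 5 ⊗ η 10)
    ≈⟨ solve 5 (λ a b c d e → a :* (b :* c) :* (d :* e) := (c :* b) :* d :* a :* e) ≈-refl (η 20) (Q 1ℤ 15 20) (Q 1ℤ 5 20) (odd-part 5) (η 10) ⟩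
  (Q 1ℤ 5 20 ⊗ Q 1ℤ 15 20) ⊗ odd-part 5 ⊗ η 20 ⊗ η 10
    ≈⟨ ⊗-cong (⊗-cong (⊗-cong (≈-sym (≈-trans (Q-split 1 1ℤ 5 10) (⊗-cong (⊗-identityˡ (Q 1ℤ 5 20)) ≈-refl))) ≈-refl) ≈-refl) ≈-refl ⟩
  Q 1ℤ 5 10 ⊗ odd-part 5 ⊗ η 20 ⊗ η 10
    ≈⟨ ⊗-cong (≈-trans (⊗-cong (Q-± 5 10) ≈-refl) (≈-sym (η-odd-part 10))) ≈-refl ⟩
  η 10 ⊗ η 10
    ≈⟨ solve 1 (λ a → a :* a := a :^ 2) ≈-refl (η 10) ⟩
  η 10 ^^ 2 ∎
  where open ≈R

Q⁺-η : ∀ m .{{_ : ℕ.NonZero m}} → Q 1ℤ m m ⊗ η m ≈ η (m ℕ.+ m)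
Q⁺-η m = ≈-trans (⊗-cong ≈-refl (η-def m)) (≈-trans (Q-± m m) (≈-sym (η-def (m ℕ.+ m))))

Q-split-5′ : Q 1ℤ 1 1 ≈ oneS ⊗ Q 1ℤ 1 5 ⊗ Q 1ℤ 2 5 ⊗ Q 1ℤ 3 5 ⊗ Q 1ℤ 4 5 ⊗ Q 1ℤ 5 5
Q-split-5′ = Q-split 4 1ℤ 1 1

-- The classes 1 to 4 modulo 5 come from the theta series and the class 0 from f_10 = (-q⁵; q⁵)_∞
-- f_5; together they form (-q; q)_∞ = f_2/f_1.
Θ-4-1-3-2 : (Θ 4 1 ⊗ Θ 3 2) ⊗ η 10 ⊗ η 1 ≈ η 5 ^^ 3 ⊗ η 2
Θ-4-1-3-2 = begin
  (Θ 4 1 ⊗ Θ 3 2) ⊗ η 10 ⊗ η 1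
    ≈⟨ ⊗-cong (⊗-cong (⊗-cong (triple-product 4 1) (triple-product 3 2)) (≈-sym (Q⁺-η 5))) ≈-refl ⟩
  (η 5 ⊗ (p₄ ⊗ p₁)) ⊗ (η 5 ⊗ (p₃ ⊗ p₂)) ⊗ (p₅ ⊗ η 5) ⊗ η 1
    ≈⟨ solve 7 (λ t d a b c e f → (d :* (e :* a)) :* (d :* (c :* b)) :* (f :* d) :* t := (d :^ 3) :* ((a :* b :* c :* e :* f) :* t))
        ≈-refl (η 1) (η 5) p₁ p₂ p₃ p₄ p₅ ⟩
  η 5 ^^ 3 ⊗ ((p₁ ⊗ p₂ ⊗ p₃ ⊗ p₄ ⊗ p₅) ⊗ η 1)
    ≈⟨ ⊗-cong ≈-refl (⊗-cong (≈-sym (≈-trans Q-split-5′ (⊗-cong (⊗-cong (⊗-cong (⊗-cong (⊗-identityˡ p₁) ≈-refl) ≈-refl) ≈-refl) ≈-refl))) ≈-refl) ⟩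
  η 5 ^^ 3 ⊗ (Q 1ℤ 1 1 ⊗ η 1)
    ≈⟨ ⊗-cong ≈-refl (Q⁺-η 1) ⟩
  η 5 ^^ 3 ⊗ η 2 ∎
  where
  open ≈R
  p₁ p₂ p₃ p₄ p₅ : Series
  p₁ = Q 1ℤ 1 5
  p₂ = Q 1ℤ 2 5
  p₃ = Q 1ℤ 3 5
  p₄ = Q 1ℤ 4 5
  p₅ = Q 1ℤ 5 5

-- The relations of level 10

-- A certificate that a - b is the sum of all c(x - y): the list gives the cofactors c and the known
-- equations x = y. The result is the equation left to the solver after nested uses of `combine`,
-- the head of the list belonging to the outermost one.
:combination : ∀ {n} (a b : S.Polynomial n) → List (S.Polynomial n × S.Polynomial n × S.Polynomial n) →
  S.Polynomial n × S.Polynomial n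
:combination a b []                  = a := b
:combination a b ((c , x , y) ∷ cxy) = :combination (a :+ c :* y) (b :+ c :* x) cxy

1+_·_ : ℕ → Series → Series
1+ n · a = const 1ℤ ⊞ const (+ n) ⊗ a

:1+ : ∀ {n} → ℕ → S.Polynomial n → S.Polynomial n
:1+ n a = con 1ℤ :+ con (+ n) :* a

^-zero-one : ∀ {a} k → a 0 ≡ 1ℤ → (a ^^ k) 0 ≡ 1ℤ
^-zero-one zero    p = refl
^-zero-one {a} (suc k) p = ⊗-zero-one {a} {a ^^ k} p (^-zero-one k p)

u₀ : Series
u₀ = η 1 ^^ 3 ⊗ η 5

u₀-zero : u₀ 0 ≡ 1ℤ
u₀-zero = ⊗-zero-one {η 1 ^^ 3} {η 5} (^-zero-one 3 (η-zero 1)) (η-zero 5)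

opaque
  -- `t` has no constant term; its quotient by q, `u`, starts with 1 and so can be cancelled.
  u t : Series
  u = η 2 ⊗ η 10 ^^ 3 ⊗ inverse u₀
  t = q ⊗ u

  u-def : u ⊗ u₀ ≈ η 2 ⊗ η 10 ^^ 3
  u-def = ≈-trans (⊗-assoc (η 2 ⊗ η 10 ^^ 3) (inverse u₀) u₀)
    (≈-trans (⊗-cong ≈-refl (inverse-⊗ u₀ u₀-zero)) (⊗-identityʳ (η 2 ⊗ η 10 ^^ 3)))

  t-def : t ≈ q ⊗ u
  t-def = ≈-refl

t-η : t ⊗ (η 1 ^^ 3 ⊗ η 5) ≈ q ⊗ (η 2 ⊗ η 10 ^^ 3)
t-η = ≈-trans (⊗-cong t-def ≈-refl) (≈-trans (⊗-assoc q u u₀) (⊗-cong ≈-refl u-def))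

u-zero : u 0 ≡ 1ℤ
u-zero = begin
  u 0             ≡⟨ sym (ℤₚ.*-identityʳ (u 0)) ⟩
  u 0 ℤ.* 1ℤ      ≡⟨ cong (u 0 ℤ.*_) (sym u₀-zero) ⟩
  u 0 ℤ.* u₀ 0    ≡⟨ sym (⊗-zero u u₀) ⟩
  (u ⊗ u₀) 0      ≡⟨ at u-def 0 ⟩
  (η 2 ⊗ η 10 ^^ 3) 0  ≡⟨ ⊗-zero-one {η 2} {η 10 ^^ 3} (η-zero 2) (^-zero-one 3 (η-zero 10)) ⟩
  1ℤ ∎
  where open ≡-Reasoning

ν-φ-quintic : ν (Θ 1 1) ⊗ ν (Θ 1 1) ≈ ν (Θ 5 5) ⊗ ν (Θ 5 5) ⊞ const (+ 4) ⊗ ((⊟ q) ⊗ ν (Θ 7 3 ⊗ Θ 9 1))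
ν-φ-quintic = ≈-trans (≈-sym (ν-⊗ (Θ 1 1) (Θ 1 1))) (≈-trans (ν-cong φ-quintic)
  (≈-trans (ν-⊞ _ _) (⊞-cong (ν-⊗ (Θ 5 5) (Θ 5 5))
    (≈-trans (ν-⊗ (const (+ 4)) _) (⊗-cong (ν-const (+ 4)) (≈-trans (ν-⊗ q _) (⊗-cong ν-q ≈-refl)))))))

-- The dissection of φ(-q)² reads f_1⁴/f_2² = f_5⁴/f_10² - 4q f_1 f_10³/(f_2 f_5). Multiplied by
-- f_2² f_10², its last term becomes -4t f_1⁴ f_10²; a further f_5 clears the remaining denominator.
η-relation₁ : η 5 ^^ 4 ⊗ η 2 ^^ 2 ≈ η 1 ^^ 4 ⊗ η 10 ^^ 2 ⊗ (1+ 4 · t)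
η-relation₁ = ⊗-cancelʳ (η 5) (η-zero 5)
  (combine t-η (combine ν-Θ-Θ (combine ν-Θ-1 (combine ν-Θ-5 (combine ν-φ-quintic
    (solve 9 (λ h₁ h₂ h₅ h₁₀ t q X Y Z →
      :combination (h₅ :^ 4 :* h₂ :^ 2 :* h₅) (h₁ :^ 4 :* h₁₀ :^ 2 :* :1+ 4 t :* h₅)
        ( (con (ℤ.- + 4) :* h₁ :* h₁₀ :^ 2 , t :* (h₁ :^ 3 :* h₅) , q :* (h₂ :* h₁₀ :^ 3))
        ∷ (con (+ 4) :* q :* h₂ :* h₁₀ :^ 2 , Z :* h₅ :* h₂ , h₁₀ :^ 3 :* h₁)
        -- The equation X h₂ = h₁² is used squared, so its cofactor contains the sum of the two
        -- sides.
        ∷ (h₁₀ :^ 2 :* h₅ :* (X :* h₂ :+ h₁ :^ 2) , X :* h₂ , h₁ :^ 2)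
        ∷ (:- (h₅ :* h₂ :^ 2 :* (Y :* h₁₀ :+ h₅ :^ 2)) , Y :* h₁₀ , h₅ :^ 2)
        ∷ (:- (h₅ :* h₂ :^ 2 :* h₁₀ :^ 2) , X :* X , Y :* Y :+ con (+ 4) :* ((:- q) :* Z))
        ∷ []))
      ≈-refl (η 1) (η 2) (η 5) (η 10) t q (ν (Θ 1 1)) (ν (Θ 5 5)) (ν (Θ 7 3 ⊗ Θ 9 1))))))))

-- The dissection of ψ(q)² gives f_2⁵ f_5² f_10 = f_1 f_2² f_5⁵ + q f_1² f_2 f_10⁵. By the first
-- relation the right side is f_1⁵ f_5 f_10² times (1 + 4t) + t, so 5 = 4 + 1.
η-relation₂ : η 2 ^^ 5 ⊗ η 5 ≈ η 1 ^^ 5 ⊗ η 10 ⊗ (1+ 5 · t)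
η-relation₂ = ⊗-cancelʳ (η 5 ⊗ η 10) (⊗-zero-one {η 5} {η 10} (η-zero 5) (η-zero 10))
  (combine η-relation₁ (combine t-η (combine Θ-3-1 (combine ψ-quintic (combine Θ-4-1-3-2 (combine Θ-15-5
    (solve 9 (λ h₁ h₂ h₅ h₁₀ t q S U W₁ →
      let W = W₁ in
      :combination (h₂ :^ 5 :* h₅ :* (h₅ :* h₁₀)) (h₁ :^ 5 :* h₁₀ :* :1+ 5 t :* (h₅ :* h₁₀))
        ( (h₁ :* h₅ , h₅ :^ 4 :* h₂ :^ 2 , h₁ :^ 4 :* h₁₀ :^ 2 :* :1+ 4 t)
        ∷ (:- (h₁ :^ 2 :* h₁₀ :^ 2) , t :* (h₁ :^ 3 :* h₅) , q :* (h₂ :* h₁₀ :^ 3))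
        ∷ (:- (h₂ :* h₅ :^ 2 :* h₁₀ :* (S :* h₁ :+ h₂ :^ 2)) , S :* h₁ , h₂ :^ 2)
        ∷ (h₂ :* h₅ :^ 2 :* h₁₀ :* h₁ :^ 2 , S :* S , W :+ q :* (U :* U))
        ∷ (h₂ :* h₅ :^ 2 :* h₁ , W :* h₁₀ :* h₁ , h₅ :^ 3 :* h₂)
        ∷ (q :* h₁ :^ 2 :* h₂ :* h₁₀ :* (U :* h₅ :+ h₁₀ :^ 2) , U :* h₅ , h₁₀ :^ 2)
        ∷ []))
      ≈-refl (η 1) (η 2) (η 5) (η 10) t q (Θ 3 1) (Θ 15 5) (Θ 4 1 ⊗ Θ 3 2)))))))) 

V-^ : ∀ a k → V (a ^^ k) ≈ V a ^^ k
V-^ a zero    = V-one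
V-^ a (suc k) = ≈-trans (V-⊗ a (a ^^ k)) (⊗-cong ≈-refl (V-^ a k))

ν-^ : ∀ a k → ν (a ^^ k) ≈ ν a ^^ k
ν-^ a zero    = ν-one
ν-^ a (suc k) = ≈-trans (ν-⊗ a (a ^^ k)) (⊗-cong ≈-refl (ν-^ a k))

^-cong : ∀ {a b} k → a ≈ b → a ^^ k ≈ b ^^ k
^-cong zero    p = ≈-refl
^-cong (suc k) p = ⊗-cong p (^-cong k p)

V-η-^ : ∀ m k .{{_ : ℕ.NonZero m}} → V (η m ^^ k) ≈ η (dbl m) ^^ k
V-η-^ m k = ≈-trans (V-^ (η m) k) (^-cong k (V-η m))

ν-η-^ : ∀ m k .{{_ : ℕ.NonZero m}} → ν (η (dbl m) ^^ k) ≈ η (dbl m) ^^ k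
ν-η-^ m k = ≈-trans (ν-^ (η (dbl m)) k) (^-cong k (ν-η m))

V-1+ : ∀ n a → V (1+ n · a) ≈ 1+ n · V a
V-1+ n a = ≈-trans (V-⊞ (const 1ℤ) (const (+ n) ⊗ a)) (⊞-cong (V-const 1ℤ)
  (≈-trans (V-⊗ (const (+ n)) a) (⊗-cong (V-const (+ n)) ≈-refl)))

ν-1+ : ∀ n a → ν (1+ n · a) ≈ 1+ n · ν a
ν-1+ n a = ≈-trans (ν-⊞ (const 1ℤ) (const (+ n) ⊗ a)) (⊞-cong (ν-const 1ℤ)
  (≈-trans (ν-⊗ (const (+ n)) a) (⊗-cong (ν-const (+ n)) ≈-refl)))

V-q : V q ≈ q ⊗ q
V-q = ≈-trans (V-mono 1) (≈-sym (mono-⊗ 1 1))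

s r : Series
s = ν t
r = V t

r-η : r ⊗ (η 2 ^^ 3 ⊗ η 10) ≈ q ⊗ q ⊗ (η 4 ⊗ η 20 ^^ 3)
r-η = ≈-trans (⊗-cong ≈-refl (≈-sym (≈-trans (V-⊗ (η 1 ^^ 3) (η 5)) (⊗-cong (V-η-^ 1 3) (V-η 5)))))
  (≈-trans (≈-sym (V-⊗ t _)) (≈-trans (V-cong t-η) (≈-trans (V-⊗ q _) (⊗-cong V-q
    (≈-trans (V-⊗ (η 2) (η 10 ^^ 3)) (⊗-cong (V-η 2) (V-η-^ 10 3)))))))

s-η : s ⊗ (ν (η 1) ^^ 3 ⊗ ν (η 5)) ≈ ⊟ q ⊗ (η 2 ⊗ η 10 ^^ 3)
s-η = ≈-trans (⊗-cong ≈-refl (≈-sym (≈-trans (ν-⊗ (η 1 ^^ 3) (η 5)) (⊗-cong (ν-^ (η 1) 3) ≈-refl))))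
  (≈-trans (≈-sym (ν-⊗ t _)) (≈-trans (ν-cong t-η) (≈-trans (ν-⊗ q _) (⊗-cong ν-q
    (≈-trans (ν-⊗ (η 2) (η 10 ^^ 3)) (⊗-cong (ν-η 1) (ν-η-^ 5 3)))))))

V-η-relation₁ : η 10 ^^ 4 ⊗ η 4 ^^ 2 ≈ η 2 ^^ 4 ⊗ η 20 ^^ 2 ⊗ (1+ 4 · r)
V-η-relation₁ = ≈-trans (≈-sym (≈-trans (V-⊗ (η 5 ^^ 4) (η 2 ^^ 2)) (⊗-cong (V-η-^ 5 4) (V-η-^ 2 2))))
  (≈-trans (V-cong η-relation₁) (≈-trans (V-⊗ _ _) (⊗-cong
    (≈-trans (V-⊗ (η 1 ^^ 4) (η 10 ^^ 2)) (⊗-cong (V-η-^ 1 4) (V-η-^ 10 2))) (V-1+ 4 t))))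

ν-η-relation₁ : ν (η 5) ^^ 4 ⊗ η 2 ^^ 2 ≈ ν (η 1) ^^ 4 ⊗ η 10 ^^ 2 ⊗ (1+ 4 · s)
ν-η-relation₁ = ≈-trans (≈-sym (≈-trans (ν-⊗ (η 5 ^^ 4) (η 2 ^^ 2)) (⊗-cong (ν-^ (η 5) 4) (ν-η-^ 1 2))))
  (≈-trans (ν-cong η-relation₁) (≈-trans (ν-⊗ _ _) (⊗-cong
    (≈-trans (ν-⊗ (η 1 ^^ 4) (η 10 ^^ 2)) (⊗-cong (ν-^ (η 1) 4) (ν-η-^ 5 2))) (ν-1+ 4 t))))

-- Both sides are -q² f_4³ f_10³ f_20 / f_2⁷.
t*s : t ⊗ s ≈ ⊟ (r ⊗ (1+ 4 · r))
t*s = ⊗-cancelʳ (η 2 ^^ 9 ⊗ η 10 ^^ 3) (⊗-zero-one {η 2 ^^ 9} {η 10 ^^ 3} (^-zero-one 9 (η-zero 2)) (^-zero-one 3 (η-zero 10)))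
  (combine r-η (combine V-η-relation₁ (combine ν-η-1 (combine ν-η-5 (combine t-η (combine s-η
    (solve 12 (λ h₁ h₂ h₄ h₅ h₁₀ h₂₀ n₁ n₅ t s r q →
      let a = n₁ :* h₁ :* h₄ ; b = h₂ :^ 3 in
      :combination (t :* s :* (h₂ :^ 9 :* h₁₀ :^ 3)) ((:- (r :* :1+ 4 r)) :* (h₂ :^ 9 :* h₁₀ :^ 3))
        ( (:1+ 4 r :* h₂ :^ 6 :* h₁₀ :^ 2 , r :* (h₂ :^ 3 :* h₁₀) , q :* q :* (h₄ :* h₂₀ :^ 3))
        ∷ (:- (q :^ 2 :* h₄ :* h₂₀ :* h₂ :^ 2 :* h₁₀ :^ 2) , h₁₀ :^ 4 :* h₄ :^ 2 , h₂ :^ 4 :* h₂₀ :^ 2 :* :1+ 4 r)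
        ∷ (:- (t :* s :* h₁₀ :^ 3 :* (a :^ 2 :+ a :* b :+ b :^ 2)) , a , b)
        ∷ (:- (t :* s :* a :^ 3) , n₅ :* h₅ :* h₂₀ , h₁₀ :^ 3)
        ∷ (h₄ :^ 3 :* h₂₀ :* s :* n₁ :^ 3 :* n₅ , t :* (h₁ :^ 3 :* h₅) , q :* (h₂ :* h₁₀ :^ 3))
        ∷ (h₄ :^ 3 :* h₂₀ :* q :* h₂ :* h₁₀ :^ 3 , s :* (n₁ :^ 3 :* n₅) , (:- q) :* (h₂ :* h₁₀ :^ 3))
        ∷ []))
      ≈-refl (η 1) (η 2) (η 4) (η 5) (η 10) (η 20) (ν (η 1)) (ν (η 5)) t s r q)))))))

-- Even and odd parts

-- Both sides are f_4⁴ f_10⁸ / (f_2⁸ f_20⁴). Since the products `a` = `b` and `c` = `d` enter as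
-- fourth powers, their cofactors are the cubic sums that divide a⁴ - b⁴ and c⁴ - d⁴.
1+4t*1+4s : (1+ 4 · t) ⊗ (1+ 4 · s) ≈ (1+ 4 · r) ⊗ (1+ 4 · r)
1+4t*1+4s = ⊗-cancelʳ (η 2 ^^ 12 ⊗ (η 20 ^^ 4 ⊗ η 10 ^^ 4))
  (⊗-zero-one {η 2 ^^ 12} (^-zero-one 12 (η-zero 2)) (⊗-zero-one {η 20 ^^ 4} (^-zero-one 4 (η-zero 20)) (^-zero-one 4 (η-zero 10))))
  (combine V-η-relation₁ (combine ν-η-1 (combine ν-η-5 (combine η-relation₁ (combine ν-η-relation₁
    (solve 11 (λ h₁ h₂ h₄ h₅ h₁₀ h₂₀ n₁ n₅ h h′ k →
      let a = n₁ :* h₁ :* h₄ ; b = h₂ :^ 3 ; c = n₅ :* h₅ :* h₂₀ ; d = h₁₀ :^ 3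
          x = h₁₀ :^ 4 :* h₄ :^ 2 ; y = h₂ :^ 4 :* h₂₀ :^ 2 :* k in
      :combination (h :* h′ :* (h₂ :^ 12 :* (h₂₀ :^ 4 :* h₁₀ :^ 4))) (k :* k :* (h₂ :^ 12 :* (h₂₀ :^ 4 :* h₁₀ :^ 4)))
        ( (h₂ :^ 4 :* h₁₀ :^ 4 :* (x :+ y) , x , y)
        ∷ (:- (h :* h′ :* h₂₀ :^ 4 :* h₁₀ :^ 4 :* (a :^ 3 :+ a :^ 2 :* b :+ a :* b :^ 2 :+ b :^ 3)) , a , b)
        ∷ (h₂ :^ 4 :* h₄ :^ 4 :* (c :^ 3 :+ c :^ 2 :* d :+ c :* d :^ 2 :+ d :^ 3) , c , d)
        ∷ (:- (h₄ :^ 4 :* h₂₀ :^ 4 :* (n₅ :^ 4 :* h₂ :^ 2)) , h₅ :^ 4 :* h₂ :^ 2 , h₁ :^ 4 :* h₁₀ :^ 2 :* h)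
        ∷ (:- (h₄ :^ 4 :* h₂₀ :^ 4 :* (h₁ :^ 4 :* h₁₀ :^ 2 :* h)) , n₅ :^ 4 :* h₂ :^ 2 , n₁ :^ 4 :* h₁₀ :^ 2 :* h′)
        ∷ []))
      ≈-refl (η 1) (η 2) (η 4) (η 5) (η 10) (η 20) (ν (η 1)) (ν (η 5)) (1+ 4 · t) (1+ 4 · s) (1+ 4 · r)))))))

t+s : t ⊞ s ≈ const (+ 6) ⊗ r ⊞ const (+ 20) ⊗ r ⊗ r
t+s = const-cancel (+ 4) (combine 1+4t*1+4s (combine t*s
  (solve 3 (λ t s r → :combination (con (+ 4) :* (t :+ s)) (con (+ 4) :* (con (+ 6) :* r :+ con (+ 20) :* r :* r))
    ( (con 1ℤ , :1+ 4 t :* :1+ 4 s , :1+ 4 r :* :1+ 4 r)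
    ∷ (con (ℤ.- + 16) , t :* s , :- (r :* :1+ 4 r))
    ∷ []))
  ≈-refl t s r)))

-- The quadratic terms 5·20r² and -25·4r² cancel, and 30r - 25r remains.
1+5t*1+5s : (1+ 5 · t) ⊗ (1+ 5 · s) ≈ 1+ 5 · r
1+5t*1+5s = combine t+s (combine t*s
  (solve 3 (λ t s r → :combination (:1+ 5 t :* :1+ 5 s) (:1+ 5 r)
    ( (con (+ 5) , t :+ s , con (+ 6) :* r :+ con (+ 20) :* r :* r)
    ∷ (con (+ 25) , t :* s , :- (r :* :1+ 4 r))
    ∷ []))
  ≈-refl t s r))

V-⊟ : ∀ a → V (⊟ a) ≈ ⊟ V a
V-⊟ a = begin
  V (⊟ a)               ≈⟨ V-cong (solve 1 (λ a → :- a := con ℤ.-1ℤ :* a) ≈-refl a) ⟩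
  V (const ℤ.-1ℤ ⊗ a)   ≈⟨ ≈-trans (V-⊗ (const ℤ.-1ℤ) a) (⊗-cong (V-const ℤ.-1ℤ) ≈-refl) ⟩
  const ℤ.-1ℤ ⊗ V a     ≈⟨ solve 1 (λ a → con ℤ.-1ℤ :* a := :- a) ≈-refl (V a) ⟩
  ⊟ V a ∎
  where open ≈R

F G K : Series
F = η 1 ^^ 4 ⊗ η 5 ^^ 4
G = η 1 ⊗ η 2 ⊗ η 5 ^^ 3 ⊗ η 10 ^^ 3
K = η 2 ^^ 4 ⊗ η 10 ^^ 4

V-F : V F ≈ K
V-F = ≈-trans (V-⊗ (η 1 ^^ 4) (η 5 ^^ 4)) (⊗-cong (V-η-^ 1 4) (V-η-^ 5 4))

F*t : F ⊗ t ≈ q ⊗ G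
F*t = combine t-η
  (solve 6 (λ h₁ h₂ h₅ h₁₀ t q → :combination (h₁ :^ 4 :* h₅ :^ 4 :* t) (q :* (h₁ :* h₂ :* h₅ :^ 3 :* h₁₀ :^ 3))
    ((h₁ :* h₅ :^ 3 , t :* (h₁ :^ 3 :* h₅) , q :* (h₂ :* h₁₀ :^ 3)) ∷ []))
  ≈-refl (η 1) (η 2) (η 5) (η 10) t q)

G*1+5t : G ⊗ (1+ 5 · t) ≈ K ⊗ (1+ 4 · t)
G*1+5t = ⊗-cancelʳ (η 1 ^^ 4) (^-zero-one 4 (η-zero 1)) (combine η-relation₂ (combine η-relation₁
  (solve 6 (λ h₁ h₂ h₅ h₁₀ g h →
    :combination (h₁ :* h₂ :* h₅ :^ 3 :* h₁₀ :^ 3 :* g :* h₁ :^ 4) (h₂ :^ 4 :* h₁₀ :^ 4 :* h :* h₁ :^ 4)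
      ( (:- (h₂ :* h₅ :^ 3 :* h₁₀ :^ 2) , h₂ :^ 5 :* h₅ , h₁ :^ 5 :* h₁₀ :* g)
      ∷ (h₂ :^ 4 :* h₁₀ :^ 2 , h₅ :^ 4 :* h₂ :^ 2 , h₁ :^ 4 :* h₁₀ :^ 2 :* h)
      ∷ []))
  ≈-refl (η 1) (η 2) (η 5) (η 10) (1+ 5 · t) (1+ 4 · t))))

F*t*1+5t : F ⊗ t ⊗ (1+ 5 · t) ≈ q ⊗ K ⊗ (1+ 4 · t)
F*t*1+5t = begin
  F ⊗ t ⊗ (1+ 5 · t)     ≈⟨ ⊗-cong F*t ≈-refl ⟩
  q ⊗ G ⊗ (1+ 5 · t)     ≈⟨ ⊗-assoc q G (1+ 5 · t) ⟩
  q ⊗ (G ⊗ (1+ 5 · t))   ≈⟨ ⊗-cong ≈-refl G*1+5t ⟩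
  q ⊗ (K ⊗ (1+ 4 · t))   ≈⟨ ⊗-assoc q K (1+ 4 · t) ⟨
  q ⊗ K ⊗ (1+ 4 · t) ∎
  where open ≈R

-- The product `M` t is q f_2⁶ f_5⁴ f_10² / f_1⁴, and the first relation replaces f_2² f_5⁴ / f_1⁴
-- by f_10² (1 + 4t).
M*t : ∀ M → M ⊗ η 1 ⊗ η 10 ≈ η 2 ^^ 5 ⊗ η 5 ^^ 5 → M ⊗ t ≈ q ⊗ K ⊗ (1+ 4 · t)
M*t M M-η = ⊗-cancelʳ (η 1 ^^ 4 ⊗ (η 5 ⊗ η 10))
  (⊗-zero-one {η 1 ^^ 4} (^-zero-one 4 (η-zero 1)) (⊗-zero-one {η 5} (η-zero 5) (η-zero 10)))
  (combine M-η (combine t-η (combine η-relation₁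
  (solve 8 (λ M h₁ h₂ h₅ h₁₀ t q h →
    :combination (M :* t :* (h₁ :^ 4 :* (h₅ :* h₁₀))) (q :* (h₂ :^ 4 :* h₁₀ :^ 4) :* h :* (h₁ :^ 4 :* (h₅ :* h₁₀)))
      ( (t :* h₁ :^ 3 :* h₅ , M :* h₁ :* h₁₀ , h₂ :^ 5 :* h₅ :^ 5)
      ∷ (h₂ :^ 5 :* h₅ :^ 5 , t :* (h₁ :^ 3 :* h₅) , q :* (h₂ :* h₁₀ :^ 3))
      ∷ (q :* h₂ :^ 4 :* h₁₀ :^ 3 :* h₅ , h₅ :^ 4 :* h₂ :^ 2 , h₁ :^ 4 :* h₁₀ :^ 2 :* h)
      ∷ []))
  ≈-refl M (η 1) (η 2) (η 5) (η 10) t q (1+ 4 · t)))))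

T*1+5t : ∀ T → T ⊗ η 2 ⊗ η 5 ≈ η 1 ^^ 5 ⊗ η 10 ^^ 5 → T ⊗ (1+ 5 · t) ≈ K
T*1+5t T T-η = ⊗-cancelʳ (η 2 ⊗ η 5) (⊗-zero-one {η 2} (η-zero 2) (η-zero 5))
  (combine T-η (combine η-relation₂
  (solve 6 (λ T h₁ h₂ h₅ h₁₀ g →
    :combination (T :* g :* (h₂ :* h₅)) (h₂ :^ 4 :* h₁₀ :^ 4 :* (h₂ :* h₅))
      ( (g , T :* h₂ :* h₅ , h₁ :^ 5 :* h₁₀ :^ 5)
      ∷ (:- (h₁₀ :^ 4) , h₂ :^ 5 :* h₅ , h₁ :^ 5 :* h₁₀ :* g)
      ∷ []))
  ≈-refl T (η 1) (η 2) (η 5) (η 10) (1+ 5 · t))))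

q-cancel : ∀ {a b} → q ⊗ a ≈ q ⊗ b → a ≈ b
q-cancel {a} {b} p = tail-cong (≈-trans (qTimes≈ a) (≈-trans p (≈-sym (qTimes≈ b))))

-- `r` is q² times `V u`, which has constant term 1.
r-cancel : ∀ {a b} → r ⊗ a ≈ r ⊗ b → a ≈ b
r-cancel {a} {b} p = ⊗-cancelʳ (V u) V-u-zero (q-cancel (q-cancel (≈-trans (≈-sym (factorise a)) (≈-trans p (factorise b)))))
  where
  V-u-zero : V u 0 ≡ 1ℤ
  V-u-zero = trans (sym (even-at (V u) 0)) (trans (at (even-V u) 0) u-zero)
  factorise : ∀ a → r ⊗ a ≈ q ⊗ (q ⊗ (a ⊗ V u))
  factorise a = ≈-trans (⊗-cong (≈-trans (V-cong t-def) (≈-trans (V-⊗ q u) (⊗-cong V-q ≈-refl))) ≈-refl)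
    (solve 3 (λ q v a → q :* q :* v :* a := q :* (q :* (a :* v))) ≈-refl q (V u) a)

1+-zero : ∀ n {a} → a 0 ≡ 0ℤ → (1+ n · a) 0 ≡ 1ℤ
1+-zero n {a} a₀ = trans (⊞-at (const 1ℤ) (const (+ n) ⊗ a) 0) (cong₂ ℤ._+_ (const-at 1ℤ 0)
  (trans (const-⊗-at (+ n) a 0) (trans (cong (+ n ℤ.*_) a₀) (ℤₚ.*-zeroʳ (+ n)))))

t-zero : t 0 ≡ 0ℤ
t-zero = trans (at t-def 0) (⊗-zero q u)

r-zero : r 0 ≡ 0ℤ
r-zero = trans (sym (even-at r 0)) (trans (at (even-V t) 0) t-zero)

V-F*t : K ⊗ r ≈ q ⊗ q ⊗ V G
V-F*t = ≈-trans (⊗-cong (≈-sym V-F) ≈-refl) (≈-trans (≈-sym (V-⊗ F t)) (≈-trans (V-cong F*t)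
  (≈-trans (V-⊗ q G) (⊗-cong V-q ≈-refl))))

V-F*t*1+5t : K ⊗ r ⊗ (1+ 5 · r) ≈ q ⊗ q ⊗ V K ⊗ (1+ 4 · r)
V-F*t*1+5t = ≈-trans (⊗-cong (≈-trans (⊗-cong (≈-sym V-F) ≈-refl) (≈-sym (V-⊗ F t))) (≈-sym (V-1+ 5 t)))
  (≈-trans (≈-sym (V-⊗ (F ⊗ t) (1+ 5 · t))) (≈-trans (V-cong F*t*1+5t) (≈-trans (V-⊗ (q ⊗ K) (1+ 4 · t))
    (⊗-cong (≈-trans (V-⊗ q K) (⊗-cong V-q ≈-refl)) (V-1+ 4 t)))))

ν-K : ν K ≈ K
ν-K = ≈-trans (ν-⊗ (η 2 ^^ 4) (η 10 ^^ 4)) (⊗-cong (ν-η-^ 1 4) (ν-η-^ 5 4))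

ν-q*K : ν (q ⊗ K ⊗ (1+ 4 · t)) ≈ ⊟ q ⊗ K ⊗ (1+ 4 · s)
ν-q*K = ≈-trans (ν-⊗ (q ⊗ K) (1+ 4 · t)) (⊗-cong (≈-trans (ν-⊗ q K) (⊗-cong ν-q ν-K)) (ν-1+ 4 t))

-- `K` is even, so T(-q)(1 + 5s) = K as well. Adding gives 2V(even T)(1 + 5r) = K(2 + 5(t + s)) =
-- 2K(1 + 5r)(1 + 10r). Finally K r is `V` of q G.
even-T : ∀ T → T ⊗ (1+ 5 · t) ≈ K → even T ≈ F ⊞ const (+ 10) ⊗ (q ⊗ G)
even-T T T-t = V-injective (⊗-cancelʳ (1+ 5 · r) (1+-zero 5 {r} r-zero) (const-cancel (+ 2)
  (≈-trans (combine (⊞-ν T) (combine T-t (combine T-s (combine 1+5t*1+5s (combine t+s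
    (solve 7 (λ X T T′ K t s r →
      :combination (con (+ 2) :* (X :* :1+ 5 r)) (con (+ 2) :* ((K :+ con (+ 10) :* (K :* r)) :* :1+ 5 r))
      ( (:- :1+ 5 r , T :+ T′ , con (+ 2) :* X)
      ∷ (:1+ 5 s , T :* :1+ 5 t , K)
      ∷ (:1+ 5 t , T′ :* :1+ 5 s , K)
      ∷ (:- (T :+ T′) , :1+ 5 t :* :1+ 5 s , :1+ 5 r)
      ∷ (con (+ 5) :* K , t :+ s , con (+ 6) :* r :+ con (+ 20) :* r :* r)
      ∷ []))
    ≈-refl (V (even T)) T (ν T) K t s r))))))
  (⊗-cong ≈-refl (⊗-cong (≈-sym expand) ≈-refl)))))
  where
  T-s : ν T ⊗ (1+ 5 · s) ≈ K
  T-s = ≈-trans (⊗-cong ≈-refl (≈-sym (ν-1+ 5 t))) (≈-trans (≈-sym (ν-⊗ T (1+ 5 · t))) (≈-trans (ν-cong T-t) ν-K))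
  expand : V (F ⊞ const (+ 10) ⊗ (q ⊗ G)) ≈ K ⊞ const (+ 10) ⊗ (K ⊗ r)
  expand = ≈-trans (V-⊞ F _) (⊞-cong V-F (≈-trans (V-⊗ (const (+ 10)) _) (⊗-cong (V-const (+ 10))
    (≈-trans (V-⊗ q G) (≈-trans (⊗-cong V-q ≈-refl) (≈-sym V-F*t))))))

-- As for `even-T`: the symmetric function is now 2 + 9(t + s) + 40ts = 2(1 + 5r)(1 + 2r).
even-G : even G ≈ F ⊞ const (+ 2) ⊗ (q ⊗ G)
even-G = V-injective (⊗-cancelʳ (1+ 5 · r) (1+-zero 5 {r} r-zero) (const-cancel (+ 2)
  (≈-trans (combine (⊞-ν G) (combine G*1+5t (combine G-s (combine 1+5t*1+5s (combine t+s (combine t*s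
    (solve 7 (λ X G G′ K t s r →
      :combination (con (+ 2) :* (X :* :1+ 5 r)) (con (+ 2) :* ((K :+ con (+ 2) :* (K :* r)) :* :1+ 5 r))
      ( (:- :1+ 5 r , G :+ G′ , con (+ 2) :* X)
      ∷ (:1+ 5 s , G :* :1+ 5 t , K :* :1+ 4 t)
      ∷ (:1+ 5 t , G′ :* :1+ 5 s , K :* :1+ 4 s)
      ∷ (:- (G :+ G′) , :1+ 5 t :* :1+ 5 s , :1+ 5 r)
      ∷ (con (+ 9) :* K , t :+ s , con (+ 6) :* r :+ con (+ 20) :* r :* r)
      ∷ (con (+ 40) :* K , t :* s , :- (r :* :1+ 4 r))
      ∷ []))
    ≈-refl (V (even G)) G (ν G) K t s r)))))))
  (⊗-cong ≈-refl (⊗-cong (≈-sym expand) ≈-refl)))))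
  where
  G-s : ν G ⊗ (1+ 5 · s) ≈ K ⊗ (1+ 4 · s)
  G-s = ≈-trans (⊗-cong ≈-refl (≈-sym (ν-1+ 5 t))) (≈-trans (≈-sym (ν-⊗ G (1+ 5 · t))) (≈-trans (ν-cong G*1+5t)
    (≈-trans (ν-⊗ K (1+ 4 · t)) (⊗-cong ν-K (ν-1+ 4 t)))))
  expand : V (F ⊞ const (+ 2) ⊗ (q ⊗ G)) ≈ K ⊞ const (+ 2) ⊗ (K ⊗ r)
  expand = ≈-trans (V-⊞ F _) (⊞-cong V-F (≈-trans (V-⊗ (const (+ 2)) _) (⊗-cong (V-const (+ 2))
    (≈-trans (V-⊗ q G) (≈-trans (⊗-cong V-q ≈-refl) (≈-sym V-F*t))))))

-- Subtracting the equation at -q gives (M - M(-q))ts = qK(t + s + 8ts) = -2qrK(1 + 6r), hence V(odd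
-- M)(1 + 4r) = K(1 + 6r). Now 1 + 6r = (1 + 4r)(1 + 10r) - 8r(1 + 5r), and `V-F*t*1+5t` turns the
-- last term into -8q²K(q²)(1 + 4r).
odd-M : ∀ M → M ⊗ t ≈ q ⊗ K ⊗ (1+ 4 · t) →
  odd M ≈ F ⊞ ⊟ (const (+ 8) ⊗ (q ⊗ K)) ⊞ const (+ 10) ⊗ (q ⊗ G)
odd-M M M-t = V-injective (⊗-cancelʳ (1+ 4 · r) (1+-zero 4 {r} r-zero) (r-cancel (q-cancel (const-cancel (+ 2)
  (≈-trans (combine (⊟-ν M) (combine t*s (combine M-t (combine M-s (combine t+s (combine V-F*t*1+5t
    (solve 9 (λ X M M′ K K′ q t s r →
      :combination (con (+ 2) :* (q :* (r :* (X :* :1+ 4 r))))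
        (con (+ 2) :* (q :* (r :* ((K :- con (+ 8) :* (q :* q :* K′) :+ con (+ 10) :* (K :* r)) :* :1+ 4 r))))
      ( (:- (r :* :1+ 4 r) , M :- M′ , con (+ 2) :* (q :* X))
      ∷ (M :- M′ :- con (+ 8) :* q :* K , t :* s , :- (r :* :1+ 4 r))
      ∷ (:- s , M :* t , q :* K :* :1+ 4 t)
      ∷ (t , M′ :* s , (:- q) :* K :* :1+ 4 s)
      ∷ (:- (q :* K) , t :+ s , con (+ 6) :* r :+ con (+ 20) :* r :* r)
      ∷ (:- (con (+ 16) :* q :* r) , K :* r :* :1+ 5 r , q :* q :* K′ :* :1+ 4 r)
      ∷ []))
    ≈-refl (V (odd M)) M (ν M) K (V K) q t s r)))))))
  (⊗-cong ≈-refl (⊗-cong ≈-refl (⊗-cong ≈-refl (⊗-cong (≈-sym expand) ≈-refl)))))))))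
  where
  M-s : ν M ⊗ s ≈ ⊟ q ⊗ K ⊗ (1+ 4 · s)
  M-s = ≈-trans (≈-sym (ν-⊗ M t)) (≈-trans (ν-cong M-t) ν-q*K)
  expand : V (F ⊞ ⊟ (const (+ 8) ⊗ (q ⊗ K)) ⊞ const (+ 10) ⊗ (q ⊗ G))
    ≈ K ⊞ ⊟ (const (+ 8) ⊗ (q ⊗ q ⊗ V K)) ⊞ const (+ 10) ⊗ (K ⊗ r)
  expand = ≈-trans (V-⊞ _ _) (⊞-cong
    (≈-trans (V-⊞ F _) (⊞-cong V-F (≈-trans (V-⊟ _) (⊟-cong (≈-trans (V-⊗ (const (+ 8)) _) (⊗-cong (V-const (+ 8))
      (≈-trans (V-⊗ q K) (⊗-cong V-q ≈-refl))))))))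
    (≈-trans (V-⊗ (const (+ 10)) _) (⊗-cong (V-const (+ 10))
      (≈-trans (V-⊗ q G) (≈-trans (⊗-cong V-q ≈-refl) (≈-sym V-F*t))))))

-- As for `odd-M`: here V(odd F)(1 + 4r) = -4K(1 + 6r + 10r²), and -4(1 + 6r + 10r²) = -4(1 + 4r) -
-- 8r(1 + 5r).
odd-F : odd F ≈ ⊟ (const (+ 4) ⊗ F) ⊞ ⊟ (const (+ 8) ⊗ (q ⊗ K))
odd-F = V-injective (⊗-cancelʳ ((1+ 4 · r) ⊗ (1+ 5 · r)) (⊗-zero-one {1+ 4 · r} (1+-zero 4 {r} r-zero) (1+-zero 5 {r} r-zero))
  (r-cancel (q-cancel (const-cancel (+ 2)
  (≈-trans (combine (⊟-ν F) (combine 1+5t*1+5s (combine t*s (combine F*t*1+5t (combine F-s (combine t+s (combine V-F*t*1+5t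
    (solve 9 (λ X F F′ K K′ q t s r →
      let k = :1+ 4 r ; g = :1+ 5 r ; σ₀ = con (+ 6) :* r :+ con (+ 20) :* r :* r in
      :combination (con (+ 2) :* (q :* (r :* (X :* (k :* g)))))
        (con (+ 2) :* (q :* (r :* ((:- (con (+ 4) :* K) :- con (+ 8) :* (q :* q :* K′)) :* (k :* g)))))
      ( (:- (r :* k :* g) , F :- F′ , con (+ 2) :* (q :* X))
      ∷ (:- ((F :- F′) :* k :* r) , :1+ 5 t :* :1+ 5 s , g)
      -- With σ = t + s and p = ts, the symmetric function is σ + 5σ² - 2p + 20pσ. Its difference
      -- quotients in σ (from σ to `σ₀`) and then in p occur in the cofactors of t + s and of ts.
      ∷ ((F :- F′) :* :1+ 5 t :* :1+ 5 s :- q :* K :* (con (+ 20) :* σ₀ :- con (+ 2)) , t :* s , :- (r :* k))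
      ∷ (:- (s :* :1+ 5 s) , F :* t :* :1+ 5 t , q :* K :* :1+ 4 t)
      ∷ (t :* :1+ 5 t , F′ :* s :* :1+ 5 s , (:- q) :* K :* :1+ 4 s)
      ∷ (:- (q :* K :* (con 1ℤ :+ con (+ 5) :* (t :+ s :+ σ₀) :+ con (+ 20) :* t :* s)) , t :+ s , σ₀)
      ∷ (:- (con (+ 16) :* q :* r :* g) , K :* r :* g , q :* q :* K′ :* k)
      ∷ []))
    ≈-refl (V (odd F)) F (ν F) K (V K) q t s r))))))))
  (⊗-cong ≈-refl (⊗-cong ≈-refl (⊗-cong ≈-refl (⊗-cong (≈-sym expand) ≈-refl)))))))))
  where
  F-s : ν F ⊗ s ⊗ (1+ 5 · s) ≈ ⊟ q ⊗ K ⊗ (1+ 4 · s)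
  F-s = ≈-trans (⊗-cong (≈-sym (ν-⊗ F t)) (≈-sym (ν-1+ 5 t))) (≈-trans (≈-sym (ν-⊗ (F ⊗ t) (1+ 5 · t)))
    (≈-trans (ν-cong F*t*1+5t) ν-q*K))
  expand : V (⊟ (const (+ 4) ⊗ F) ⊞ ⊟ (const (+ 8) ⊗ (q ⊗ K)))
    ≈ ⊟ (const (+ 4) ⊗ K) ⊞ ⊟ (const (+ 8) ⊗ (q ⊗ q ⊗ V K))
  expand = ≈-trans (V-⊞ _ _) (⊞-cong
    (≈-trans (V-⊟ _) (⊟-cong (≈-trans (V-⊗ (const (+ 4)) F) (⊗-cong (V-const (+ 4)) V-F))))
    (≈-trans (V-⊟ _) (⊟-cong (≈-trans (V-⊗ (const (+ 8)) _) (⊗-cong (V-const (+ 8))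
      (≈-trans (V-⊗ q K) (⊗-cong V-q ≈-refl)))))))

-- The recurrence

⊛≈⊗ : ∀ {a a′ b b′} → a ≈ a′ → b ≈ b′ → a ⊛ b ≈ a′ ⊗ b′
⊛≈⊗ {a} {a′} {b} {b′} p r = ≈-trans (≈-sym (⊗-def a b)) (⊗-cong p r)

^ˢ≈^ : ∀ {a b} k → a ≈ b → a ^ˢ k ≈ b ^^ k
^ˢ≈^ zero    p = ≈-refl
^ˢ≈^ {a} {b} (suc k) p = ⊛≈⊗ {a} {b} {a ^ˢ k} {b ^^ k} p (^ˢ≈^ k p)

f^≈η^ : ∀ m k → f m ^ˢ k ≈ η m ^^ k
f^≈η^ m k = ^ˢ≈^ {f m} {η m} k (f≈η m)

f^⊛f^ : ∀ m j n k → (f m ^ˢ j) ⊛ (f n ^ˢ k) ≈ η m ^^ j ⊗ η n ^^ k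
f^⊛f^ m j n k = ⊛≈⊗ {f m ^ˢ j} {η m ^^ j} {f n ^ˢ k} {η n ^^ k} (f^≈η^ m j) (f^≈η^ n k)

f-product≈G : f 1 ⊛ f 2 ⊛ (f 5 ^ˢ 3) ⊛ (f 10 ^ˢ 3) ≈ G
f-product≈G = ⊛≈⊗ {f 1 ⊛ f 2 ⊛ (f 5 ^ˢ 3)} {η 1 ⊗ η 2 ⊗ η 5 ^^ 3} {f 10 ^ˢ 3} {η 10 ^^ 3}
  (⊛≈⊗ {f 1 ⊛ f 2} {η 1 ⊗ η 2} {f 5 ^ˢ 3} {η 5 ^^ 3} (⊛≈⊗ {f 1} {η 1} {f 2} {η 2} (f≈η 1) (f≈η 2)) (f^≈η^ 5 3))
  (f^≈η^ 10 3)

-- These combinations are closed under taking odd parts. The 8 is split off so that `b` is simply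
-- the preceding value of `a`.
FKG : ℤ → ℤ → ℤ → Series
FKG a b c = const a ⊗ F ⊞ ⊟ (const (+ 8 ℤ.* b) ⊗ (q ⊗ K)) ⊞ const c ⊗ (q ⊗ G)

odd-scale : ∀ c a → odd (const c ⊗ a) ≈ const c ⊗ odd a
odd-scale c a = pointwise λ n → trans (odd-at (const c ⊗ a) n) (trans (const-⊗-at c a (suc (dbl n)))
  (sym (trans (const-⊗-at c (odd a) n) (cong (c ℤ.*_) (odd-at a n)))))

odd-⊟ : ∀ a → odd (⊟ a) ≈ ⊟ odd a
odd-⊟ a = pointwise λ n → trans (odd-at (⊟ a) n) (trans (⊟-at a (suc (dbl n)))
  (sym (trans (⊟-at (odd a) n) (cong ℤ.-_ (odd-at a n)))))

-- The odd part of q K is even K = F, and that of q G is even G = F + 2q G. With `odd-F` this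
-- collects to the recurrence shared by A, B and C, while the coefficient of q G doubles.
odd-FKG : ∀ a b c → odd (FKG a b c) ≈ FKG (ℤ.- (+ 4) ℤ.* a ℤ.- + 8 ℤ.* b ℤ.+ c) a (+ 2 ℤ.* c)
odd-FKG a b c = begin
  odd (FKG a b c)
    ≈⟨ ≈-trans (odd-⊞ _ _) (⊞-cong (≈-trans (odd-⊞ _ _) (⊞-cong (odd-scale a F)
         (≈-trans (odd-⊟ _) (⊟-cong (≈-trans (odd-scale (+ 8 ℤ.* b) (q ⊗ K)) (⊗-cong ≈-refl (odd-q K))))))) (≈-trans (odd-scale c (q ⊗ G)) (⊗-cong ≈-refl (odd-q G)))) ⟩
  const a ⊗ odd F ⊞ ⊟ (const (+ 8 ℤ.* b) ⊗ even K) ⊞ const c ⊗ even G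
    ≈⟨ ⊞-cong (⊞-cong (⊗-cong ≈-refl odd-F) (⊟-cong (⊗-cong (const-⊗ (+ 8) b) (≈-trans (even-cong (≈-sym V-F)) (even-V F))))) (⊗-cong ≈-refl even-G) ⟩
  const a ⊗ (⊟ (const (+ 4) ⊗ F) ⊞ ⊟ (const (+ 8) ⊗ (q ⊗ K))) ⊞ ⊟ (const (+ 8) ⊗ const b ⊗ F)
    ⊞ const c ⊗ (F ⊞ const (+ 2) ⊗ (q ⊗ G))
    ≈⟨ solve 6 (λ a b c F qK qG →
         a :* (:- (con (+ 4) :* F) :+ :- (con (+ 8) :* qK)) :+ :- (con (+ 8) :* b :* F) :+ c :* (F :+ con (+ 2) :* qG)
         := (con (ℤ.- (+ 4)) :* a :+ :- (con (+ 8) :* b) :+ c) :* F :+ :- (con (+ 8) :* a :* qK) :+ con (+ 2) :* c :* qG)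
         ≈-refl (const a) (const b) (const c) F (q ⊗ K) (q ⊗ G) ⟩
  (const (ℤ.- (+ 4)) ⊗ const a ⊞ ⊟ (const (+ 8) ⊗ const b) ⊞ const c) ⊗ F
    ⊞ ⊟ (const (+ 8) ⊗ const a ⊗ (q ⊗ K)) ⊞ const (+ 2) ⊗ const c ⊗ (q ⊗ G)
    ≈⟨ ⊞-cong (⊞-cong (⊗-cong (≈-sym (≈-trans (const-⊞ (ℤ.- (+ 4) ℤ.* a ℤ.- + 8 ℤ.* b) c) (⊞-cong
         (≈-trans (const-⊞ (ℤ.- (+ 4) ℤ.* a) (ℤ.- (+ 8 ℤ.* b))) (⊞-cong (const-⊗ (ℤ.- (+ 4)) a)
           (≈-trans (const-⊟ (+ 8 ℤ.* b)) (⊟-cong (const-⊗ (+ 8) b))))) ≈-refl))) ≈-refl)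
         (⊟-cong (⊗-cong (≈-sym (const-⊗ (+ 8) a)) ≈-refl))) (⊗-cong (≈-sym (const-⊗ (+ 2) c)) ≈-refl) ⟩
  FKG (ℤ.- (+ 4) ℤ.* a ℤ.- + 8 ℤ.* b ℤ.+ c) a (+ 2 ℤ.* c) ∎
  where open ≈R

FKG-cong : ∀ {a a′ b b′ c c′} → a ≡ a′ → b ≡ b′ → c ≡ c′ → FKG a b c ≈ FKG a′ b′ c′
FKG-cong refl refl refl = ≈-refl

qTimes-· : ∀ c a m → qTimes (c · a) m ≡ c ℤ.* qTimes a m
qTimes-· c a zero    = sym (ℤₚ.*-zeroʳ c)
qTimes-· c a (suc m) = refl

scaled-q : ∀ c {a b} → a ≈ b → ∀ m → qTimes (c · a) m ≡ (const c ⊗ (q ⊗ b)) m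
scaled-q c {a} {b} p m = trans (qTimes-· c a m) (sym (trans (const-⊗-at c (q ⊗ b) m)
  (cong (c ℤ.*_) (at (≈-trans (≈-sym (qTimes≈ b)) (qTimes-cong (≈-sym p))) m))))

FKG-at : ∀ a b c m → FKG a b c m ≡
  (a · ((f 1 ^ˢ 4) ⊛ (f 5 ^ˢ 4)) ⊖ qTimes ((+ 8 ℤ.* b) · ((f 2 ^ˢ 4) ⊛ (f 10 ^ˢ 4)))
    ⊕ qTimes (c · (f 1 ⊛ f 2 ⊛ (f 5 ^ˢ 3) ⊛ (f 10 ^ˢ 3)))) m
FKG-at a b c m = trans (⊞-at (const a ⊗ F ⊞ ⊟ (const (+ 8 ℤ.* b) ⊗ (q ⊗ K))) _ m) (cong₂ ℤ._+_
  (trans (⊞-at (const a ⊗ F) _ m) (cong₂ ℤ._+_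
    (trans (const-⊗-at a F m) (cong (a ℤ.*_) (sym (at (f^⊛f^ 1 4 5 4) m))))
    (trans (⊟-at (const (+ 8 ℤ.* b) ⊗ (q ⊗ K)) m) (cong ℤ.-_ (sym (scaled-q (+ 8 ℤ.* b) (f^⊛f^ 2 4 10 4) m))))))
  (sym (scaled-q c f-product≈G m)))

dbl≡2* : ∀ n → dbl n ≡ 2 ℕ.* n
dbl≡2* zero    = refl
dbl≡2* (suc n) = trans (cong (λ m → suc (suc m)) (dbl≡2* n)) (lem n)
  where
  lem : ∀ n → suc (suc (2 ℕ.* n)) ≡ 2 ℕ.* suc n
  lem = ℕ-Solver.solve-∀

-- At m = n + 1 the index is 2^k n + 2^(k+1) - d, with d = 1 for M and P and d = 2 for T.
progression : ℕ → Series → ℕ → Series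
progression d a k m = a (2 ℕ.^ k ℕ.* m ℕ.+ (2 ℕ.^ k ∸ d))

-- Replacing m by 2m + 1 turns 2^k m + 2^k - d into 2^(k+1) m + 2^(k+1) - d, for either d. The bound
-- keeps the subtraction exact; for d = 2 the step to k = 1 is excluded and takes the even part
-- instead.
progression-suc : ∀ d a k → d ≤ 2 ℕ.^ k → progression d a (suc k) ≈ odd (progression d a k)
progression-suc d a k d≤2^k = pointwise λ m → trans (cong a (index m)) (sym (odd-at (progression d a k) m))
  where
  open ≡-Reasoning
  index : ∀ m → 2 ℕ.^ suc k ℕ.* m ℕ.+ (2 ℕ.^ suc k ∸ d) ≡ 2 ℕ.^ k ℕ.* suc (dbl m) ℕ.+ (2 ℕ.^ k ∸ d)
  index m with ℕₚ.m≤n⇒∃[o]m+o≡n d≤2^k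
  ... | o , e rewrite sym e | dbl≡2* m = begin
    2 ℕ.* (d ℕ.+ o) ℕ.* m ℕ.+ (2 ℕ.* (d ℕ.+ o) ∸ d)
      ≡⟨ cong (λ x → 2 ℕ.* (d ℕ.+ o) ℕ.* m ℕ.+ (x ∸ d)) (lem₁ d o) ⟩
    2 ℕ.* (d ℕ.+ o) ℕ.* m ℕ.+ (d ℕ.+ (d ℕ.+ o ℕ.+ o) ∸ d)
      ≡⟨ cong (2 ℕ.* (d ℕ.+ o) ℕ.* m ℕ.+_) (ℕₚ.m+n∸m≡n d (d ℕ.+ o ℕ.+ o)) ⟩
    2 ℕ.* (d ℕ.+ o) ℕ.* m ℕ.+ (d ℕ.+ o ℕ.+ o)
      ≡⟨ lem₂ d o m ⟩
    (d ℕ.+ o) ℕ.* suc (2 ℕ.* m) ℕ.+ o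
      ≡⟨ cong ((d ℕ.+ o) ℕ.* suc (2 ℕ.* m) ℕ.+_) (sym (ℕₚ.m+n∸m≡n d o)) ⟩
    (d ℕ.+ o) ℕ.* suc (2 ℕ.* m) ℕ.+ (d ℕ.+ o ∸ d) ∎
    where
    lem₁ : ∀ d o → 2 ℕ.* (d ℕ.+ o) ≡ d ℕ.+ (d ℕ.+ o ℕ.+ o)
    lem₁ = ℕ-Solver.solve-∀
    lem₂ : ∀ d o m → 2 ℕ.* (d ℕ.+ o) ℕ.* m ℕ.+ (d ℕ.+ o ℕ.+ o) ≡ (d ℕ.+ o) ℕ.* suc (2 ℕ.* m) ℕ.+ o
    lem₂ = ℕ-Solver.solve-∀

progression-1-1 : ∀ a → progression 1 a 1 ≈ odd a
progression-1-1 a = pointwise λ m → trans (cong a (trans (ℕₚ.+-comm (2 ℕ.* m) 1) (cong suc (sym (dbl≡2* m))))) (sym (odd-at a m))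

progression-2-1 : ∀ a → progression 2 a 1 ≈ even a
progression-2-1 a = pointwise λ m → trans (cong a (trans (ℕₚ.+-identityʳ (2 ℕ.* m)) (sym (dbl≡2* m)))) (sym (even-at a m))

-- A, B and C satisfy the same recurrence, with e = 5, 5 and 0.
progression-FKG : ∀ d S (X : ℕ → ℤ) e → d ≤ 2 →
  (∀ k → X (suc (suc k)) ≡ ℤ.- (+ 4) ℤ.* X (suc k) ℤ.- + 8 ℤ.* X k ℤ.+ + (e ℕ.* 2 ℕ.^ suc k)) →
  progression d S 1 ≈ FKG (X 1) (X 0) (+ (e ℕ.* 2)) →
  ∀ k → progression d S (suc k) ≈ FKG (X (suc k)) (X k) (+ (e ℕ.* 2 ℕ.^ suc k))
progression-FKG d S X e d≤2 recurrence base zero    = base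
progression-FKG d S X e d≤2 recurrence base (suc k) = begin
  progression d S (suc (suc k))
    ≈⟨ progression-suc d S (suc k) (ℕₚ.≤-trans d≤2 (ℕₚ.m≤m*n 2 (2 ℕ.^ k) {{ℕₚ.m^n≢0 2 k}})) ⟩
  odd (progression d S (suc k))
    ≈⟨ odd-cong (progression-FKG d S X e d≤2 recurrence base k) ⟩
  odd (FKG (X (suc k)) (X k) (+ (e ℕ.* 2 ℕ.^ suc k)))
    ≈⟨ odd-FKG (X (suc k)) (X k) (+ (e ℕ.* 2 ℕ.^ suc k)) ⟩
  FKG (ℤ.- (+ 4) ℤ.* X (suc k) ℤ.- + 8 ℤ.* X k ℤ.+ + (e ℕ.* 2 ℕ.^ suc k)) (X (suc k)) (+ 2 ℤ.* + (e ℕ.* 2 ℕ.^ suc k))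
    ≈⟨ FKG-cong (sym (recurrence k)) refl (trans (sym (ℤₚ.pos-* 2 (e ℕ.* 2 ℕ.^ suc k))) (cong +_ (lem e (2 ℕ.^ suc k)))) ⟩
  FKG (X (suc (suc k))) (X (suc k)) (+ (e ℕ.* 2 ℕ.^ suc (suc k))) ∎
  where
  open ≈R
  lem : ∀ e x → 2 ℕ.* (e ℕ.* x) ≡ e ℕ.* (2 ℕ.* x)
  lem = ℕ-Solver.solve-∀

theorem3p1 : (M T P : Series)
    → (∀ n → (M ⊛ f 1 ⊛ f 10) n ≡ ((f 2 ^ˢ 5) ⊛ (f 5 ^ˢ 5)) n)
    → (∀ n → (T ⊛ f 2 ⊛ f 5) n ≡ ((f 1 ^ˢ 5) ⊛ (f 10 ^ˢ 5)) n)
    → (∀ n → P n ≡ ((f 1 ^ˢ 4) ⊛ (f 5 ^ˢ 4)) n)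
    → (k : ℕ) → 1 ≤ k
    → (∀ m → M (2 ^ k *ℕ m +ℕ (2 ^ k ∸ 1))
    ≡ (A k · ((f 1 ^ˢ 4) ⊛ (f 5 ^ˢ 4))
    ⊖ qTimes ((+ 8 *ℤ A (k ∸ 1)) · ((f 2 ^ˢ 4) ⊛ (f 10 ^ˢ 4)))
    ⊕ qTimes ((+ (5 *ℕ 2 ^ k)) · (f 1 ⊛ f 2 ⊛ (f 5 ^ˢ 3) ⊛ (f 10 ^ˢ 3)))) m)
    × (∀ m → T (2 ^ k *ℕ m +ℕ (2 ^ k ∸ 2))
    ≡ (B k · ((f 1 ^ˢ 4) ⊛ (f 5 ^ˢ 4))
    ⊖ qTimes ((+ 8 *ℤ B (k ∸ 1)) · ((f 2 ^ˢ 4) ⊛ (f 10 ^ˢ 4)))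
    ⊕ qTimes ((+ (5 *ℕ 2 ^ k)) · (f 1 ⊛ f 2 ⊛ (f 5 ^ˢ 3) ⊛ (f 10 ^ˢ 3)))) m)
    × (∀ m → P (2 ^ k *ℕ m +ℕ (2 ^ k ∸ 1))
    ≡ (C k · ((f 1 ^ˢ 4) ⊛ (f 5 ^ˢ 4))
    ⊖ qTimes ((+ 8 *ℤ C (k ∸ 1)) · ((f 2 ^ˢ 4) ⊛ (f 10 ^ˢ 4)))) m)
theorem3p1 M T P M-def T-def P-def (suc k) _ =
  (λ m → trans (at (progression-FKG 1 M A 5 (s≤s z≤n) (recurrence A (λ _ → refl)) M-base k) m)
           (FKG-at (A (suc k)) (A k) (+ (5 ℕ.* 2 ℕ.^ suc k)) m)) ,
  (λ m → trans (at (progression-FKG 2 T B 5 (s≤s (s≤s z≤n)) (recurrence B (λ _ → refl)) T-base k) m)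
           (FKG-at (B (suc k)) (B k) (+ (5 ℕ.* 2 ℕ.^ suc k)) m)) ,
  (λ m → trans (at (progression-FKG 1 P C 0 (s≤s z≤n) (λ _ → sym (ℤₚ.+-identityʳ _)) P-base k) m)
           (trans (FKG-at (C (suc k)) (C k) 0ℤ m) (trans
             (cong (ℤ._+_ (main m)) (qTimes-0 (f 1 ⊛ f 2 ⊛ (f 5 ^ˢ 3) ⊛ (f 10 ^ˢ 3)) m))
             (ℤₚ.+-identityʳ (main m)))))
  where
  open ≈R
  recurrence : ∀ (X : ℕ → ℤ) →
    (∀ k → X (suc (suc k)) ≡ ℤ.- (+ 4) ℤ.* X (suc k) ℤ.- + 8 ℤ.* X k ℤ.+ + 5 ℤ.* + (2 ℕ.^ suc k)) →
    ∀ k → X (suc (suc k)) ≡ ℤ.- (+ 4) ℤ.* X (suc k) ℤ.- + 8 ℤ.* X k ℤ.+ + (5 ℕ.* 2 ℕ.^ suc k)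
  recurrence X e k = trans (e k) (cong (ℤ._+_ (ℤ.- (+ 4) ℤ.* X (suc k) ℤ.- + 8 ℤ.* X k)) (sym (ℤₚ.pos-* 5 (2 ℕ.^ suc k))))
  main : ℕ → ℤ
  main = C (suc k) · ((f 1 ^ˢ 4) ⊛ (f 5 ^ˢ 4)) ⊖ qTimes ((+ 8 ℤ.* C k) · ((f 2 ^ˢ 4) ⊛ (f 10 ^ˢ 4)))
  qTimes-0 : ∀ a m → qTimes (0ℤ · a) m ≡ 0ℤ
  qTimes-0 a m = trans (qTimes-· 0ℤ a m) (ℤₚ.*-zeroˡ (qTimes a m))
  M-base : progression 1 M 1 ≈ FKG 1ℤ 1ℤ (+ 10)
  M-base = begin
    progression 1 M 1
      ≈⟨ progression-1-1 M ⟩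
    odd M
      ≈⟨ odd-M M (M*t M (≈-trans (≈-sym (⊛≈⊗ {M ⊛ f 1} {M ⊗ η 1} {f 10} {η 10} (⊛≈⊗ {M} {M} {f 1} {η 1} ≈-refl (f≈η 1)) (f≈η 10)))
           (≈-trans (pointwise M-def) (f^⊛f^ 2 5 5 5)))) ⟩
    F ⊞ ⊟ (const (+ 8) ⊗ (q ⊗ K)) ⊞ const (+ 10) ⊗ (q ⊗ G)
      ≈⟨ solve 3 (λ F qK qG → F :- con (+ 8) :* qK :+ con (+ 10) :* qG := con 1ℤ :* F :- con (+ 8) :* qK :+ con (+ 10) :* qG)
           ≈-refl F (q ⊗ K) (q ⊗ G) ⟩
    FKG 1ℤ 1ℤ (+ 10) ∎
  T-base : progression 2 T 1 ≈ FKG 1ℤ 0ℤ (+ 10)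
  T-base = begin
    progression 2 T 1
      ≈⟨ progression-2-1 T ⟩
    even T
      ≈⟨ even-T T (T*1+5t T (≈-trans (≈-sym (⊛≈⊗ {T ⊛ f 2} {T ⊗ η 2} {f 5} {η 5} (⊛≈⊗ {T} {T} {f 2} {η 2} ≈-refl (f≈η 2)) (f≈η 5)))
           (≈-trans (pointwise T-def) (f^⊛f^ 1 5 10 5)))) ⟩
    F ⊞ const (+ 10) ⊗ (q ⊗ G)
      ≈⟨ solve 3 (λ F qK qG → F :+ con (+ 10) :* qG := con 1ℤ :* F :- con 0ℤ :* qK :+ con (+ 10) :* qG)
           ≈-refl F (q ⊗ K) (q ⊗ G) ⟩
    FKG 1ℤ 0ℤ (+ 10) ∎
  P-base : progression 1 P 1 ≈ FKG (ℤ.- (+ 4)) 1ℤ 0ℤ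
  P-base = begin
    progression 1 P 1
      ≈⟨ progression-1-1 P ⟩
    odd P
      ≈⟨ odd-cong (≈-trans (pointwise P-def) (f^⊛f^ 1 4 5 4)) ⟩
    odd F
      ≈⟨ odd-F ⟩
    ⊟ (const (+ 4) ⊗ F) ⊞ ⊟ (const (+ 8) ⊗ (q ⊗ K))
      ≈⟨ solve 3 (λ F qK qG → :- (con (+ 4) :* F) :- con (+ 8) :* qK := con (ℤ.- (+ 4)) :* F :- con (+ 8) :* qK :+ con 0ℤ :* qG)
           ≈-refl F (q ⊗ K) (q ⊗ G) ⟩
    FKG (ℤ.- (+ 4)) 1ℤ 0ℤ ∎
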